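{- Let $\Delta$ be an edge-transitive connected bipartite graph with given bipartition $X\cup Y$. The digraph $DL(\Delta)$ is connected-homogeneous if and only if $\Delta$ is isomorphic to one of: a cycle $C_m$ ($m$ even), an infinite semiregular tree $T_{a,b}$ ($a,b\in\mathbb{N}$), a complete bipartite graph $K_{m,n}$ ($m,n\in\mathbb{N}$), or the complement of a perfect matching.
   Context: A digraph is a set with an irreflexive antisymmetric arc relation; it is connected-homogeneous if every isomorphism between finite induced subdigraphs whose underlying graphs are connected extends to an automorphism. Construction $DL(\Delta)$: let $T$ be a directed tree in which every vertex has in-degree $|X|$ and out-degree $|Y|$; for each $t\in VT$ fix bijections $\varphi_t$ from the in-neighbours of $t$ to $X$ and $\psi_t$ from the out-neighbours of $t$ to $Y$. $DL(\Delta)$ has vertex set the arc set $ET$, and $((a,b),(c,d))$ is an arc iff $b=c$ and $\{\psi_b(a),\varphi_b(d)\}$ is an edge of $\Delta$; by edge-transitivity of $\Delta$ this is independent of the chosen bijections up to isomorphism. $T_{a,b}$ denotes the infinite tree in which vertices in one part of the bipartition have degree $a$ and those in the other have degree $b$. The complement of a perfect matching on $2n$ vertices has parts $X',Y'$ of size $n$, a bijection $\eta:X'\to Y'$, and $x\sim y$ iff $y\ne\eta(x)$.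
   Formalization: Δ is assumed locally finite: otherwise the complete bipartite graph with both parts countably infinite gives a connected-homogeneous DL(Δ) but is not listed. The arc rule is read with φ_b(a), ψ_b(d), the only well-typed form. -}

module Defs where

open import Data.Bool.Base using (Bool; if_then_else_)
open import Data.Empty using (⊥)
open import Data.Fin.Base using (Fin; toℕ)
open import Data.Nat.Base using (ℕ; suc; _≤_; s≤s)
open import Data.Nat.Properties using (≡-irrelevant)
open import Data.Product.Base using (Σ; ∃-syntax; _×_; _,_; proj₁; proj₂)
open import Data.Sum.Base using (_⊎_; inj₁; inj₂; swap)
open import Data.Unit.Base using (⊤)
open import Function.Bundles using (_↔_; _⇔_; module Inverse)
open import Function.Definitions using (Injective)
open import Level using (0ℓ)
open import Relation.Binary.Construct.Closure.ReflexiveTransitive using (Star)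
open import Relation.Binary.Core using (Rel)
open import Relation.Binary.Definitions using (Asymmetric; Irreflexive; Symmetric)
import Relation.Binary.Definitions as Binary
open import Relation.Binary.PropositionalEquality
  using (_≡_; _≢_; refl; sym; trans; cong; cong₂)
open import Relation.Nullary using (¬_; contradiction)
import Relation.Unary as Unary

-- Throughout, relations and predicates are required to be proof-irrelevant
-- (i.e. they are genuine subsets), so that arcs, neighbourhoods and induced
-- subdigraphs can be formed as Σ-types and counted with _≡_.

Finite : Set → Set
Finite A = ∃[ n ] (A ↔ Fin n)

Infinite : Set → Set
Infinite A = ¬ Finite A

record RelIso {A B : Set} (R : Rel A 0ℓ) (S : Rel B 0ℓ) : Set where
  field
    bijection : A ↔ B
  open Inverse bijection public using (to; from)
  field
    preserves : ∀ {x y} → R x y ⇔ S (to x) (to y)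

record Graph : Set₁ where
  infix 4 _~_
  field
    V            : Set
    _~_          : Rel V 0ℓ
    ~-sym        : Symmetric _~_
    ~-irrefl     : Irreflexive _≡_ _~_
    ~-irrelevant : Binary.Irrelevant _~_

infix 4 _≅_
_≅_ : Graph → Graph → Set
Γ ≅ Γ′ = RelIso (Graph._~_ Γ) (Graph._~_ Γ′)

module _ (Γ : Graph) where
  open Graph Γ

  Connected : Set
  Connected = V × (∀ u v → Star _~_ u v)

  Neighbours : V → Set
  Neighbours v = ∃[ u ] (v ~ u)

  HasDegree : V → ℕ → Set
  HasDegree v d = Neighbours v ↔ Fin d

  -- Excludes for instance K_{m,n} with m or n infinite; Γ may still be infinite.
  LocallyFinite : Set
  LocallyFinite = ∀ v → Finite (Neighbours v)

  EdgeTransitive : Set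
  EdgeTransitive = ∀ {u v u′ v′} → u ~ v → u′ ~ v′ →
    Σ (Γ ≅ Γ) λ g → let open RelIso g in
      (to u ≡ u′ × to v ≡ v′) ⊎ (to u ≡ v′ × to v ≡ u′)

module _ {m : ℕ} where

  -- j = i + 1 modulo m
  Next : Rel (Fin m) 0ℓ
  Next i j = toℕ j ≡ suc (toℕ i) ⊎ (toℕ j ≡ 0 × suc (toℕ i) ≡ m)

  CycleAdj : Rel (Fin m) 0ℓ
  CycleAdj i j = Next i j ⊎ Next j i

private
  next-irrelevant : ∀ {m} → Binary.Irrelevant (Next {m})
  next-irrelevant (inj₁ p) (inj₁ q) = cong inj₁ (≡-irrelevant p q)
  next-irrelevant (inj₁ p) (inj₂ (q , _)) with () ← trans (sym p) q
  next-irrelevant (inj₂ (p , _)) (inj₁ q) with () ← trans (sym p) q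
  next-irrelevant (inj₂ (p , p′)) (inj₂ (q , q′)) =
    cong inj₂ (cong₂ _,_ (≡-irrelevant p q) (≡-irrelevant p′ q′))

  wrap : ∀ {m a b} → 3 ≤ m → a ≡ suc b → b ≡ 0 → suc a ≢ m
  wrap (s≤s (s≤s (s≤s _))) refl refl ()

  low : ∀ {m a} → 3 ≤ m → a ≡ 0 → suc a ≢ m
  low (s≤s (s≤s (s≤s _))) refl ()

  next-asym : ∀ {m} → 3 ≤ m → Asymmetric (Next {m})
  next-asym _   (inj₁ p) (inj₁ q) = two p q
    where
    two : ∀ {a b} → b ≡ suc a → a ≢ suc b
    two refl ()
  next-asym 3≤m (inj₁ p) (inj₂ (q , q′)) = wrap 3≤m p q q′
  next-asym 3≤m (inj₂ (p , p′)) (inj₁ q) = wrap 3≤m q p p′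
  next-asym 3≤m (inj₂ (_ , p′)) (inj₂ (q , _)) = low 3≤m q p′

  orient-irrelevant : {A : Set} (R : Rel A 0ℓ) → Asymmetric R →
    Binary.Irrelevant R → Binary.Irrelevant (λ x y → R x y ⊎ R y x)
  orient-irrelevant _ asym irr (inj₁ p) (inj₁ q) = cong inj₁ (irr p q)
  orient-irrelevant _ asym irr (inj₁ p) (inj₂ q) = contradiction q (asym p)
  orient-irrelevant _ asym irr (inj₂ p) (inj₁ q) = contradiction q (asym p)
  orient-irrelevant _ asym irr (inj₂ p) (inj₂ q) = cong inj₂ (irr p q)

  orient-irrefl : {A : Set} (R : Rel A 0ℓ) → Asymmetric R →
    Irreflexive _≡_ (λ x y → R x y ⊎ R y x)
  orient-irrefl _ asym refl (inj₁ p) = asym p p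
  orient-irrefl _ asym refl (inj₂ p) = asym p p

cycle : (m : ℕ) → 3 ≤ m → Graph
cycle m 3≤m = record
  { V            = Fin m
  ; _~_          = CycleAdj
  ; ~-sym        = swap
  ; ~-irrefl     = orient-irrefl Next (next-asym 3≤m)
  ; ~-irrelevant = orient-irrelevant Next (next-asym 3≤m) next-irrelevant
  }

-- The cycles c need not be induced subgraphs.
Acyclic : Graph → Set
Acyclic Γ = ∀ {m} → 3 ≤ m → (c : Fin m → V) → Injective _≡_ _≡_ c →
  ¬ (∀ {i j} → CycleAdj i j → c i ~ c j)
  where open Graph Γ

IsTree : Graph → Set
IsTree Γ = Connected Γ × Acyclic Γ

-- Γ is the semiregular tree T_{a,b}; infinitude forces a , b ≥ 2.
record IsSemiregularTree (a b : ℕ) (Γ : Graph) : Set where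
  open Graph Γ
  field
    isTree   : IsTree Γ
    infinite : Infinite V
    side     : V → Bool
    proper   : ∀ {u v} → u ~ v → side u ≢ side v
    degree   : ∀ v → HasDegree Γ v (if side v then a else b)

record BipartiteGraph : Set₁ where
  field
    X Y          : Set
    E            : X → Y → Set
    E-irrelevant : Binary.Irrelevant E

-- The underlying graph forgets which part is X and which is Y, so its
-- automorphisms may interchange the two parts.
graph : BipartiteGraph → Graph
graph Δ = record
  { V            = X ⊎ Y
  ; _~_          = Adj
  ; ~-sym        = λ {u} {v} → Adj-sym u v
  ; ~-irrefl     = λ { {u} refl → Adj-irrefl u }
  ; ~-irrelevant = λ {u} {v} → Adj-irrelevant u v
  }
  where
  open BipartiteGraph Δ

  Adj : Rel (X ⊎ Y) 0ℓ
  Adj (inj₁ x) (inj₂ y) = E x y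
  Adj (inj₂ y) (inj₁ x) = E x y
  Adj (inj₁ _) (inj₁ _) = ⊥
  Adj (inj₂ _) (inj₂ _) = ⊥

  Adj-sym : ∀ u v → Adj u v → Adj v u
  Adj-sym (inj₁ _) (inj₂ _) e = e
  Adj-sym (inj₂ _) (inj₁ _) e = e

  Adj-irrefl : ∀ u → ¬ Adj u u
  Adj-irrefl (inj₁ _) ()
  Adj-irrefl (inj₂ _) ()

  Adj-irrelevant : ∀ u v (p q : Adj u v) → p ≡ q
  Adj-irrelevant (inj₁ _) (inj₂ _) p q = E-irrelevant p q
  Adj-irrelevant (inj₂ _) (inj₁ _) p q = E-irrelevant p q

completeBipartite : ℕ → ℕ → BipartiteGraph
completeBipartite m n = record
  { X = Fin m
  ; Y = Fin n
  ; E = λ _ _ → ⊤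
  ; E-irrelevant = λ _ _ → refl
  }

matchingComplement : {n : ℕ} → Fin n ↔ Fin n → BipartiteGraph
matchingComplement {n} η = record
  { X = Fin n
  ; Y = Fin n
  ; E = λ x y → y ≢ Inverse.to η x
  ; E-irrelevant = λ _ _ → refl
  }

record Digraph : Set₁ where
  infix 4 _⟶_
  field
    V            : Set
    _⟶_          : Rel V 0ℓ
    ⟶-asym       : Asymmetric _⟶_   -- irreflexive and antisymmetric
    ⟶-irrelevant : Binary.Irrelevant _⟶_

  In Out : V → Set
  In  t = ∃[ s ] (s ⟶ t)
  Out t = ∃[ u ] (t ⟶ u)

infix 4 _≅ᵈ_
_≅ᵈ_ : Digraph → Digraph → Set
D ≅ᵈ D′ = RelIso (Digraph._⟶_ D) (Digraph._⟶_ D′)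

underlying : Digraph → Graph
underlying D = record
  { V            = V
  ; _~_          = λ u v → u ⟶ v ⊎ v ⟶ u
  ; ~-sym        = swap
  ; ~-irrefl     = orient-irrefl _⟶_ ⟶-asym
  ; ~-irrelevant = orient-irrelevant _⟶_ ⟶-asym ⟶-irrelevant
  }
  where open Digraph D

record Subset (A : Set) : Set₁ where
  field
    member            : Unary.Pred A 0ℓ
    member-irrelevant : Unary.Irrelevant member

  Elements : Set
  Elements = Σ A member

module _ (D : Digraph) where
  open Digraph D

  Induced : Subset V → Digraph
  Induced P = record
    { V            = Subset.Elements P
    ; _⟶_          = λ p q → proj₁ p ⟶ proj₁ q
    ; ⟶-asym       = ⟶-asym
    ; ⟶-irrelevant = ⟶-irrelevant
    }

  ConnectedHomogeneous : Set₁
  ConnectedHomogeneous = (P Q : Subset V) →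
    Finite (Subset.Elements P) → Finite (Subset.Elements Q) →
    Connected (underlying (Induced P)) → Connected (underlying (Induced Q)) →
    (σ : Induced P ≅ᵈ Induced Q) →
    Σ (D ≅ᵈ D) λ α → ∀ p → RelIso.to α (proj₁ p) ≡ proj₁ (RelIso.to σ p)

-- The bijections φ and ψ express that every vertex of T has in-degree |X|
-- and out-degree |Y|; X and Y may be infinite.
module _ (Δ : BipartiteGraph) (T : Digraph)
  (φ : ∀ t → Digraph.In T t ↔ BipartiteGraph.X Δ)
  (ψ : ∀ t → Digraph.Out T t ↔ BipartiteGraph.Y Δ)
  where
  open BipartiteGraph Δ
  open Digraph T

  Arc : Set
  Arc = ∃[ a ] ∃[ b ] (a ⟶ b)

  data DLArc : Rel Arc 0ℓ where
    arc : ∀ {a b d} (p : a ⟶ b) (q : b ⟶ d) →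
          E (Inverse.to (φ b) (a , p)) (Inverse.to (ψ b) (d , q)) →
          DLArc (a , b , p) (b , d , q)

  private
    DLArc-asym : Asymmetric DLArc
    DLArc-asym (arc p q _) (arc _ _ _) = ⟶-asym p q

    DLArc-irrelevant : Binary.Irrelevant DLArc
    DLArc-irrelevant (arc p q e) (arc .p .q e′) = cong (arc p q) (E-irrelevant e e′)

  DL : Digraph
  DL = record
    { V            = Arc
    ; _⟶_          = DLArc
    ; ⟶-asym       = DLArc-asym
    ; ⟶-irrelevant = DLArc-irrelevant
    }

{-# OPTIONS --safe #-}

-- A vertex of DL(Δ) is an arc of T, and the arcs at a vertex t of T span a copy of
-- Δ; these copies are glued in the pattern of the tree T.  Hence an automorphism
-- of DL(Δ) is an automorphism of T that acts at each vertex by an automorphism of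
-- Δ preserving X and Y, and DL(Δ) is connected-homogeneous as soon as every
-- side-preserving isomorphism between connected induced subgraphs of Δ extends to
-- Δ: starting from one vertex, the local automorphisms are chosen along the
-- reduced walks of T.  The graphs in the list have this extension property.
--
-- Conversely, connected-homogeneity of DL(Δ) gives the following moves of Δ: if F
-- is finite and connected, and v, v′ on the same side have the same neighbours in
-- F, at least one if F is nonempty, then an automorphism fixes F and takes v to v′.
-- Suppose Δ has no leaf and is not a tree.  If it has a 4-cycle, write S(x′) for
-- N(x) ∩ N(x′) when x′ is at distance two from x.  Moves exchange any vertex of
-- S(x′) for any other neighbour of x, and act on the triples of neighbours of a
-- vertex.  This forces S(x′) to be N(x), giving a complete bipartite graph, or N(x)
-- less one vertex, giving the complement of a perfect matching.  If Δ has no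
-- 4-cycle but a vertex of degree at least 3, moving the end of the path obtained
-- from a shortest cycle by deleting two vertices produces a 6-cycle, and moving a
-- leaf of a spider with three legs of length two then produces a 4-cycle.

module Submission where

open import Axiom.ExcludedMiddle using (ExcludedMiddle)
open import Data.Bool.Base using (Bool; true; false; not; if_then_else_)
open import Data.Bool.Properties using (¬-not)
open import Data.Empty using (⊥; ⊥-elim)
open import Data.Fin.Base using (Fin; zero; suc; toℕ; fromℕ<; punchIn; punchOut; opposite)
import Data.Fin.Base as Fin
open import Data.Fin.Permutation using (Permutation′; _⟨$⟩ʳ_; insert; insert-punchIn)
open import Data.Fin.Properties using (punchOut-injective; punchIn-punchOut; injective⇒≤; ¬Fin0; toℕ-injective; toℕ-fromℕ<; toℕ<n)
import Data.Fin.Properties as Fin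
open import Data.List.Base using (List; []; _∷_; _++_; filter; tabulate; map; length; lookup)
open import Data.List.Membership.Propositional using (_∈_; _∉_; find; lose)
open import Data.List.Membership.Propositional.Properties using (∈-filter⁺; ∈-++⁺ˡ; ∈-++⁺ʳ; ∈-++⁻; ∈-filter⁻; ∈-tabulate⁺; ∈-map⁺; ∈-map⁻)
open import Data.List.Relation.Unary.Any using (Any; here; there; index)
open import Data.List.Relation.Unary.Any.Properties using (lookup-index)
open import Data.Nat.Base using (ℕ; zero; suc; _+_; _≤_; _<_; z≤n; s≤s)
open import Data.Nat.Divisibility using (_∣_; _∣0; ∣-refl; ∣m∣n⇒∣m+n)
open import Data.Nat.Induction using (<-rec)
open import Data.Nat.Properties using (≤-refl; ≤-trans; ≤-pred; n≤1+n; m≤n⇒m≤1+n; <⇒≤; 1+n≰n; ≤∧≢⇒<; suc-injective)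
import Data.Nat.Properties as ℕ
open import Data.Product.Base using (Σ; ∃-syntax; _×_; _,_; proj₁; proj₂)
open import Data.Sum.Base using (_⊎_; inj₁; inj₂; [_,_]′; swap)
open import Data.Sum.Properties using (inj₁-injective; inj₂-injective)
open import Data.Unit.Base using (⊤; tt)
open import Function.Base using (_∘_; id; case_of_)
open import Function.Bundles using (_↔_; _⇔_; mk⇔; mk↔ₛ′; module Inverse; module Equivalence)
open import Function.Definitions using (Injective)
open import Level using (0ℓ)
open import Relation.Binary.Construct.Closure.ReflexiveTransitive using (Star; ε; _◅_; _◅◅_; gmap)
import Relation.Binary.Construct.Closure.ReflexiveTransitive as Star
open import Relation.Binary.Core using (Rel)
open import Relation.Binary.PropositionalEquality using (_≡_; _≢_; refl; sym; trans; cong; subst; subst₂)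
open import Relation.Nullary using (¬_; Dec; yes; no; contradiction)
open import Defs

-- Each arc of T lies in two copies of Δ, at its head and at its tail, so the local automorphisms
-- chosen for a subdigraph that spreads over many copies must fit together. They do because a
-- connected subdigraph meets each copy in a connected set and contains, at such a copy, the arc
-- that leads towards any other copy it meets. A new local automorphism then has one prescribed
-- value, which the given isomorphism already respects where the copy is met; elsewhere homogeneity
-- for a single vertex supplies it.
--
-- In the converse, suppose that N(x) has two vertices outside S(x′). Exchanging one or two vertices
-- of S(x′) gives x₁ and x₂ that meet S(x′) in sets of different sizes, while a move fixing x and x′
-- takes x₁ to x₂. This needs a neighbour common to all four vertices, so the case of two vertices
-- in S(x′) is argued separately. A 6-cycle contradicts a girth above 6, and girth 6 is where the
-- spider is needed; girths 3 and 5 are excluded by the two sides.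

-- Finite sets and the extension of partial permutations

↔-to-injective : ∀ {A B : Set} (f : A ↔ B) {x y} → Inverse.to f x ≡ Inverse.to f y → x ≡ y
↔-to-injective f {x} {y} eq =
  trans (sym (Inverse.strictlyInverseʳ f x)) (trans (cong (Inverse.from f) eq) (Inverse.strictlyInverseʳ f y))

↔-from-injective : ∀ {A B : Set} (f : A ↔ B) {x y} → Inverse.from f x ≡ Inverse.from f y → x ≡ y
↔-from-injective f {x} {y} eq =
  trans (sym (Inverse.strictlyInverseˡ f x)) (trans (cong (Inverse.to f) eq) (Inverse.strictlyInverseˡ f y))

module _ (em : ExcludedMiddle 0ℓ) where

  -- Excluded middle decides whether 0 is attained; if it is, its only preimage `a₀` is split off
  -- and counted separately.
  finite-injection : ∀ {A : Set} n (f : A → Fin n) → Injective _≡_ _≡_ f → Finite A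
  finite-injection zero f f-inj = 0 , mk↔ₛ′ f (λ ()) (λ ()) (λ a → ⊥-elim (¬Fin0 (f a)))
  finite-injection {A} (suc n) f f-inj with em {∃[ a ] f a ≡ zero}
  ... | no zero∉ = finite-injection n (λ a → punchOut (0≢f a))
                     (λ eq → f-inj (punchOut-injective (0≢f _) (0≢f _) eq))
    where
    0≢f : ∀ a → zero ≢ f a
    0≢f a 0≡fa = zero∉ (a , sym 0≡fa)
  ... | yes (a₀ , fa₀≡0) = suc m , mk↔ₛ′ to from to∘from from∘to
    where
    0≢f : ((a , _) : Σ A (_≢ a₀)) → zero ≢ f a
    0≢f (a , a≢a₀) 0≡fa = a≢a₀ (f-inj (trans (sym 0≡fa) (sym fa₀≡0)))

    Σ-ext : {p q : Σ A (_≢ a₀)} → proj₁ p ≡ proj₁ q → p ≡ q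
    Σ-ext refl = refl

    rest : Finite (Σ A (_≢ a₀))
    rest = finite-injection n (λ p → punchOut (0≢f p))
             (λ {p} {q} eq → Σ-ext (f-inj (punchOut-injective (0≢f p) (0≢f q) eq)))

    m = proj₁ rest
    open Inverse (proj₂ rest) renaming (to to g; from to h)
      using (strictlyInverseˡ; strictlyInverseʳ)

    to : A → Fin (suc m)
    to a with em {a ≡ a₀}
    ... | yes _    = zero
    ... | no a≢a₀ = suc (g (a , a≢a₀))

    from : Fin (suc m) → A
    from zero    = a₀
    from (suc i) = proj₁ (h i)

    to∘from : ∀ i → to (from i) ≡ i
    to∘from zero with em {a₀ ≡ a₀}
    ... | yes _     = refl
    ... | no a₀≢a₀ = contradiction refl a₀≢a₀
    to∘from (suc i) with em {proj₁ (h i) ≡ a₀}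
    ... | yes eq = contradiction eq (proj₂ (h i))
    ... | no _   = cong suc (strictlyInverseˡ i)

    from∘to : ∀ a → from (to a) ≡ a
    from∘to a with em {a ≡ a₀}
    ... | yes a≡a₀ = sym a≡a₀
    ... | no a≢a₀  = cong proj₁ (strictlyInverseʳ (a , a≢a₀))

  -- The partial permutation is given as a relation, so that constraints from several sources can be
  -- joined by `⊎`. Finiteness is essential: a partial injection of an infinite set may be
  -- surjective without being total.
  extend-partial-permutation : ∀ n (R : Fin n → Fin n → Set) →
    (∀ {i j j′} → R i j → R i j′ → j ≡ j′) →
    (∀ {i i′ j} → R i j → R i′ j → i ≡ i′) →
    Σ (Permutation′ n) λ π → ∀ {i j} → R i j → π ⟨$⟩ʳ i ≡ j
  extend-partial-permutation zero R fun inj =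
    mk↔ₛ′ id id (λ _ → refl) (λ _ → refl) , λ { {()} }
  extend-partial-permutation (suc n) R fun inj = π , π-extends
    where
    -- If 0 is not in the domain of R, its image must avoid the range, which
    -- is then a proper subset of Fin (suc n).
    image : Σ (Fin (suc n)) λ j₀ → ∀ {i j} → R i j → (i ≡ zero → j ≡ j₀) × (i ≢ zero → j ≢ j₀)
    image with em {∃[ j ] R zero j}
    ... | yes (j₀ , r₀) = j₀ , λ { r → (λ { refl → fun r r₀ }) , λ { i≢0 refl → i≢0 (inj r r₀) } }
    ... | no 0∉ with em {∃[ j ] (∀ i → ¬ R i j)}
    ...   | yes (j₀ , j₀∉) = j₀ , λ { r → (λ { refl → contradiction (_ , r) 0∉ }) , λ { _ refl → j₀∉ _ r } }
    ...   | no ¬avoid = contradiction (injective⇒≤ (λ {j} {j′} → h-inj {j} {j′})) 1+n≰n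
      where
      preimage : ∀ j → ∃[ i ] R i j
      preimage j with em {∃[ i ] R i j}
      ... | yes p = p
      ... | no ¬p = contradiction (j , λ i r → ¬p (i , r)) ¬avoid

      0≢preimage : ∀ j → zero ≢ proj₁ (preimage j)
      0≢preimage j eq = 0∉ (j , subst (λ i → R i j) (sym eq) (proj₂ (preimage j)))

      h : Fin (suc n) → Fin n
      h j = punchOut (0≢preimage j)

      h-inj : Injective _≡_ _≡_ h
      h-inj {j} {j′} eq =
        fun (proj₂ (preimage j)) (subst (λ i → R i j′) (sym (punchOut-injective (0≢preimage j) (0≢preimage j′) eq)) (proj₂ (preimage j′)))

    j₀ = proj₁ image

    rest : Σ (Permutation′ n) λ π′ → ∀ {i j} → R (suc i) (punchIn j₀ j) → π′ ⟨$⟩ʳ i ≡ j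
    rest = extend-partial-permutation n (λ i j → R (suc i) (punchIn j₀ j))
      (λ r r′ → Fin.punchIn-injective j₀ _ _ (fun r r′))
      (λ r r′ → Fin.suc-injective (inj r r′))

    π = insert zero j₀ (proj₁ rest)

    π-extends : ∀ {i j} → R i j → π ⟨$⟩ʳ i ≡ j
    π-extends {zero}  r = sym (proj₁ (proj₂ image r) refl)
    π-extends {suc i} {j} r =
      trans (insert-punchIn zero j₀ (proj₁ rest) i)
        (trans (cong (punchIn j₀) (proj₂ rest (subst (R (suc i)) (sym (punchIn-punchOut j₀≢j)) r)))
          (punchIn-punchOut j₀≢j))
      where
      j₀≢j : j₀ ≢ j
      j₀≢j eq = proj₂ (proj₂ image r) (λ ()) (sym eq)

  extend-partial-bijection : ∀ {A B : Set} {n} → A ↔ Fin n → B ↔ Fin n → (R : A → B → Set) →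
    (∀ {a b b′} → R a b → R a b′ → b ≡ b′) →
    (∀ {a a′ b} → R a b → R a′ b → a ≡ a′) →
    Σ (A ↔ B) λ h → ∀ {a b} → R a b → Inverse.to h a ≡ b
  extend-partial-bijection {n = n} f g R fun inj =
    mk↔ₛ′ (λ a → G.from (Π.to (F.to a))) (λ b → F.from (Π.from (G.to b)))
      (λ b → trans (cong G.from (trans (cong Π.to (F.strictlyInverseˡ _)) (Π.strictlyInverseˡ _)))
                   (G.strictlyInverseʳ b))
      (λ a → trans (cong F.from (trans (cong Π.from (G.strictlyInverseˡ _)) (Π.strictlyInverseʳ _)))
                   (F.strictlyInverseʳ a))
    , λ {a} {b} r → trans (cong G.from (proj₂ ext (subst (λ a → R a (G.from (G.to b))) (sym (F.strictlyInverseʳ a))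
                        (subst (R a) (sym (G.strictlyInverseʳ b)) r))))
                      (G.strictlyInverseʳ b)
    where
    module F = Inverse f
    module G = Inverse g

    ext = extend-partial-permutation n (λ i j → R (F.from i) (G.from j))
      (λ r r′ → ↔-from-injective g (fun r r′))
      (λ r r′ → ↔-from-injective f (inj r r′))

    module Π = Inverse (proj₁ ext)

-- Isomorphisms of relations

module _ {A B : Set} {R : Rel A 0ℓ} {S : Rel B 0ℓ} (f : RelIso R S) where
  private
    module f = RelIso f

  to∘from : ∀ y → f.to (f.from y) ≡ y
  to∘from = Inverse.strictlyInverseˡ f.bijection

  from∘to : ∀ x → f.from (f.to x) ≡ x
  from∘to = Inverse.strictlyInverseʳ f.bijection

  to-injective : ∀ {x y} → f.to x ≡ f.to y → x ≡ y
  to-injective = ↔-to-injective f.bijection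

  preserve : ∀ {x y} → R x y → S (f.to x) (f.to y)
  preserve = Equivalence.to f.preserves

  reflect : ∀ {x y} → S (f.to x) (f.to y) → R x y
  reflect = Equivalence.from f.preserves

  RelIso-sym : RelIso S R
  RelIso-sym = record
    { bijection = mk↔ₛ′ f.from f.to from∘to to∘from
    ; preserves = λ {x} {y} → mk⇔
        (λ s → reflect (subst₂ S (sym (to∘from x)) (sym (to∘from y)) s))
        (λ r → subst₂ S (to∘from x) (to∘from y) (preserve r))
    }

RelIso-trans : {A B C : Set} {R : Rel A 0ℓ} {S : Rel B 0ℓ} {U : Rel C 0ℓ} →
  RelIso R S → RelIso S U → RelIso R U
RelIso-trans f g = record
  { bijection = mk↔ₛ′ (RelIso.to g ∘ RelIso.to f) (RelIso.from f ∘ RelIso.from g)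
      (λ z → trans (cong (RelIso.to g) (to∘from f _)) (to∘from g z))
      (λ x → trans (cong (RelIso.from f) (from∘to g _)) (from∘to f x))
  ; preserves = mk⇔ (preserve g ∘ preserve f) (reflect f ∘ reflect g)
  }

-- Reduced walks and cycles

module _ {V : Set} {R : Rel V 0ℓ} where

  -- The first step leads to `v`. With `v` the vertex from which the walk was entered, this is a
  -- step straight back.
  Via : ∀ {t r} → V → Star R t r → Set
  Via v ε                   = ⊥
  Via v (_◅_ {j = s} _ _) = v ≡ s

  Reduced : ∀ {t r} → Star R t r → Set
  Reduced ε                   = ⊤
  Reduced (_◅_ {i = t} _ w) = ¬ Via t w × Reduced w

  reduce : ExcludedMiddle 0ℓ → ∀ {t r} → Star R t r → Σ (Star R t r) Reduced
  reduce em ε = ε , tt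
  reduce em {t} (e ◅ w) with reduce em w
  ... | w′ , red with em {Via t w′}
  ...   | no ¬back = e ◅ w′ , ¬back , red
  ...   | yes back = dropBack w′ red back
    where
    dropBack : ∀ {s r} (w : Star R s r) → Reduced w → Via t w → Σ (Star R t r) Reduced
    dropBack (_ ◅ w) (_ , red) refl = w , red

  -- Beyond its end a walk is continued by its last vertex; only indices up to `steps w` matter.
  vertex : ∀ {t r} → Star R t r → ℕ → V
  vertex {t} _       zero    = t
  vertex {t} ε       (suc i) = t
  vertex     (e ◅ w) (suc i) = vertex w i

  steps : ∀ {t r} → Star R t r → ℕ
  steps ε       = 0
  steps (_ ◅ w) = suc (steps w)

  vertex-end : ∀ {t r} (w : Star R t r) → vertex w (steps w) ≡ r
  vertex-end ε       = refl
  vertex-end (_ ◅ w) = vertex-end w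

  vertex-step : ∀ {t r} (w : Star R t r) i → i < steps w → R (vertex w i) (vertex w (suc i))
  vertex-step (e ◅ w) zero    _         = e
  vertex-step (e ◅ w) (suc i) (s≤s i<n) = vertex-step w i i<n

  vertex-reduced : ∀ {t r} (w : Star R t r) → Reduced w →
    ∀ i → suc i < steps w → vertex w i ≢ vertex w (suc (suc i))
  vertex-reduced (_ ◅ e ◅ w) (¬back , _)   zero    _         = ¬back
  vertex-reduced (_ ◅ w)     (_     , red) (suc i) (s≤s i<n) = vertex-reduced w red i i<n

-- Backtracking concerns only the two ends of a path of length two, so local injectivity of `f` is
-- enough. This allows injectivity on a whole tree to be deduced from it later.
Reduced-gmap : ∀ {A B : Set} {R : Rel A 0ℓ} {S : Rel B 0ℓ} (f : A → B) (g : ∀ {x y} → R x y → S (f x) (f y)) →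
  (∀ {t s u} → R t s → R s u → t ≢ u → f t ≢ f u) →
  ∀ {t r} (w : Star R t r) → Reduced w → Reduced (gmap {U = S} f g w)
Reduced-gmap f g f-inj ε              red           = tt
Reduced-gmap f g f-inj (e ◅ ε)        (_ , _)       = (λ ()) , tt
Reduced-gmap f g f-inj (e ◅ e′ ◅ w) (¬back , red) = f-inj e e′ ¬back , Reduced-gmap f g f-inj (e′ ◅ w) red

module _ (Γ : Graph) where
  open Graph Γ

  HasCycle : ℕ → Set
  HasCycle m = Σ (Fin m → V) λ c → Injective _≡_ _≡_ c × (∀ {i j} → CycleAdj i j → c i ~ c j)

  Walk : (ℕ → V) → ℕ → Set
  Walk h n = ∀ i → i < n → h i ~ h (suc i)

  NonBacktracking : (ℕ → V) → ℕ → Set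
  NonBacktracking h n = ∀ i → suc i < n → h i ≢ h (suc (suc i))

  InjectiveUpTo : (ℕ → V) → ℕ → Set
  InjectiveUpTo h n = ∀ {i j} → i ≤ n → j ≤ n → h i ≡ h j → i ≡ j

  -- The bound lets the same lemmas serve trees, where every bound holds, and graphs of known girth.
  NoCycleUpTo : ℕ → Set
  NoCycleUpTo n = ∀ m → 3 ≤ m → m ≤ n → ¬ HasCycle m

  closed-walk⇒cycle : ∀ {h n} → Walk h n → InjectiveUpTo h n → h n ~ h 0 → HasCycle (suc n)
  closed-walk⇒cycle {h} {n} walk inj hn~h0 =
    h ∘ toℕ , (λ eq → toℕ-injective (inj (≤-pred (toℕ<n _)) (≤-pred (toℕ<n _)) eq)) , λ where
      (inj₁ next) → step next
      (inj₂ next) → ~-sym (step next)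
    where
    step : ∀ {i j : Fin (suc n)} → Next i j → h (toℕ i) ~ h (toℕ j)
    step {i} {j} (inj₁ j≡1+i) rewrite j≡1+i = walk (toℕ i) (≤-pred (subst (_< suc n) j≡1+i (toℕ<n j)))
    step {i} (inj₂ (j≡0 , 1+i≡m)) rewrite j≡0 | suc-injective 1+i≡m = hn~h0

  -- By induction the walk is injective once either end is removed, so only the two ends can
  -- coincide. The walk then closes to a cycle, except in lengths 1 and 2, which irreflexivity and
  -- the absence of backtracking exclude.
  reduced-walk-injective : ∀ n {h} → NoCycleUpTo n → Walk h n → NonBacktracking h n → InjectiveUpTo h n
  reduced-walk-injective zero _ _ _ z≤n z≤n _ = refl
  reduced-walk-injective (suc n) {h} noCycle walk nb = inj
    where
    noCycle′ : NoCycleUpTo n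
    noCycle′ m 3≤m m≤n = noCycle m 3≤m (m≤n⇒m≤1+n m≤n)

    init : InjectiveUpTo h n
    init = reduced-walk-injective n noCycle′ (λ i i<n → walk i (m≤n⇒m≤1+n i<n)) (λ i i<n → nb i (m≤n⇒m≤1+n i<n))

    tail : InjectiveUpTo (h ∘ suc) n
    tail = reduced-walk-injective n noCycle′ (λ i i<n → walk (suc i) (s≤s i<n)) (λ i i<n → nb (suc i) (s≤s i<n))

    not-closed : ∀ k → k ≡ n → h 0 ≢ h (suc k)
    not-closed zero          refl eq = ~-irrefl eq (walk 0 (s≤s z≤n))
    not-closed (suc zero)    refl eq = nb 0 (s≤s (s≤s z≤n)) eq
    not-closed (suc (suc k)) refl eq = noCycle (suc n) (s≤s (s≤s (s≤s z≤n))) ≤-refl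
      (closed-walk⇒cycle (λ i i<n → walk i (m≤n⇒m≤1+n i<n)) init
        (subst (h n ~_) (sym eq) (walk n ≤-refl)))

    0≢suc : ∀ {j} → suc j ≤ suc n → h 0 ≢ h (suc j)
    0≢suc {j} (s≤s j≤n) eq with j ℕ.≟ n
    ... | yes refl = not-closed n refl eq
    ... | no j≢n   with () ← init z≤n (≤∧≢⇒< j≤n j≢n) eq

    inj : InjectiveUpTo h (suc n)
    inj {zero}  {zero}  _         _         _  = refl
    inj {zero}  {suc j} _         j≤n       eq = contradiction eq (0≢suc j≤n)
    inj {suc i} {zero}  i≤n       _         eq = contradiction (sym eq) (0≢suc i≤n)
    inj {suc i} {suc j} (s≤s i≤n) (s≤s j≤n) eq = cong suc (tail i≤n j≤n eq)

  no-chord : ∀ n {h} → 2 ≤ n → NoCycleUpTo (suc n) → Walk h n → NonBacktracking h n → ¬ (h n ~ h 0)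
  no-chord n 2≤n noCycle walk nb hn~h0 =
    noCycle (suc n) (s≤s 2≤n) ≤-refl
      (closed-walk⇒cycle walk
        (reduced-walk-injective n (λ m 3≤m m≤n → noCycle m 3≤m (m≤n⇒m≤1+n m≤n)) walk nb) hn~h0)

  module _ (acyclic : Acyclic Γ) where

    acyclic⇒noCycle : ∀ n → NoCycleUpTo n
    acyclic⇒noCycle n m 3≤m _ (c , c-inj , c-adj) = acyclic 3≤m c c-inj c-adj

    no-closed-reduced : ∀ {t s} (e : t ~ s) (w : Star _~_ s t) → ¬ Reduced (e ◅ w)
    no-closed-reduced e w red
      with () ← reduced-walk-injective (steps (e ◅ w)) (acyclic⇒noCycle _)
        (vertex-step (e ◅ w)) (vertex-reduced (e ◅ w) red) z≤n ≤-refl (sym (vertex-end (e ◅ w)))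

    private
      SameStart : ∀ {t r r′} → Star _~_ t r → Star _~_ t r′ → Set
      SameStart w w′ = ∃[ s ] Via s w × Via s w′

      -- Reversing w in front of e ◅ w′ gives a reduced walk from r to r′.
      diverging : ∀ {t r s r′} (w : Star _~_ t r) (e : t ~ s) (w′ : Star _~_ s r′) → Reduced w →
        Reduced (e ◅ w′) → ¬ SameStart w (e ◅ w′) → r ≢ r′
      diverging ε       e′ w′ _          red′ _     refl = no-closed-reduced e′ w′ red′
      diverging (e ◅ w) e′ w′ (¬b , red) red′ ¬same =
        diverging w (~-sym e) (e′ ◅ w′) red ((λ b → ¬same (_ , refl , b)) , red′)
          (λ { (_ , b , refl) → ¬b b })

    -- Two reduced walks that part at the first step join to a reduced walk between their ends,
    -- which are then distinct. Hence walks with the same ends agree step by step.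
    reduced-unique : ExcludedMiddle 0ℓ → ∀ {t r} (w w′ : Star _~_ t r) → Reduced w → Reduced w′ → w ≡ w′
    reduced-unique em ε       ε         _   _    = refl
    reduced-unique em ε       (e ◅ w′) _   red′ = contradiction red′ (no-closed-reduced e w′)
    reduced-unique em (e ◅ w) ε         red _    = contradiction red (no-closed-reduced e w)
    reduced-unique em (_◅_ {j = s} e w) (_◅_ {j = s′} e′ w′) red red′ with em {s ≡ s′}
    ... | no s≢s′ = contradiction refl
      (diverging (e ◅ w) e′ w′ red red′ λ { (_ , refl , s≡s′) → s≢s′ s≡s′ })
    ... | yes refl with ~-irrelevant e e′ | reduced-unique em w w′ (proj₂ red) (proj₂ red′)
    ...   | refl | refl = refl

-- Automorphisms of trees

Reduced-irrelevant : ∀ {V : Set} {R : Rel V 0ℓ} {t r} (w : Star R t r) (red red′ : Reduced w) → red ≡ red′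
Reduced-irrelevant ε       _         _          = refl
Reduced-irrelevant (_ ◅ w) (_ , red) (_ , red′) = cong (_ ,_) (Reduced-irrelevant w red red′)

-- Local pieces of an automorphism taking r to r′, chosen one vertex at a time
-- along the reduced walks that leave r.
record LocalSystem (Γ : Graph) (r r′ : Graph.V Γ) : Set₁ where
  open Graph Γ
  field
    State          : V → V → Set
    start          : State r r′
    act            : ∀ {t t′ s} → State t t′ → t ~ s → V
    act-adjacent   : ∀ {t t′ s} (st : State t t′) (e : t ~ s) → t′ ~ act st e
    act-injective  : ∀ {t t′ s u} (st : State t t′) (e : t ~ s) (e′ : t ~ u) → act st e ≡ act st e′ → s ≡ u
    act-surjective : ∀ {t t′ s′} (st : State t t′) → t′ ~ s′ → ∃[ s ] Σ (t ~ s) λ e → act st e ≡ s′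
    next           : ∀ {t t′ s} (st : State t t′) (e : t ~ s) (w : Star _~_ t r) → Reduced (~-sym e ◅ w) →
                     Σ (State s (act st e)) λ st′ → act st′ (~-sym e) ≡ t′

module TreeExtension (em : ExcludedMiddle 0ℓ) (Γ : Graph) (tree : IsTree Γ)
  {r r′ : Graph.V Γ} (L : LocalSystem Γ r r′) where

  open Graph Γ
  open LocalSystem L

  private
    connect : ∀ u v → Star _~_ u v
    connect = proj₂ (proj₁ tree)

    acyclic : Acyclic Γ
    acyclic = proj₂ tree

    home : ∀ t → Σ (Star _~_ t r) Reduced
    home t = reduce em (connect t r)

    home-unique : ∀ {t} (w : Star _~_ t r) (red : Reduced w) → home t ≡ (w , red)
    home-unique {t} w red with home t
    ... | w′ , red′ with reduced-unique Γ acyclic em w′ w red′ red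
    ...   | refl = cong (w ,_) (Reduced-irrelevant w red′ red)

    -- The recursion runs over the reduced walk from `t` home to `r`, which is unique in a tree, so
    -- `image-along` evaluates the state of `t` along any such walk.
    along : ∀ {t} (w : Star _~_ t r) → Reduced w → Σ V (State t)
    along ε       _         = r′ , start
    along (e ◅ w) (nb , red) =
      _ , proj₁ (next (proj₂ (along w red)) (~-sym e) w (nb , red))

    image : ∀ t → Σ V (State t)
    image t = along (proj₁ (home t)) (proj₂ (home t))

    image-along : ∀ {t} (w : Star _~_ t r) (red : Reduced w) → image t ≡ along w red
    image-along w red = cong (λ (w , red) → along w red) (home-unique w red)

  α : V → V
  α t = proj₁ (image t)

  state : ∀ t → State t (α t)
  state t = proj₂ (image t)

  -- If the walk home from `t` does not pass through `s`, then `s` lies beyond `t` and its image was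
  -- defined by the state of `t`. Otherwise the state of `t` came from that of `s`, and `next` made
  -- it send the edge back correctly.
  act-state : ∀ {t s} (e : t ~ s) → act (state t) e ≡ α s
  act-state {t} {s} e with em {Via s (proj₁ (home t))}
  ... | no ¬back = sym (trans (cong proj₁ (image-along (~-sym e ◅ proj₁ (home t)) (¬back , proj₂ (home t))))
                     (cong (act (state t)) (~-irrelevant _ e)))
  ... | yes back = toward (proj₁ (home t)) (proj₂ (home t)) back (image-along _ _)
    where
    toward : (w : Star _~_ t r) (red : Reduced w) → Via s w → image t ≡ along w red → act (state t) e ≡ α s
    toward (e′ ◅ w) (nb , red) refl eq rewrite eq | sym (image-along w red) =
      trans (cong (act (proj₁ step)) (~-irrelevant e _)) (proj₂ step)
      where
      step = next (proj₂ (image s)) (~-sym e′) w (nb , red)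

  α-adjacent : ∀ {t s} → t ~ s → α t ~ α s
  α-adjacent e = subst (_ ~_) (act-state e) (act-adjacent (state _) e)

  -- Local injectivity keeps the image of a reduced walk reduced, and in a tree a nonempty reduced
  -- walk is never closed.
  α-injective : ∀ {t u} → α t ≡ α u → t ≡ u
  α-injective {t} {u} αt≡αu with reduce em (connect t u)
  ... | ε     , _   = refl
  ... | e ◅ w , red = contradiction
    (subst (λ v → Σ (Star _~_ _ v) λ w → Reduced (α-adjacent e ◅ w)) (sym αt≡αu)
      (gmap α α-adjacent w , Reduced-gmap α α-adjacent locally-injective (e ◅ w) red))
    λ { (w′ , red′) → no-closed-reduced Γ acyclic (α-adjacent e) w′ red′ }
    where
    locally-injective : ∀ {t s u} → t ~ s → s ~ u → t ≢ u → α t ≢ α u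
    locally-injective e e′ t≢u eq = t≢u (act-injective (state _) (~-sym e) e′
      (trans (act-state (~-sym e)) (trans eq (sym (act-state e′)))))

  α-lift : ∀ {t s′} → α t ~ s′ → ∃[ s ] (t ~ s × α s ≡ s′)
  α-lift {t} e with act-surjective (state t) e
  ... | s , e′ , eq = s , e′ , trans (sym (act-state e′)) eq

  α-root : α r ≡ r′
  α-root = cong proj₁ (image-along ε tt)

  α-surjective : ∀ t′ → ∃[ t ] α t ≡ t′
  α-surjective t′ = go r α-root (connect r′ t′)
    where
    go : ∀ {u′} t → α t ≡ u′ → Star _~_ u′ t′ → ∃[ t ] α t ≡ t′
    go t eq   ε       = t , eq
    go t refl (e ◅ w) with α-lift e
    ... | s , _ , eq = go s eq w

  α-reflect : ∀ {t s} → α t ~ α s → t ~ s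
  α-reflect e with α-lift e
  ... | s , e′ , eq = subst (_ ~_) (α-injective eq) e′

  automorphism : Γ ≅ Γ
  automorphism = record
    { bijection = mk↔ₛ′ α (proj₁ ∘ α-surjective) (proj₂ ∘ α-surjective)
                    (λ t → α-injective (proj₂ (α-surjective (α t))))
    ; preserves = mk⇔ α-adjacent α-reflect
    }

-- Extension of partial isomorphisms in the listed graphs

Elements-≡ : ∀ {A : Set} (P : Subset A) {p q : Subset.Elements P} → proj₁ p ≡ proj₁ q → p ≡ q
Elements-≡ P {_ , m} {_ , m′} refl = cong (_ ,_) (Subset.member-irrelevant P m m′)

-- Lying on the same side, expressed without reference to the sides, which an
-- isomorphism of the underlying graphs may interchange.
EvenWalk : (Γ : Graph) → Rel (Graph.V Γ) 0ℓ
EvenWalk Γ = Star (λ u v → ∃[ w ] (u ~ w × w ~ v))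
  where open Graph Γ

≢-≢⇒≡ : ∀ {a b c : Bool} → a ≢ b → b ≢ c → a ≡ c
≢-≢⇒≡ a≢b b≢c = trans (¬-not a≢b) (sym (¬-not (b≢c ∘ sym)))

module _ (Γ : Graph) where
  open Graph Γ

  Proper : (V → Bool) → Set
  Proper side = ∀ {u v} → u ~ v → side u ≢ side v

  even⇒same-side : ∀ {side} → Proper side → ∀ {u v} → EvenWalk Γ u v → side u ≡ side v
  even⇒same-side proper ε                       = refl
  even⇒same-side proper ((_ , e , e′) ◅ w) = trans (≢-≢⇒≡ (proper e) (proper e′)) (even⇒same-side proper w)

  same-side⇒even : ∀ {side} → Proper side → ∀ {u v} → Star _~_ u v → side u ≡ side v → EvenWalk Γ u v
  same-side⇒even {side} proper {u} {v} walk su≡sv with parity walk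
    where
    parity : ∀ {u} → Star _~_ u v → EvenWalk Γ u v ⊎ ∃[ w ] (u ~ w × EvenWalk Γ w v)
    parity ε       = inj₁ ε
    parity (e ◅ w) with parity w
    ... | inj₁ even            = inj₂ (_ , e , even)
    ... | inj₂ (_ , e′ , even) = inj₁ ((_ , e , e′) ◅ even)
  ... | inj₁ even           = even
  ... | inj₂ (w , e , even) = contradiction (trans su≡sv (sym (even⇒same-side proper even))) (proper e)

  same-sides-preserved : ∀ {side} → Proper side → (∀ u v → Star _~_ u v) → (g : Γ ≅ Γ) →
    ∀ {u} → side (RelIso.to g u) ≡ side u → ∀ v → side (RelIso.to g v) ≡ side v
  same-sides-preserved {side} proper connect g {u} eq v = go (connect u v) eq
    where
    go : ∀ {u} → Star _~_ u v → side (RelIso.to g u) ≡ side u → side (RelIso.to g v) ≡ side v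
    go ε       eq = eq
    go (e ◅ w) eq = go w (trans (¬-not (proper (preserve g e) ∘ sym))
                           (trans (cong not eq) (sym (¬-not (proper e ∘ sym)))))

  -- An embedding of the subgraph induced on `domain`; its image is left implicit, which spares a
  -- second subset.
  record PartialIso : Set₁ where
    field
      domain      : Subset V
    open Subset domain public
    field
      σ           : Elements → V
      base        : Elements
      connected   : ∀ p q → Star (λ (p q : Elements) → proj₁ p ~ proj₁ q) p q
      σ-injective : ∀ {p q : Elements} → σ p ≡ σ q → p ≡ q
      σ-adjacent  : ∀ {p q : Elements} → proj₁ p ~ proj₁ q ⇔ σ p ~ σ q
      σ-even      : ∀ (p : Elements) → EvenWalk Γ (proj₁ p) (σ p)

    σ-≡ : ∀ {u v} (m : member u) (m′ : member v) → u ≡ v → σ (u , m) ≡ σ (v , m′)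
    σ-≡ m m′ u≡v = cong σ (Elements-≡ domain u≡v)

  Homogeneous : Set₁
  Homogeneous = (π : PartialIso) → let open PartialIso π in
    Σ (Γ ≅ Γ) λ g → ∀ p → RelIso.to g (proj₁ p) ≡ σ p

Homogeneous-resp-≅ : ∀ {Γ Γ′} → Γ ≅ Γ′ → Homogeneous Γ′ → Homogeneous Γ
Homogeneous-resp-≅ {Γ} {Γ′} f hom π = RelIso-trans f (RelIso-trans (proj₁ ext) (RelIso-sym f)) , λ where
    (v , m) → trans (cong f.from (proj₂ ext (push (v , m))))
                (trans (from∘to f _) (σ-≡ _ m (from∘to f v)))
  where
  module f = RelIso f
  open PartialIso π
  module Γ = Graph Γ
  module Γ′ = Graph Γ′

  P′ : Subset Γ′.V
  P′ = record { member = member ∘ f.from ; member-irrelevant = member-irrelevant }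

  push : Elements → Subset.Elements P′
  push (v , m) = f.to v , subst member (sym (from∘to f v)) m

  pull : Subset.Elements P′ → Elements
  pull (v′ , m) = f.from v′ , m

  push∘pull : ∀ p → push (pull p) ≡ p
  push∘pull (v′ , _) = Elements-≡ P′ (to∘from f v′)

  π′ : PartialIso Γ′
  π′ = record
    { domain      = P′
    ; σ           = f.to ∘ σ ∘ pull
    ; base        = push base
    ; connected   = λ p q → subst₂ (Star _) (push∘pull p) (push∘pull q)
                      (gmap push (preserve f) (connected (pull p) (pull q)))
    ; σ-injective = λ eq → Elements-≡ P′ (to-injective (RelIso-sym f) (cong proj₁ (σ-injective (to-injective f eq))))
    ; σ-adjacent  = mk⇔ (λ e → preserve f (Equivalence.to σ-adjacent (preserve (RelIso-sym f) e)))
                        (λ e → reflect (RelIso-sym f) (Equivalence.from σ-adjacent (reflect f e)))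
    ; σ-even      = λ p → subst (λ v → EvenWalk Γ′ v (f.to (σ (pull p)))) (to∘from f (proj₁ p))
                      (gmap f.to (λ { (w , e , e′) → f.to w , preserve f e , preserve f e′ }) (σ-even (pull p)))
    }

  ext : Σ (Γ′ ≅ Γ′) λ g → ∀ p → RelIso.to g (proj₁ p) ≡ f.to (σ (pull p))
  ext = hom π′

module _ (Δ : BipartiteGraph) where
  open BipartiteGraph Δ
  open Graph (graph Δ) using (_~_)

  sideOf : X ⊎ Y → Bool
  sideOf (inj₁ _) = true
  sideOf (inj₂ _) = false

  sideOf-proper : Proper (graph Δ) sideOf
  sideOf-proper {inj₁ _} {inj₂ _} _ ()
  sideOf-proper {inj₂ _} {inj₁ _} _ ()

  module _ (π : PartialIso (graph Δ)) where
    open PartialIso π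

    -- The part of `σ` on X as a relation, in the form that the extension of partial permutations
    -- takes.
    OnX : X → X → Set
    OnX x x′ = Σ (member (inj₁ x)) λ m → σ (inj₁ x , m) ≡ inj₁ x′

    OnY : Y → Y → Set
    OnY y y′ = Σ (member (inj₂ y)) λ m → σ (inj₂ y , m) ≡ inj₂ y′

    OnX-functional : ∀ {x x′ x″} → OnX x x′ → OnX x x″ → x′ ≡ x″
    OnX-functional (m , eq) (m′ , eq′) = inj₁-injective (trans (sym eq) (trans (σ-≡ m m′ refl) eq′))

    OnX-injective : ∀ {x x′ x″} → OnX x x″ → OnX x′ x″ → x ≡ x′
    OnX-injective (m , eq) (m′ , eq′) = inj₁-injective (cong proj₁ (σ-injective (trans eq (sym eq′))))

    OnY-functional : ∀ {y y′ y″} → OnY y y′ → OnY y y″ → y′ ≡ y″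
    OnY-functional (m , eq) (m′ , eq′) = inj₂-injective (trans (sym eq) (trans (σ-≡ m m′ refl) eq′))

    OnY-injective : ∀ {y y′ y″} → OnY y y″ → OnY y′ y″ → y ≡ y′
    OnY-injective (m , eq) (m′ , eq′) = inj₂-injective (cong proj₁ (σ-injective (trans eq (sym eq′))))

    OnX-OnY-edge : ∀ {x x′ y y′} → OnX x x′ → OnY y y′ → E x y ⇔ E x′ y′
    OnX-OnY-edge {x} {x′} {y} {y′} (m , eq) (m′ , eq′) =
      subst₂ (λ u v → E x y ⇔ u ~ v) eq eq′ (σ-adjacent {inj₁ x , m} {inj₂ y , m′})

    glue : (πX : X ↔ X) (πY : Y ↔ Y) →
      (∀ {x y} → E x y ⇔ E (Inverse.to πX x) (Inverse.to πY y)) →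
      (∀ {x x′} → OnX x x′ → Inverse.to πX x ≡ x′) →
      (∀ {y y′} → OnY y y′ → Inverse.to πY y ≡ y′) →
      Σ (graph Δ ≅ graph Δ) λ g → ∀ p → RelIso.to g (proj₁ p) ≡ σ p
    glue πX πY edge onX onY = record
      { bijection = mk↔ₛ′ to from
          (λ { (inj₁ x) → cong inj₁ (Inverse.strictlyInverseˡ πX x)
             ; (inj₂ y) → cong inj₂ (Inverse.strictlyInverseˡ πY y) })
          (λ { (inj₁ x) → cong inj₁ (Inverse.strictlyInverseʳ πX x)
             ; (inj₂ y) → cong inj₂ (Inverse.strictlyInverseʳ πY y) })
      ; preserves = λ {u} {v} → adjacent u v
      } , λ { (u , m) → extends u m (σ (u , m)) refl }
      where
      to from : X ⊎ Y → X ⊎ Y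
      to (inj₁ x)   = inj₁ (Inverse.to πX x)
      to (inj₂ y)   = inj₂ (Inverse.to πY y)
      from (inj₁ x) = inj₁ (Inverse.from πX x)
      from (inj₂ y) = inj₂ (Inverse.from πY y)

      adjacent : ∀ u v → u ~ v ⇔ to u ~ to v
      adjacent (inj₁ x) (inj₂ y) = edge
      adjacent (inj₂ y) (inj₁ x) = edge
      adjacent (inj₁ _) (inj₁ _) = mk⇔ (λ ()) (λ ())
      adjacent (inj₂ _) (inj₂ _) = mk⇔ (λ ()) (λ ())

      extends : ∀ u (m : member u) v → σ (u , m) ≡ v → to u ≡ σ (u , m)
      extends (inj₁ x) m (inj₁ x′) eq = trans (cong inj₁ (onX (m , eq))) (sym eq)
      extends (inj₂ y) m (inj₂ y′) eq = trans (cong inj₂ (onY (m , eq))) (sym eq)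
      extends (inj₁ x) m (inj₂ y′) eq
        with () ← trans (even⇒same-side (graph Δ) (λ {u} {v} → sideOf-proper {u} {v}) (σ-even (_ , m))) (cong sideOf eq)
      extends (inj₂ y) m (inj₁ x′) eq
        with () ← trans (even⇒same-side (graph Δ) (λ {u} {v} → sideOf-proper {u} {v}) (σ-even (_ , m))) (cong sideOf eq)

module _ (em : ExcludedMiddle 0ℓ) where

  completeBipartite-homogeneous : ∀ m n → Homogeneous (graph (completeBipartite m n))
  completeBipartite-homogeneous m n π =
    glue Δ π (proj₁ extX) (proj₁ extY) (mk⇔ _ _) (proj₂ extX) (proj₂ extY)
    where
    Δ = completeBipartite m n
    extX = extend-partial-permutation em m (OnX Δ π) (OnX-functional Δ π) (OnX-injective Δ π)
    extY = extend-partial-permutation em n (OnY Δ π) (OnY-functional Δ π) (OnY-injective Δ π)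

  -- An automorphism that keeps the sides is a single permutation of `Fin n`, acting on Y through
  -- `η`. The constraints on X and on Y are therefore joined into one relation `R`.
  matchingComplement-homogeneous : ∀ {n} (η : Fin n ↔ Fin n) → Homogeneous (graph (matchingComplement η))
  matchingComplement-homogeneous {n} η π = glue Δ π (proj₁ ext) πY
    (λ {x} {y} → mk⇔
      (λ y≢ηx eq → y≢ηx (trans (sym (η.strictlyInverseˡ y))
        (cong η.to (↔-to-injective (proj₁ ext) (↔-to-injective η eq)))))
      (λ neq eq → neq (cong (η.to ∘ ρ.to) (trans (cong η.from eq) (η.strictlyInverseʳ x)))))
    (λ r → proj₂ ext (inj₁ r))
    λ {y} {y′} r → trans (cong η.to (proj₂ ext {η.from y} {η.from y′} (inj₂ (subst₂ (OnY Δ π)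
      (sym (η.strictlyInverseˡ y)) (sym (η.strictlyInverseˡ y′)) r)))) (η.strictlyInverseˡ y′)
    where
    Δ = matchingComplement η
    module η = Inverse η

    R : Fin n → Fin n → Set
    R i j = OnX Δ π i j ⊎ OnY Δ π (η.to i) (η.to j)

    -- Both constraints agree, because the only non-neighbour of a vertex on the other side is its
    -- mate, and `σ` preserves non-adjacency.
    matched : ∀ {i i′ j j′} → OnX Δ π i j → OnY Δ π (η.to i′) (η.to j′) → (i ≡ i′) ⇔ (j ≡ j′)
    matched {i} {i′} {j} {j′} rX rY = mk⇔
      (λ { refl → sym (↔-to-injective η (decide λ neq → Equivalence.from edge neq refl)) })
      (λ { refl → sym (↔-to-injective η (decide λ neq → Equivalence.to edge neq refl)) })
      where
      edge : (η.to i′ ≢ η.to i) ⇔ (η.to j′ ≢ η.to j)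
      edge = OnX-OnY-edge Δ π rX rY

      decide : ∀ {k l : Fin n} → ¬ (k ≢ l) → k ≡ l
      decide {k} {l} ¬≢ with k Fin.≟ l
      ... | yes eq = eq
      ... | no neq = contradiction neq ¬≢

    R-functional : ∀ {i j j′} → R i j → R i j′ → j ≡ j′
    R-functional (inj₁ r) (inj₁ r′) = OnX-functional Δ π r r′
    R-functional (inj₁ r) (inj₂ r′) = Equivalence.to (matched r r′) refl
    R-functional (inj₂ r) (inj₁ r′) = sym (Equivalence.to (matched r′ r) refl)
    R-functional (inj₂ r) (inj₂ r′) = ↔-to-injective η (OnY-functional Δ π r r′)

    R-injective : ∀ {i i′ j} → R i j → R i′ j → i ≡ i′
    R-injective (inj₁ r) (inj₁ r′) = OnX-injective Δ π r r′
    R-injective (inj₁ r) (inj₂ r′) = Equivalence.from (matched r r′) refl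
    R-injective (inj₂ r) (inj₁ r′) = sym (Equivalence.from (matched r′ r) refl)
    R-injective (inj₂ r) (inj₂ r′) = ↔-to-injective η (OnY-injective Δ π r r′)

    ext : Σ (Permutation′ n) λ ρ → ∀ {i j} → R i j → ρ ⟨$⟩ʳ i ≡ j
    ext = extend-partial-permutation em n R R-functional R-injective

    module ρ = Inverse (proj₁ ext)

    πY : Fin n ↔ Fin n
    πY = mk↔ₛ′ (η.to ∘ ρ.to ∘ η.from) (η.to ∘ ρ.from ∘ η.from)
      (λ y → trans (cong (η.to ∘ ρ.to) (η.strictlyInverseʳ _))
               (trans (cong η.to (ρ.strictlyInverseˡ _)) (η.strictlyInverseˡ y)))
      (λ y → trans (cong (η.to ∘ ρ.from) (η.strictlyInverseʳ _))
               (trans (cong η.to (ρ.strictlyInverseʳ _)) (η.strictlyInverseˡ y)))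

-- Rotations and reflections of cycles

module _ {m : ℕ} where

  Next-functional : ∀ {i j j′ : Fin m} → Next i j → Next i j′ → j ≡ j′
  Next-functional (inj₁ p) (inj₁ q) = toℕ-injective (trans p (sym q))
  Next-functional {j = j} (inj₁ p) (inj₂ (_ , q)) = contradiction (trans p q) (ℕ.<⇒≢ (toℕ<n j))
  Next-functional {j′ = j} (inj₂ (_ , p)) (inj₁ q) = contradiction (trans q p) (ℕ.<⇒≢ (toℕ<n j))
  Next-functional (inj₂ (p , _)) (inj₂ (q , _)) = toℕ-injective (trans p (sym q))

  Next-injective : ∀ {i i′ j : Fin m} → Next i j → Next i′ j → i ≡ i′
  Next-injective (inj₁ p) (inj₁ q) = toℕ-injective (suc-injective (trans (sym p) q))
  Next-injective (inj₁ p) (inj₂ (q , _)) with () ← trans (sym p) q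
  Next-injective (inj₂ (p , _)) (inj₁ q) with () ← trans (sym p) q
  Next-injective (inj₂ (_ , p)) (inj₂ (_ , q)) = toℕ-injective (suc-injective (trans p (sym q)))

  Next-asym : 3 ≤ m → ∀ {i j : Fin m} → Next i j → ¬ Next j i
  Next-asym _ (inj₁ p) (inj₁ q) = ℕ.m≢1+n+m _ (trans q (cong suc p))
  Next-asym (s≤s (s≤s (s≤s _))) (inj₁ p) (inj₂ (q , q′)) with () ← trans (sym q′) (cong suc (trans p (cong suc q)))
  Next-asym (s≤s (s≤s (s≤s _))) (inj₂ (p , p′)) (inj₁ q) with () ← trans (sym p′) (cong suc (trans q (cong suc p)))
  Next-asym (s≤s (s≤s (s≤s _))) (inj₂ (_ , p)) (inj₂ (q , _)) with () ← trans (sym p) (cong suc q)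

  next : ∀ (i : Fin m) → ∃[ j ] Next i j
  next i with suc (toℕ i) ℕ.<? m
  ... | yes 1+i<m = fromℕ< 1+i<m , inj₁ (toℕ-fromℕ< 1+i<m)
  ... | no 1+i≮m = first i , inj₂ (first≡0 i , ℕ.≤-antisym (toℕ<n i) (ℕ.≮⇒≥ 1+i≮m))
    where
    first : ∀ {n} → Fin n → Fin n
    first {suc n} _ = zero

    first≡0 : ∀ {n} (i : Fin n) → toℕ (first i) ≡ 0
    first≡0 {suc n} _ = refl

  private
    opposite-sum : ∀ (i : Fin m) → toℕ (opposite i) + suc (toℕ i) ≡ m
    opposite-sum i = trans (cong (_+ suc (toℕ i)) (Fin.opposite-prop i)) (ℕ.m∸n+n≡m (toℕ<n i))

  -- Reflection reverses the orientation. It yields predecessors from successors, and the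
  -- automorphism that turns a backward arc forward.
  opposite-Next : ∀ {i j : Fin m} → Next i j → Next (opposite j) (opposite i)
  opposite-Next {i} {j} (inj₁ p) =
    inj₁ (ℕ.+-cancelʳ-≡ (suc (toℕ i)) _ _ (trans (opposite-sum i)
      (trans (sym (opposite-sum j)) (trans (cong (λ b → toℕ (opposite j) + suc b) p) (ℕ.+-suc _ _)))))
  opposite-Next {i} {j} (inj₂ (p , p′)) =
    inj₂ ( ℕ.+-cancelʳ-≡ (suc (toℕ i)) _ _ (trans (opposite-sum i) (sym p′))
         , trans (ℕ.+-comm 1 _) (trans (cong (λ b → toℕ (opposite j) + suc b) (sym p)) (opposite-sum j)))

  prev : ∀ (j : Fin m) → ∃[ i ] Next i j
  prev j with next (opposite j)
  ... | k , r = opposite k , subst (Next (opposite k)) (Fin.opposite-involutive j) (opposite-Next r)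

  CycleAdj-degree≤2 : ∀ {i a b c : Fin m} → CycleAdj i a → CycleAdj i b → CycleAdj i c → b ≢ a → c ≢ a → b ≡ c
  CycleAdj-degree≤2 (inj₁ _) (inj₂ q) (inj₂ r) _ _ = Next-injective q r
  CycleAdj-degree≤2 (inj₂ _) (inj₁ q) (inj₁ r) _ _ = Next-functional q r
  CycleAdj-degree≤2 (inj₁ p) (inj₁ q) _ b≢a _ = contradiction (Next-functional q p) b≢a
  CycleAdj-degree≤2 (inj₁ p) _ (inj₁ r) _ c≢a = contradiction (Next-functional r p) c≢a
  CycleAdj-degree≤2 (inj₂ p) (inj₂ q) _ b≢a _ = contradiction (Next-injective q p) b≢a
  CycleAdj-degree≤2 (inj₂ p) _ (inj₂ r) _ c≢a = contradiction (Next-injective r p) c≢a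

  private
    NextIso : Set
    NextIso = RelIso (Next {m}) (Next {m})

    rotation : NextIso
    rotation = record
      { bijection = mk↔ₛ′ ρ (proj₁ ∘ prev) (λ j → Next-functional (ρ-next _) (proj₂ (prev j)))
                      (λ i → Next-injective (proj₂ (prev (ρ i))) (ρ-next i))
      ; preserves = λ {i} {j} → mk⇔
          (λ r → subst (λ k → Next k (ρ j)) (Next-functional r (ρ-next i)) (ρ-next j))
          (λ r → subst (Next i) (Next-injective r (ρ-next j)) (ρ-next i))
      }
      where
      ρ : Fin m → Fin m
      ρ = proj₁ ∘ next

      ρ-next : ∀ i → Next i (ρ i)
      ρ-next = proj₂ ∘ next

    rotate-from-0 : ∀ n (i : Fin m) → toℕ i ≡ n → Σ NextIso λ g → ∃[ z ] (toℕ z ≡ 0 × RelIso.to g z ≡ i)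
    rotate-from-0 zero    i i≡0 = record { bijection = mk↔ₛ′ id id (λ _ → refl) (λ _ → refl) ; preserves = mk⇔ id id }
                                , i , i≡0 , refl
    rotate-from-0 (suc n) i i≡1+n with prev i
    ... | p , inj₂ (i≡0 , _) with () ← trans (sym i≡0) i≡1+n
    ... | p , inj₁ i≡1+p with rotate-from-0 n p (suc-injective (trans (sym i≡1+p) i≡1+n))
    ...   | g , z , z≡0 , gz≡p = RelIso-trans g rotation , z , z≡0 ,
      Next-functional (proj₂ (next _)) (subst (λ k → Next k i) (sym gz≡p) (inj₁ i≡1+p))

    rotate : ∀ (i i′ : Fin m) → Σ NextIso λ g → RelIso.to g i ≡ i′
    rotate i i′ with rotate-from-0 _ i refl | rotate-from-0 _ i′ refl
    ... | g , z , z≡0 , gz≡i | g′ , z′ , z′≡0 , g′z′≡i′ = RelIso-trans (RelIso-sym g) g′ ,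
      trans (cong (RelIso.to g′) (trans (cong (RelIso.from g) (sym gz≡i))
        (trans (from∘to g z) (toℕ-injective (trans z≡0 (sym z′≡0)))))) g′z′≡i′

    unorient : NextIso → RelIso (CycleAdj {m}) (CycleAdj {m})
    unorient g = record
      { bijection = RelIso.bijection g
      ; preserves = mk⇔ (λ { (inj₁ r) → inj₁ (preserve g r) ; (inj₂ r) → inj₂ (preserve g r) })
                        (λ { (inj₁ r) → inj₁ (reflect g r) ; (inj₂ r) → inj₂ (reflect g r) })
      }

    orient : ∀ {i j : Fin m} → CycleAdj i j →
      Σ (RelIso (CycleAdj {m}) (CycleAdj {m})) λ g → Next (RelIso.to g i) (RelIso.to g j)
    orient (inj₁ r) = record { bijection = mk↔ₛ′ id id (λ _ → refl) (λ _ → refl) ; preserves = mk⇔ id id } , r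
    orient (inj₂ r) = record
      { bijection = mk↔ₛ′ opposite opposite Fin.opposite-involutive Fin.opposite-involutive
      ; preserves = mk⇔ flip (λ s → subst₂ CycleAdj (Fin.opposite-involutive _) (Fin.opposite-involutive _) (flip s))
      } , opposite-Next r
      where
      flip : ∀ {i j : Fin m} → CycleAdj i j → CycleAdj (opposite i) (opposite j)
      flip (inj₁ r) = inj₂ (opposite-Next r)
      flip (inj₂ r) = inj₁ (opposite-Next r)

  -- Reflections make both arcs point forward; a rotation that matches their first ends then matches
  -- the second ends, as successors are unique.
  cycle-arc-transitive : ∀ {i j i′ j′ : Fin m} → CycleAdj i j → CycleAdj i′ j′ →
    Σ (RelIso (CycleAdj {m}) (CycleAdj {m})) λ g → RelIso.to g i ≡ i′ × RelIso.to g j ≡ j′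
  cycle-arc-transitive e e′ with orient e | orient e′
  ... | f , r | f′ , r′ with rotate (RelIso.to f _) (RelIso.to f′ _)
  ...   | ρ , ρfi≡f′i′ =
    RelIso-trans f (RelIso-trans (unorient ρ) (RelIso-sym f′))
    , trans (cong (RelIso.from f′) ρfi≡f′i′) (from∘to f′ _)
    , trans (cong (RelIso.from f′) (Next-functional (subst (λ k → Next k _) ρfi≡f′i′ (preserve ρ r)) r′)) (from∘to f′ _)

-- Homogeneity of cycles and semiregular trees

module _ (em : ExcludedMiddle 0ℓ) where

  -- An automorphism of a cycle is determined by its values on one edge; if the domain has an edge
  -- at `base`, that edge decides everything.
  cycle-homogeneous : ∀ m (3≤m : 3 ≤ m) → Homogeneous (cycle m 3≤m)
  cycle-homogeneous m 3≤m π with em {Σ Elements λ q → CycleAdj (proj₁ base) (proj₁ q)}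
    where open PartialIso π
  ... | no isolated = proj₁ g , λ p → agree p (connected base p)
    where
    open PartialIso π

    -- The domain is the single vertex `base`, so the arc that accompanies it may be chosen freely.
    g = cycle-arc-transitive (inj₁ (proj₂ (next (proj₁ base)))) (inj₁ (proj₂ (next (σ base))))

    agree : ∀ p → Star (λ (p q : Elements) → CycleAdj (proj₁ p) (proj₁ q)) base p → RelIso.to (proj₁ g) (proj₁ p) ≡ σ p
    agree _ ε       = proj₁ (proj₂ g)
    agree _ (_◅_ {j = q} e _) = contradiction (q , e) isolated
  ... | yes (q₀ , e₀) = proj₁ g , λ p → agree (connected base p) (proj₁ (proj₂ g)) e₀ (proj₂ (proj₂ g))
    where
    open PartialIso π

    g = cycle-arc-transitive e₀ (Equivalence.to (σ-adjacent {base} {q₀}) e₀)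

    Agree : Elements → Set
    Agree p = RelIso.to (proj₁ g) (proj₁ p) ≡ σ p

    -- Agreement is carried along on two adjacent vertices `u` and `v`: the next vertex of the walk
    -- is `v` or the only other neighbour of `u`.
    agree : ∀ {u v p} → Star (λ (p q : Elements) → CycleAdj (proj₁ p) (proj₁ q)) u p →
      Agree u → CycleAdj (proj₁ u) (proj₁ v) → Agree v → Agree p
    agree ε gu _ _ = gu
    agree {u} {v} (_◅_ {j = w} e ws) gu e′ gv = agree ws gw (swap e) gu
      where
      gw : Agree w
      gw with em {proj₁ w ≡ proj₁ v}
      ... | yes w≡v = subst Agree (Elements-≡ domain (sym w≡v)) gv
      ... | no w≢v  = CycleAdj-degree≤2 (Equivalence.to (σ-adjacent {u} {v}) e′)
        (subst (λ i → CycleAdj i (RelIso.to (proj₁ g) (proj₁ w))) gu (preserve (proj₁ g) e))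
        (Equivalence.to (σ-adjacent {u} {w}) e)
        (λ eq → w≢v (to-injective (proj₁ g) (trans eq (sym gv))))
        (λ eq → w≢v (cong proj₁ (σ-injective eq)))

  -- A state is a bijection between two neighbourhoods that follows `σ` at vertices of the domain.
  -- It records equal sides, so that the degrees agree.
  tree-homogeneous : ∀ {a b Γ} → IsSemiregularTree a b Γ → Homogeneous Γ
  tree-homogeneous {a} {b} {Γ} T π = automorphism , λ { (u , m) → sym (proj₁ (proj₂ (proj₂ (state u)) m)) }
    where
    open IsSemiregularTree T
    open Graph Γ
    open PartialIso π

    Bijection : V → V → Set
    Bijection u u′ = Neighbours Γ u ↔ Neighbours Γ u′

    Extends : ∀ u u′ → Bijection u u′ → Set
    Extends u u′ f = (m : member u) → σ (u , m) ≡ u′ ×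
      (∀ {n} (e : u ~ n) (m′ : member n) → proj₁ (Inverse.to f (n , e)) ≡ σ (n , m′))

    Neighbours-≡ : ∀ {u} {n n′ : Neighbours Γ u} → proj₁ n ≡ proj₁ n′ → n ≡ n′
    Neighbours-≡ refl = cong (_ ,_) (~-irrelevant _ _)

    choose : ∀ {u u′} → side u ≡ side u′ → (R : Neighbours Γ u → Neighbours Γ u′ → Set) →
      (∀ {n n₁ n₂} → R n n₁ → R n n₂ → n₁ ≡ n₂) → (∀ {n n₁ n₂} → R n₁ n → R n₂ n → n₁ ≡ n₂) →
      Σ (Bijection u u′) λ f → ∀ {n n′} → R n n′ → Inverse.to f n ≡ n′
    choose {u} {u′} su≡su′ R fun inj = extend-partial-bijection em (degree u)
      (subst (λ s → HasDegree Γ u′ (if s then a else b)) (sym su≡su′) (degree u′)) R fun inj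

    chooseIn : ∀ {u u′} (m : member u) → side u ≡ side u′ → σ (u , m) ≡ u′ → Σ (Bijection u u′) (Extends u u′)
    chooseIn {u} {u′} m su≡su′ σu≡u′ = proj₁ f , λ m′ → trans (σ-≡ m′ m refl) σu≡u′ ,
      λ {n} e m″ → cong proj₁ (proj₂ f {n , e} {σ (n , m″) ,
        subst (_~ σ (n , m″)) σu≡u′ (Equivalence.to (σ-adjacent {u , m} {n , m″}) e)} (m″ , refl))
      where
      f = choose su≡su′ (λ n n′ → Σ (member (proj₁ n)) λ m → σ (proj₁ n , m) ≡ proj₁ n′)
        (λ { (m , eq) (m′ , eq′) → Neighbours-≡ (trans (sym eq) (trans (σ-≡ m m′ refl) eq′)) })
        (λ { (m , eq) (m′ , eq′) → Neighbours-≡ (cong proj₁ (σ-injective (trans eq (sym eq′)))) })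

    State : V → V → Set
    State u u′ = side u ≡ side u′ × Σ (Bijection u u′) (Extends u u′)

    act : ∀ {t t′ s} → State t t′ → t ~ s → V
    act (_ , f , _) e = proj₁ (Inverse.to f (_ , e))

    -- The connected domain contains a reduced walk from `s` to `base`, and in the tree that is the
    -- only one.
    toward-base : ∀ {t s} (e : s ~ t) (w : Star _~_ t (proj₁ base)) → Reduced (e ◅ w) → member s → member t
    toward-base {t} {s} e w red m with reduce em (connected (s , m) base)
    ... | w′ , red′ = second w′ (subst (Via t) (reduced-unique Γ (proj₂ isTree) em (e ◅ w) (gmap proj₁ id w′) red
      (Reduced-gmap proj₁ id (λ _ _ p≢q eq → p≢q (Elements-≡ domain eq)) w′ red′)) refl)
      where
      second : ∀ {p} (w : Star (λ (p q : Elements) → proj₁ p ~ proj₁ q) p base) → Via t (gmap {U = _~_} proj₁ id w) → member t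
      second (_◅_ {j = q} _ _) refl = proj₂ q

    next′ : ∀ {t t′ s} (st : State t t′) (e : t ~ s) (w : Star _~_ t (proj₁ base)) → Reduced (~-sym e ◅ w) →
      Σ (State s (act st e)) λ st′ → act st′ (~-sym e) ≡ t′
    next′ {t} {t′} {s} st@(st≡st′ , f , ext) e w red with em {member s}
    ... | yes m = (sides , chooseIn m sides (sym (proj₂ (ext mt) e m)))
                , trans (proj₂ (proj₂ (chooseIn m sides (sym (proj₂ (ext mt) e m))) m) (~-sym e) mt) (proj₁ (ext mt))
      where
      mt = toward-base (~-sym e) w red m
      sides = ≢-≢⇒≡ {b = side t} (proper (~-sym e)) (λ eq → proper (proj₂ (Inverse.to f (s , e))) (trans (sym st≡st′) eq))
    -- Outside the domain the edge back to `t` is the only constraint.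
    ... | no ¬m = (sides , proj₁ f′ , λ m → contradiction m ¬m)
                , cong proj₁ (proj₂ f′ {t , ~-sym e} {t′ , ~-sym (proj₂ (Inverse.to f (s , e)))} (refl , refl))
      where
      sides = ≢-≢⇒≡ {b = side t} (proper (~-sym e)) (λ eq → proper (proj₂ (Inverse.to f (s , e))) (trans (sym st≡st′) eq))
      f′ = choose sides (λ n n′ → proj₁ n ≡ t × proj₁ n′ ≡ t′)
        (λ { (_ , eq) (_ , eq′) → Neighbours-≡ (trans eq (sym eq′)) })
        (λ { (eq , _) (eq′ , _) → Neighbours-≡ (trans eq (sym eq′)) })

    L : LocalSystem Γ (proj₁ base) (σ base)
    L = record
      { State          = State
      ; start          = even⇒same-side Γ proper (σ-even base) , chooseIn (proj₂ base) (even⇒same-side Γ proper (σ-even base)) refl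
      ; act            = act
      ; act-adjacent   = λ { (_ , f , _) e → proj₂ (Inverse.to f (_ , e)) }
      ; act-injective  = λ { (_ , f , _) e e′ eq → cong proj₁ (↔-to-injective f (Neighbours-≡ eq)) }
      ; act-surjective = λ { (_ , f , _) e → proj₁ (Inverse.from f (_ , e)) , proj₂ (Inverse.from f (_ , e))
                                           , cong proj₁ (Inverse.strictlyInverseˡ f (_ , e)) }
      ; next           = next′
      }

    open TreeExtension em Γ isTree L

-- The copies of Δ in DL(Δ)

module ArcLabels (Δ : BipartiteGraph) (T : Digraph)
  (φ : ∀ t → Digraph.In T t ↔ BipartiteGraph.X Δ)
  (ψ : ∀ t → Digraph.Out T t ↔ BipartiteGraph.Y Δ) where

  open BipartiteGraph Δ public
  open Digraph T public using (_⟶_; ⟶-asym; ⟶-irrelevant) renaming (V to VT)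
  open Graph (underlying T) public using () renaming (_~_ to _~ᵀ_; ~-sym to ~ᵀ-sym; ~-irrelevant to ~ᵀ-irrelevant)
  open Graph (graph Δ) public using () renaming (_~_ to _~ᐞ_; ~-sym to ~ᐞ-sym)

  Label : Set
  Label = X ⊎ Y

  side : Label → Bool
  side = sideOf Δ

  Vertex : Set
  Vertex = Arc Δ T φ ψ

  infix 4 _⟶ᴰ_ _⇀_
  _⟶ᴰ_ : Rel Vertex 0ℓ
  _⟶ᴰ_ = DLArc Δ T φ ψ

  -- Edges of Δ directed from X to Y: in the copy at a tree vertex, X labels the arcs that enter it
  -- and Y the arcs that leave it.
  _⇀_ : Rel Label 0ℓ
  u ⇀ v = u ~ᐞ v × side u ≡ true

  ~⇒⇀ : ∀ {u v} → u ~ᐞ v → u ⇀ v ⊎ v ⇀ u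
  ~⇒⇀ {inj₁ _} {inj₂ _} e = inj₁ (e , refl)
  ~⇒⇀ {inj₂ _} {inj₁ _} e = inj₂ (e , refl)

  ⟶-irrefl : ∀ {t s} → t ⟶ s → t ≢ s
  ⟶-irrefl p refl = ⟶-asym p p

  Arc-≡ : {e e′ : Vertex} → proj₁ e ≡ proj₁ e′ → proj₁ (proj₂ e) ≡ proj₁ (proj₂ e′) → e ≡ e′
  Arc-≡ {a , b , p} {_ , _ , q} refl refl = cong (λ p → a , b , p) (⟶-irrelevant p q)

  nbr : VT → Label → VT
  nbr s (inj₁ x) = proj₁ (Inverse.from (φ s) x)
  nbr s (inj₂ y) = proj₁ (Inverse.from (ψ s) y)

  nbr-adjacent : ∀ s v → s ~ᵀ nbr s v
  nbr-adjacent s (inj₁ x) = inj₂ (proj₂ (Inverse.from (φ s) x))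
  nbr-adjacent s (inj₂ y) = inj₁ (proj₂ (Inverse.from (ψ s) y))

  -- The copy of Δ in DL(Δ) located at the tree vertex s.
  arcAt : VT → Label → Vertex
  arcAt s (inj₁ x) = _ , s , proj₂ (Inverse.from (φ s) x)
  arcAt s (inj₂ y) = s , _ , proj₂ (Inverse.from (ψ s) y)

  label : ∀ {s t} → s ~ᵀ t → Label
  label {s} {t} (inj₁ p) = inj₂ (Inverse.to (ψ s) (t , p))
  label {s} {t} (inj₂ p) = inj₁ (Inverse.to (φ s) (t , p))

  nbr-label : ∀ {s t} (e : s ~ᵀ t) → nbr s (label e) ≡ t
  nbr-label {s} (inj₁ p) = cong proj₁ (Inverse.strictlyInverseʳ (ψ s) (_ , p))
  nbr-label {s} (inj₂ p) = cong proj₁ (Inverse.strictlyInverseʳ (φ s) (_ , p))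

  label-nbr : ∀ s v → label (nbr-adjacent s v) ≡ v
  label-nbr s (inj₁ x) = cong inj₁ (Inverse.strictlyInverseˡ (φ s) x)
  label-nbr s (inj₂ y) = cong inj₂ (Inverse.strictlyInverseˡ (ψ s) y)

  label-cong : ∀ {s t t′} (e : s ~ᵀ t) (e′ : s ~ᵀ t′) → t ≡ t′ → label e ≡ label e′
  label-cong e e′ refl = cong label (~ᵀ-irrelevant e e′)

  nbr-injective : ∀ s {u v} → nbr s u ≡ nbr s v → u ≡ v
  nbr-injective s {u} {v} eq =
    trans (sym (label-nbr s u)) (trans (label-cong _ _ eq) (label-nbr s v))

  label-nbr-≡ : ∀ {s t v} (e : s ~ᵀ t) → nbr s v ≡ t → label e ≡ v
  label-nbr-≡ {s} e eq = nbr-injective s (trans (nbr-label e) (sym eq))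

  side-label-sym : ∀ {s t} (e : s ~ᵀ t) → side (label (~ᵀ-sym e)) ≡ not (side (label e))
  side-label-sym (inj₁ p) = refl
  side-label-sym (inj₂ p) = refl

  -- This is how copies are glued: an arc of T has a Y-label at its tail and an X-label at its head.
  arc-label : ∀ {s t} (e : s ~ᵀ t) → arcAt s (label e) ≡ arcAt t (label (~ᵀ-sym e))
  arc-label (inj₁ p) = Arc-≡ (sym (nbr-label (inj₂ p))) (nbr-label (inj₁ p))
  arc-label (inj₂ p) = Arc-≡ (nbr-label (inj₂ p)) (sym (nbr-label (inj₁ p)))

  arcAt-head : ∀ {a b} (p : a ⟶ b) → arcAt b (label (inj₂ p)) ≡ (a , b , p)
  arcAt-head p = Arc-≡ (nbr-label (inj₂ p)) refl

  arcAt-tail : ∀ {a b} (p : a ⟶ b) → arcAt a (label (inj₁ p)) ≡ (a , b , p)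
  arcAt-tail p = Arc-≡ refl (nbr-label (inj₁ p))

  arcAt-injective : ∀ s {u v} → arcAt s u ≡ arcAt s v → u ≡ v
  arcAt-injective s {inj₁ _} {inj₁ _} eq = nbr-injective s (cong proj₁ eq)
  arcAt-injective s {inj₂ _} {inj₂ _} eq = nbr-injective s (cong (proj₁ ∘ proj₂) eq)
  arcAt-injective s {inj₁ x} {inj₂ _} eq = contradiction (cong proj₁ eq) (⟶-irrefl (proj₂ (Inverse.from (φ s) x)))
  arcAt-injective s {inj₂ _} {inj₁ x} eq = contradiction (sym (cong proj₁ eq)) (⟶-irrefl (proj₂ (Inverse.from (φ s) x)))

  -- An arc with an X-label at `s` ends at `s`, so its out-neighbours in DL(Δ) start at `s` and
  -- belong to the same copy.
  arc-out : ∀ {s u e} → side u ≡ true → arcAt s u ⟶ᴰ e → ∃[ v ] (arcAt s v ≡ e × side v ≡ false × u ⇀ v)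
  arc-out {s} {inj₁ x} _ (arc p q ε′) = _ , arcAt-tail q , refl ,
    subst (λ x → E x _) (Inverse.strictlyInverseˡ (φ s) x) ε′ , refl

  arc-in : ∀ {s v e} → side v ≡ false → e ⟶ᴰ arcAt s v → ∃[ u ] (arcAt s u ≡ e × side u ≡ true × u ⇀ v)
  arc-in {s} {inj₂ y} _ (arc p q ε′) = _ , arcAt-head p , refl ,
    subst (E _) (Inverse.strictlyInverseˡ (ψ s) y) ε′ , refl

  ⇀⇒⟶ : ∀ s {u v} → u ⇀ v → arcAt s u ⟶ᴰ arcAt s v
  ⇀⇒⟶ s {inj₁ x} {inj₂ y} (e , _) = arc _ _
    (subst₂ E (sym (Inverse.strictlyInverseˡ (φ s) x)) (sym (Inverse.strictlyInverseˡ (ψ s) y)) e)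

  ⟶-meets : ∀ {e e′} → e ⟶ᴰ e′ → proj₁ (proj₂ e) ≡ proj₁ e′
  ⟶-meets (arc _ _ _) = refl

  ⟶⇒⇀ : ∀ s {u v} → arcAt s u ⟶ᴰ arcAt s v → u ⇀ v
  ⟶⇒⇀ s {inj₁ x} {v} d with arc-out {s} {inj₁ x} refl d
  ... | w , eq , _ , h = subst (inj₁ x ⇀_) (arcAt-injective s eq) h
  ⟶⇒⇀ s {inj₂ y} {inj₁ x} d = contradiction (proj₂ (Inverse.from (φ s) x))
    (⟶-asym (subst (s ⟶_) (⟶-meets d) (proj₂ (Inverse.from (ψ s) y))))
  ⟶⇒⇀ s {inj₂ y} {inj₂ _} d = contradiction (sym (⟶-meets d)) (⟶-irrefl (proj₂ (Inverse.from (ψ s) y)))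

  Local : Subset Vertex → VT → Subset Label
  Local P s = record { member = λ u → Subset.member P (arcAt s u) ; member-irrelevant = Subset.member-irrelevant P }

  LocalStar : ∀ P s → Rel (Subset.Elements (Local P s)) 0ℓ
  LocalStar P s = Star (λ l l′ → proj₁ l ~ᐞ proj₁ l′)

  module Propagation (P : Subset Vertex) (σ : Subset.Elements P → Vertex)
    (σ-preserves : ∀ {p q} → proj₁ p ⟶ᴰ proj₁ q → σ p ⟶ᴰ σ q) where
    open Subset P

    at : ∀ s → Subset.Elements (Local P s) → Elements
    at s (u , m) = arcAt s u , m

    Lands : ∀ s s′ → Subset.Elements (Local P s) → Set
    Lands s s′ l = ∃[ u′ ] (side u′ ≡ side (proj₁ l) × σ (at s l) ≡ arcAt s′ u′)

    -- A vertex lies in two copies, and its side together with the direction of an arc tells in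
    -- which of them the other end is found. So one vertex that lands in the copy at `s′` on its own
    -- side brings its connected part along.
    propagate : ∀ {s s′ l l′} → LocalStar P s l l′ → Lands s s′ l → Lands s s′ l′
    propagate ε land = land
    propagate {s} {s′} {l} (_◅_ {j = k} e w) (u′ , same , eq) = propagate w (step (~⇒⇀ {proj₁ l} {proj₁ k} e))
      where
      step : proj₁ l ⇀ proj₁ k ⊎ proj₁ k ⇀ proj₁ l → Lands s s′ k
      step (inj₁ h) with arc-out {s′} {u′} (trans same (proj₂ h)) (subst (_⟶ᴰ σ (at s k)) eq (σ-preserves (⇀⇒⟶ s h)))
      ... | v , eq′ , sv , _ = v , trans sv (sym (trans (¬-not (sideOf-proper Δ {proj₁ k} {proj₁ l} (~ᐞ-sym {proj₁ l} {proj₁ k} e))) (cong not (proj₂ h)))) , sym eq′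
      step (inj₂ h) with arc-in {s′} {u′} (trans same (trans (¬-not (sideOf-proper Δ {proj₁ l} {proj₁ k} e)) (cong not (proj₂ h))))
                           (subst (σ (at s k) ⟶ᴰ_) eq (σ-preserves (⇀⇒⟶ s h)))
      ... | v , eq′ , sv , _ = v , trans sv (sym (proj₂ h)) , sym eq′

module Tracking (em : ExcludedMiddle 0ℓ) (Δ : BipartiteGraph) (T : Digraph)
  (φ : ∀ t → Digraph.In T t ↔ BipartiteGraph.X Δ)
  (ψ : ∀ t → Digraph.Out T t ↔ BipartiteGraph.Y Δ)
  (tree : IsTree (underlying T))
  (P : Subset (Arc Δ T φ ψ))
  (connected : Connected (underlying (Induced (DL Δ T φ ψ) P))) where

  open ArcLabels Δ T φ ψ
  open Subset P

  Avoiding : VT → Rel VT 0ℓ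
  Avoiding s t t′ = t ~ᵀ t′ × t ≢ s × t′ ≢ s

  -- t lies in the branch at s that starts with the arc labelled v.
  InBranch : VT → Label → VT → Set
  InBranch s v t = Star (Avoiding s) (nbr s v) t

  branch-walk : ∀ {s v t} → InBranch s v t → Σ (Star _~ᵀ_ (nbr s v) t) λ w → Reduced (nbr-adjacent s v ◅ w)
  branch-walk {s} {v} w with reduce em w
  ... | w′ , red = gmap id proj₁ w′ , ¬back w′ , Reduced-gmap id proj₁ (λ _ _ t≢u → t≢u) w′ red
    where
    ¬back : ∀ {t r} (w : Star (Avoiding s) t r) → ¬ Via {R = _~ᵀ_} s (gmap id proj₁ w)
    ¬back ((_ , _ , t≢s) ◅ _) s≡t = t≢s (sym s≡t)

  branch-start : ∀ {s v t t′} → InBranch s v t′ → (e : s ~ᵀ t) (w : Star _~ᵀ_ t t′) → Reduced (e ◅ w) → nbr s v ≡ t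
  branch-start {s} {v} {t} b e w red with branch-walk {v = v} b
  ... | w′ , red′ = sym (subst (Via t) (reduced-unique (underlying T) (proj₂ tree) em (e ◅ w) (nbr-adjacent s v ◅ w′) red red′) refl)

  branch-unique : ∀ {s v v′ t} → InBranch s v t → InBranch s v′ t → v ≡ v′
  branch-unique {s} {v} {v′} b b′ with branch-walk {v = v′} b′
  ... | w , red = nbr-injective s (branch-start {v = v} b (nbr-adjacent s v′) w red)

  -- The arc is `arcAt s v` or lies beyond it. An end equal to `s` is exempt, since no branch
  -- contains `s`.
  Hangs : VT → Vertex → Label → Set
  Hangs s (a , b , _) v = (a ≢ s → InBranch s v a) × (b ≢ s → InBranch s v b)

  arcAt-hangs : ∀ s v → Hangs s (arcAt s v) v
  arcAt-hangs s (inj₁ x) = (λ _ → ε) , (λ s≢s → contradiction refl s≢s)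
  arcAt-hangs s (inj₂ y) = (λ s≢s → contradiction refl s≢s) , (λ _ → ε)

  private
    -- An arc of DL(Δ) whose middle vertex is not `s` stays in one branch at `s`. If its middle
    -- vertex is `s`, it is an edge of the copy at `s`, and the tracked label moves along that edge.
    move : ∀ {s} {p q : Elements} (l : Subset.Elements (Local P s)) → proj₁ p ⟶ᴰ proj₁ q ⊎ proj₁ q ⟶ᴰ proj₁ p →
      Hangs s (proj₁ p) (proj₁ l) → Σ (Subset.Elements (Local P s)) λ l′ → LocalStar P s l l′ × Hangs s (proj₁ q) (proj₁ l′)
    move {s} {q = _ , m} (v , mv) (inj₁ (arc {b = b} p q e)) (left , right) with em {b ≡ s}
    ... | no b≢s = (v , mv) , ε , (λ _ → right b≢s) ,
      λ d≢s → right b≢s ◅◅ ((inj₁ q , b≢s , d≢s) ◅ ε)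
    ... | yes refl with branch-unique {v = v} {label (inj₂ p)} (left (⟶-irrefl p)) (subst (InBranch b (label (inj₂ p))) (nbr-label (inj₂ p)) ε)
    ...   | refl = (label (inj₁ q) , subst member (sym (arcAt-tail q)) m) , e ◅ ε ,
      subst (λ e → Hangs b e (label (inj₁ q))) (arcAt-tail q) (arcAt-hangs b (label (inj₁ q)))
    move {s} {q = _ , m} (v , mv) (inj₂ (arc {b = b} p q e)) (left , right) with em {b ≡ s}
    ... | no b≢s = (v , mv) , ε , (λ a≢s → left b≢s ◅◅ ((inj₂ p , b≢s , a≢s) ◅ ε)) , λ _ → left b≢s
    ... | yes refl with branch-unique {v = v} {label (inj₁ q)} (right (⟶-irrefl q ∘ sym)) (subst (InBranch b (label (inj₁ q))) (nbr-label (inj₁ q)) ε)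
    ...   | refl = (label (inj₂ p) , subst member (sym (arcAt-head p)) m) , e ◅ ε ,
      subst (λ e → Hangs b e (label (inj₂ p))) (arcAt-head p) (arcAt-hangs b (label (inj₂ p)))

  track : ∀ {s} {p q : Elements} (l : Subset.Elements (Local P s)) →
    Star (λ (p q : Elements) → proj₁ p ⟶ᴰ proj₁ q ⊎ proj₁ q ⟶ᴰ proj₁ p) p q →
    Hangs s (proj₁ p) (proj₁ l) → Σ (Subset.Elements (Local P s)) λ l′ → LocalStar P s l l′ × Hangs s (proj₁ q) (proj₁ l′)
  track l ε       h = l , ε , h
  track {p = p} l (_◅_ {j = k} e w) h with move {p = p} {k} l e h
  ... | l′ , w′ , h′ with track l′ w h′
  ...   | l″ , w″ , h″ = l″ , w′ ◅◅ w″ , h″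

  private
    track-from : ∀ s (l : Subset.Elements (Local P s)) (q : Elements) →
      Σ (Subset.Elements (Local P s)) λ l′ → LocalStar P s l l′ × Hangs s (proj₁ q) (proj₁ l′)
    track-from s l q = track l (proj₂ connected (arcAt s (proj₁ l) , proj₂ l) q) (arcAt-hangs s (proj₁ l))

  -- A walk in the subdigraph may leave the copy at `s`, but the branches that it visits trace out a
  -- walk within the copy.
  local-connected : ∀ s (l l′ : Subset.Elements (Local P s)) → LocalStar P s l l′
  local-connected s l (v , m) with track-from s l (arcAt s v , m)
  ... | l″ , w , h = subst (LocalStar P s l) (Elements-≡ (Local P s) (branch-unique {v = proj₁ l″} {v} (end {v} {proj₁ l″} h) ε)) w
    where
    end : ∀ {v v′} → Hangs s (arcAt s v) v′ → InBranch s v′ (nbr s v)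
    end {inj₁ x} (left , _)  = left (⟶-irrefl (proj₂ (Inverse.from (φ s) x)))
    end {inj₂ y} (_ , right) = right (⟶-irrefl (proj₂ (Inverse.from (ψ s) y)) ∘ sym)

  -- A walk from the copy at `s` to the copy at `r` ends in the branch that starts with `e`, and the
  -- label tracked along it always belongs to the subset.
  arc-toward : ∀ {s t r u u′} → member (arcAt s u) → member (arcAt r u′) →
    (e : s ~ᵀ t) (w : Star _~ᵀ_ t r) → Reduced (e ◅ w) → member (arcAt s (label e))
  arc-toward {s} {t} {r} {u} {u′} m m′ e w red with track-from s (u , m) (arcAt r u′ , m′)
  ... | (v , mv) , _ , h = subst (member ∘ arcAt s) (sym (label-nbr-≡ e (branch-start {v = v} (end {u′} {v} h) e w red))) mv
    where
    r≢s : r ≢ s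
    r≢s refl = no-closed-reduced (underlying T) (proj₂ tree) e w red

    end : ∀ {u v} → Hangs s (arcAt r u) v → InBranch s v r
    end {inj₁ _} (_ , right) = right r≢s
    end {inj₂ _} (left , _)  = left r≢s

-- From homogeneity of Δ to automorphisms of DL(Δ)

module _ (em : ExcludedMiddle 0ℓ) (Δ : BipartiteGraph) (T : Digraph)
  (φ : ∀ t → Digraph.In T t ↔ BipartiteGraph.X Δ)
  (ψ : ∀ t → Digraph.Out T t ↔ BipartiteGraph.Y Δ)
  (tree : IsTree (underlying T)) (Δ-connected : Connected (graph Δ)) where

  open ArcLabels Δ T φ ψ

  homogeneous⇒DL-connectedHomogeneous : Homogeneous (graph Δ) → ConnectedHomogeneous (DL Δ T φ ψ)
  homogeneous⇒DL-connectedHomogeneous hom P Q _ _ P-connected _ σ-iso = DL-automorphism , extends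
    where
    open Subset P
    open Tracking em Δ T φ ψ tree P P-connected

    σ : Elements → Vertex
    σ p = proj₁ (RelIso.to σ-iso p)

    σ-injective : ∀ {p q} → σ p ≡ σ q → p ≡ q
    σ-injective eq = to-injective σ-iso (Elements-≡ Q eq)

    σ-cong : ∀ {e e′} (m : member e) (m′ : member e′) → e ≡ e′ → σ (e , m) ≡ σ (e′ , m′)
    σ-cong m m′ eq = cong σ (Elements-≡ P eq)

    open Propagation P σ (λ {p} {q} → preserve σ-iso {p} {q})

    LocalAut : Set
    LocalAut = Σ (graph Δ ≅ graph Δ) λ g → ∀ v → side (RelIso.to g v) ≡ side v

    Extends : VT → VT → graph Δ ≅ graph Δ → Set
    Extends s s′ g = ∀ u (m : member (arcAt s u)) → arcAt s′ (RelIso.to g u) ≡ σ (arcAt s u , m)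

    -- Knowing that one vertex of the trace of `P` lands in the copy at `s′` suffices: the trace is
    -- connected, so `σ` restricts to a partial isomorphism of Δ.
    extend : ∀ {s s′ w′} (w : Subset.Elements (Local P s)) → side w′ ≡ side (proj₁ w) → σ (at s w) ≡ arcAt s′ w′ →
      Σ LocalAut λ g → Extends s s′ (proj₁ g) × RelIso.to (proj₁ g) (proj₁ w) ≡ w′
    extend {s} {s′} {w′} w same eq =
      (g , same-sides-preserved (graph Δ) (λ {u} {v} → sideOf-proper Δ {u} {v}) (proj₂ Δ-connected) g
        (trans (cong side (proj₂ ext w)) (proj₁ (proj₂ (landing w))))) , agree ,
      arcAt-injective s′ (trans (agree (proj₁ w) (proj₂ w)) eq)
      where
      landing : ∀ l → Lands s s′ l
      landing l = propagate {l = w} (local-connected s w l) (w′ , same , eq)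

      π : PartialIso (graph Δ)
      π = record
        { domain      = Local P s
        ; σ           = proj₁ ∘ landing
        ; base        = w
        ; connected   = local-connected s
        ; σ-injective = λ {p} {q} eq → Elements-≡ (Local P s) (arcAt-injective s (cong proj₁
            (σ-injective (trans (proj₂ (proj₂ (landing p))) (trans (cong (arcAt s′) eq) (sym (proj₂ (proj₂ (landing q)))))))))
        ; σ-adjacent  = λ {p} {q} → mk⇔
            (λ e → [ arrow p q , (λ h → ~ᐞ-sym {proj₁ (landing q)} {proj₁ (landing p)} (arrow q p h)) ]′ (~⇒⇀ {proj₁ p} {proj₁ q} e))
            (λ e → [ arrow⁻¹ p q , (λ h → ~ᐞ-sym {proj₁ q} {proj₁ p} (arrow⁻¹ q p h)) ]′ (~⇒⇀ {proj₁ (landing p)} {proj₁ (landing q)} e))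
        ; σ-even      = λ p → same-side⇒even (graph Δ) (λ {u} {v} → sideOf-proper Δ {u} {v})
            (proj₂ Δ-connected _ _) (sym (proj₁ (proj₂ (landing p))))
        }
        where
        arrow : ∀ p q → proj₁ p ⇀ proj₁ q → proj₁ (landing p) ~ᐞ proj₁ (landing q)
        arrow p q h = proj₁ (⟶⇒⇀ s′ (subst₂ _⟶ᴰ_ (proj₂ (proj₂ (landing p))) (proj₂ (proj₂ (landing q)))
          (preserve σ-iso {at s p} {at s q} (⇀⇒⟶ s h))))

        arrow⁻¹ : ∀ p q → proj₁ (landing p) ⇀ proj₁ (landing q) → proj₁ p ~ᐞ proj₁ q
        arrow⁻¹ p q h = proj₁ (⟶⇒⇀ s (reflect σ-iso {at s p} {at s q}
          (subst₂ _⟶ᴰ_ (sym (proj₂ (proj₂ (landing p)))) (sym (proj₂ (proj₂ (landing q)))) (⇀⇒⟶ s′ h))))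

      ext = hom π
      g = proj₁ ext

      agree : Extends s s′ g
      agree u m = trans (cong (arcAt s′) (proj₂ ext (u , m))) (sym (proj₂ (proj₂ (landing (u , m)))))

    send : ∀ {w w′} → side w′ ≡ side w → Σ LocalAut λ g → RelIso.to (proj₁ g) w ≡ w′
    send {w} {w′} same = (g , same-sides-preserved (graph Δ) (λ {u} {v} → sideOf-proper Δ {u} {v}) (proj₂ Δ-connected) g
                               (trans (cong side gw≡w′) same)) , gw≡w′
      where
      ext = hom record
        { domain      = record { member = _≡ w ; member-irrelevant = λ { refl refl → refl } }
        ; σ           = λ _ → w′
        ; base        = w , refl
        ; connected   = λ { (_ , refl) (_ , refl) → ε }
        ; σ-injective = λ { {_ , refl} {_ , refl} _ → refl }
        ; σ-adjacent  = λ { {_ , refl} {_ , refl} → mk⇔ (λ e → contradiction e (Graph.~-irrefl (graph Δ) {w} {w} refl))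
                                                       (λ e → contradiction e (Graph.~-irrefl (graph Δ) {w′} {w′} refl)) }
        ; σ-even      = λ { (_ , refl) → same-side⇒even (graph Δ) (λ {u} {v} → sideOf-proper Δ {u} {v})
                            (proj₂ Δ-connected _ _) (sym same) }
        }
      g = proj₁ ext
      gw≡w′ = proj₂ ext (w , refl)

    State : VT → VT → Set
    State t t′ = Σ LocalAut (Extends t t′ ∘ proj₁)

    act-label : ∀ {t t′ s} → State t t′ → t ~ᵀ s → Label
    act-label ((g , _) , _) e = RelIso.to g (label e)

    act : ∀ {t t′ s} → State t t′ → t ~ᵀ s → VT
    act {t′ = t′} st e = nbr t′ (act-label st e)

    -- If `P` meets the copy at `s`, it contains the arc of `e`, where the state at `t` already
    -- follows `σ`; any local extension of `σ` at `s` then sends this arc back correctly. If not,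
    -- only the label of this arc is prescribed.
    next-state : ∀ {r} u₀ → member (arcAt r u₀) → ∀ {t t′ s} (st : State t t′) (e : t ~ᵀ s) (w : Star _~ᵀ_ t r) →
      Reduced (~ᵀ-sym e ◅ w) → Σ (State s (act st e)) λ st′ → act st′ (~ᵀ-sym e) ≡ t′
    next-state {r} u₀ m₀ {t} {t′} {s} st@((g , g-side) , ext) e w red = choose em
      where
      s′ = act st e

      e′ : t′ ~ᵀ s′
      e′ = nbr-adjacent t′ (act-label st e)

      back back′ : Label
      back  = label (~ᵀ-sym e)
      back′ = label (~ᵀ-sym e′)

      e′-label : label e′ ≡ RelIso.to g (label e)
      e′-label = label-nbr t′ _

      same : side back′ ≡ side back
      same = trans (side-label-sym e′) (trans (cong not (trans (cong side e′-label) (g-side _))) (sym (side-label-sym e)))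

      finish : ∀ {v} → v ≡ back′ → nbr s′ v ≡ t′
      finish refl = nbr-label (~ᵀ-sym e′)

      choose : Dec (∃[ u ] member (arcAt s u)) → Σ (State s s′) λ st′ → act st′ (~ᵀ-sym e) ≡ t′
      choose (yes (u , m)) = (proj₁ ext′ , proj₁ (proj₂ ext′)) , finish (proj₂ (proj₂ ext′))
        where
        mb = arc-toward {u = u} {u₀} m m₀ (~ᵀ-sym e) w red
        ext′ = extend {s} {s′} {back′} (back , mb) same
          (trans (σ-cong mb (subst member (sym (arc-label e)) mb) (sym (arc-label e)))
            (trans (sym (ext (label e) _)) (trans (cong (arcAt t′) (sym e′-label)) (arc-label e′))))
      choose (no empty) = (proj₁ sent , λ u m → contradiction (u , m) empty) , finish (proj₂ sent)
        where
        sent = send {back} {back′} same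

    base : Elements
    base = proj₁ P-connected

    -- Both roots are heads, so `base` and its image carry X-labels there and their sides agree by
    -- `refl`.
    r r′ : VT
    r  = proj₁ (proj₂ (proj₁ base))
    r′ = proj₁ (proj₂ (σ base))

    m₀ : member (arcAt r (label (inj₂ (proj₂ (proj₂ (proj₁ base))))))
    m₀ = subst member (sym (arcAt-head (proj₂ (proj₂ (proj₁ base))))) (proj₂ base)

    L : LocalSystem (underlying T) r r′
    L = record
      { State          = State
      ; start          = let ext = extend {r} {r′} {label (inj₂ (proj₂ (proj₂ (σ base))))} (_ , m₀) refl
                               (trans (σ-cong m₀ (proj₂ base) (arcAt-head (proj₂ (proj₂ (proj₁ base)))))
                                 (sym (arcAt-head (proj₂ (proj₂ (σ base))))))
                         in proj₁ ext , proj₁ (proj₂ ext)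
      ; act            = act
      ; act-adjacent   = λ st e → nbr-adjacent _ (act-label st e)
      ; act-injective  = λ { {t} {t′} ((g , _) , _) e e₁ eq → trans (sym (nbr-label e))
                             (trans (cong (nbr t) (to-injective g (nbr-injective t′ eq))) (nbr-label e₁)) }
      ; act-surjective = λ { {t} {t′} ((g , _) , _) e → _ , nbr-adjacent t (RelIso.from g (label e)) ,
                             trans (cong (nbr t′ ∘ RelIso.to g) (label-nbr t _))
                               (trans (cong (nbr t′) (to∘from g _)) (nbr-label e)) }
      ; next           = next-state (label (inj₂ (proj₂ (proj₂ (proj₁ base))))) m₀
      }

    open TreeExtension em (underlying T) tree L

    local : ∀ t → graph Δ ≅ graph Δ
    local t = proj₁ (proj₁ (state t))

    local-side : ∀ t v → side (RelIso.to (local t) v) ≡ side v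
    local-side t = proj₂ (proj₁ (state t))

    label-α : ∀ {t s} (e : t ~ᵀ s) (e′ : α t ~ᵀ α s) → label e′ ≡ RelIso.to (local t) (label e)
    label-α e e′ = label-nbr-≡ e′ (act-state e)

    α-forward : ∀ {t s} → t ⟶ s → α t ⟶ α s
    α-forward {t} {s} p = oriented (α-adjacent (inj₁ p)) refl
      where
      oriented : ∀ (e : α t ~ᵀ α s) → α-adjacent (inj₁ p) ≡ e → α t ⟶ α s
      oriented (inj₁ q) _  = q
      -- A reversed arc would have its label moved from Y to X.
      oriented (inj₂ q) eq with () ← trans (cong side (label-α (inj₁ p) (inj₂ q))) (local-side t _)

    α-backward : ∀ {t s} → α t ⟶ α s → t ⟶ s
    α-backward q with α-reflect (inj₁ q)
    ... | inj₁ p = p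
    ... | inj₂ p = contradiction q (⟶-asym (α-forward p))

    β β⁻¹ : Vertex → Vertex
    β   (a , b , p) = α a , α b , α-forward p
    β⁻¹ (a , b , p) = proj₁ (α-surjective a) , proj₁ (α-surjective b) ,
      α-backward (subst₂ _⟶_ (sym (proj₂ (α-surjective a))) (sym (proj₂ (α-surjective b))) p)

    β-arcAt : ∀ t u → β (arcAt t u) ≡ arcAt (α t) (RelIso.to (local t) u)
    β-arcAt t u = go u (RelIso.to (local t) u) (local-side t u)
                     (trans (sym (act-state (nbr-adjacent t u))) (cong (nbr (α t) ∘ RelIso.to (local t)) (label-nbr t u)))
      where
      go : ∀ u v → side v ≡ side u → α (nbr t u) ≡ nbr (α t) v → β (arcAt t u) ≡ arcAt (α t) v
      go (inj₁ _) (inj₁ _) _ eq = Arc-≡ eq refl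
      go (inj₂ _) (inj₂ _) _ eq = Arc-≡ refl eq

    β-head : ∀ {a b} (p : a ⟶ b) → β (a , b , p) ≡ arcAt (α b) (RelIso.to (local b) (label (inj₂ p)))
    β-head p = trans (cong β (sym (arcAt-head p))) (β-arcAt _ _)

    β-tail : ∀ {a b} (p : a ⟶ b) → β (a , b , p) ≡ arcAt (α a) (RelIso.to (local a) (label (inj₁ p)))
    β-tail p = trans (cong β (sym (arcAt-tail p))) (β-arcAt _ _)

    β-preserves : ∀ {e e′} → e ⟶ᴰ e′ → β e ⟶ᴰ β e′
    β-preserves (arc {b = b} p q ε′) = subst₂ _⟶ᴰ_ (sym (β-head p)) (sym (β-tail q))
      (⇀⇒⟶ (α b) {RelIso.to (local b) (label (inj₂ p))} {RelIso.to (local b) (label (inj₁ q))} (preserve (local b) {label (inj₂ p)} {label (inj₁ q)} ε′ , local-side b (label (inj₂ p))))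

    β-reflects : ∀ {e e′} → β e ⟶ᴰ β e′ → e ⟶ᴰ e′
    β-reflects {a , b , p} {c , d , q} h with α-injective (⟶-meets h)
    ... | refl = subst₂ _⟶ᴰ_ (arcAt-head p) (arcAt-tail q)
      (⇀⇒⟶ b {label (inj₂ p)} {label (inj₁ q)} (reflect (local b) {label (inj₂ p)} {label (inj₁ q)} (proj₁ (⟶⇒⇀ (α b) (subst₂ _⟶ᴰ_ (β-head p) (β-tail q) h))) , refl))

    DL-automorphism : DL Δ T φ ψ ≅ᵈ DL Δ T φ ψ
    DL-automorphism = record
      { bijection = mk↔ₛ′ β β⁻¹ (λ e → Arc-≡ (proj₂ (α-surjective _)) (proj₂ (α-surjective _)))
          (λ e → Arc-≡ (α-injective (proj₂ (α-surjective _))) (α-injective (proj₂ (α-surjective _))))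
      ; preserves = mk⇔ β-preserves β-reflects
      }

    extends : ∀ p → RelIso.to DL-automorphism (proj₁ p) ≡ proj₁ (RelIso.to σ-iso p)
    extends ((a , b , p) , m) = trans (β-head p) (trans (proj₂ (state b) (label (inj₂ p)) m′) (σ-cong m′ m (arcAt-head p)))
      where
      m′ = subst member (sym (arcAt-head p)) m

-- Moves

module _ (Γ : Graph) where
  open Graph Γ

  -- Each vertex of the list is adjacent to a later one, so the list spans a
  -- connected subgraph.
  Built : List V → Set
  Built []      = ⊤
  Built (v ∷ l) = (l ≡ [] ⊎ Any (v ~_) l) × Built l

  Built-connected : (P : Subset V) → ∀ {v l} → Built (v ∷ l) → (inc : ∀ {u} → u ∈ v ∷ l → Subset.member P u) →
    ∀ {u} (m : u ∈ v ∷ l) → Star (λ (p q : Subset.Elements P) → proj₁ p ~ proj₁ q) (u , inc m) (v , inc (here refl))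
  Built-connected P _ inc (here refl) = ε
  Built-connected P {l = _ ∷ _} (inj₂ nb , built) inc (there m) with find nb
  ... | z , z∈l , v~z = Built-connected P built (inc ∘ there) m ◅◅
    Star.reverse (~-sym) (Built-connected P built (inc ∘ there) z∈l) ◅◅ (~-sym v~z ◅ ε)

  Built-replace : ∀ {v v′ l} → (∀ {u} → u ∈ l → v ~ u → v′ ~ u) → Built (v ∷ l) → Built (v′ ∷ l)
  Built-replace imp (inj₁ empty , built) = inj₁ empty , built
  Built-replace imp (inj₂ nb , built) with find nb
  ... | u , u∈l , v~u = inj₂ (lose u∈l (imp u∈l v~u)) , built

-- The double negation makes membership proof-irrelevant.
listSubset : ∀ {A : Set} → List A → Subset A
listSubset l = record { member = λ u → ¬ ¬ (u ∈ l) ; member-irrelevant = λ _ _ → refl }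

module _ (em : ExcludedMiddle 0ℓ) where

  double-negation : ∀ {A : Set} → ¬ ¬ A → A
  double-negation {A} ¬¬a with em {A}
  ... | yes a = a
  ... | no ¬a = contradiction ¬a ¬¬a

  listSubset-finite : ∀ {A : Set} (l : List A) → Finite (Subset.Elements (listSubset l))
  listSubset-finite l = finite-injection em (length l) position
    (λ {p} {q} eq → Elements-≡ (listSubset l) (trans (at-position p) (trans (cong (lookup l) eq) (sym (at-position q)))))
    where
    position : Subset.Elements (listSubset l) → Fin (length l)
    position (u , m) = index (double-negation m)

    at-position : ∀ p → proj₁ p ≡ lookup l (position p)
    at-position (u , m) = lookup-index (double-negation m)

  module _ (D : Digraph) (ch : ConnectedHomogeneous D) where
    open Digraph D
    open Graph (underlying D) using (_~_)

    -- Exchanging `v` for `v′` and fixing `F` is an isomorphism between two connected finite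
    -- subdigraphs, to which homogeneity applies.
    digraph-move : ∀ {F v v′} → v ∉ F → v′ ∉ F → Built (underlying D) (v ∷ F) →
      (∀ {u} → u ∈ F → (v ⟶ u ⇔ v′ ⟶ u) × (u ⟶ v ⇔ u ⟶ v′)) →
      Σ (D ≅ᵈ D) λ α → RelIso.to α v ≡ v′ × (∀ {u} → u ∈ F → RelIso.to α u ≡ u)
    digraph-move {F} {v} {v′} v∉F v′∉F built same =
      proj₁ ext , trans (proj₂ ext (v , λ k → k (here refl))) (replace-self v v′) ,
      λ m → trans (proj₂ ext (_ , λ k → k (there m))) (replace-other v′ (λ { refl → v∉F m }))
      where
      replace : V → V → V → V
      replace a b u with em {u ≡ a}
      ... | yes _ = b
      ... | no _  = u

      replace-self : ∀ a b → replace a b a ≡ b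
      replace-self a b with em {a ≡ a}
      ... | yes _   = refl
      ... | no a≢a = contradiction refl a≢a

      replace-other : ∀ {a u} b → u ≢ a → replace a b u ≡ u
      replace-other {a} {u} b u≢a with em {u ≡ a}
      ... | yes u≡a = contradiction u≡a u≢a
      ... | no _    = refl

      P Q : Subset V
      P = listSubset (v ∷ F)
      Q = listSubset (v′ ∷ F)

      replaceIn : ∀ a b → a ∉ F → Subset.Elements (listSubset (a ∷ F)) → Subset.Elements (listSubset (b ∷ F))
      replaceIn a b a∉F (u , m) = replace a b u , λ k → m λ where
        (here refl) → k (here (replace-self a b))
        (there u∈F) → k (subst (_∈ b ∷ F) (sym (replace-other b λ { refl → a∉F u∈F })) (there u∈F))

      replace-back : ∀ a b → a ∉ F → b ∉ F → ∀ {u} → u ∈ a ∷ F → replace b a (replace a b u) ≡ u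
      replace-back a b a∉F b∉F (here refl) = trans (cong (replace b a) (replace-self a b)) (replace-self b a)
      replace-back a b a∉F b∉F (there u∈F) =
        trans (cong (replace b a) (replace-other b λ { refl → a∉F u∈F })) (replace-other a λ { refl → b∉F u∈F })

      arrows : ∀ {u w} → u ∈ v ∷ F → w ∈ v ∷ F → u ⟶ w ⇔ replace v v′ u ⟶ replace v v′ w
      arrows (here refl) (here refl) = mk⇔ (λ e → contradiction e (⟶-asym e)) (λ e → contradiction e (⟶-asym e))
      arrows {w = w} (here refl) (there m) =
        subst₂ (λ a b → v ⟶ w ⇔ a ⟶ b) (sym (replace-self v v′)) (sym (replace-other v′ λ { refl → v∉F m })) (proj₁ (same m))
      arrows {u} (there m) (here refl) =
        subst₂ (λ a b → u ⟶ v ⇔ a ⟶ b) (sym (replace-other v′ λ { refl → v∉F m })) (sym (replace-self v v′)) (proj₂ (same m))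
      arrows {u} {w} (there m) (there m′) =
        subst₂ (λ a b → u ⟶ w ⇔ a ⟶ b) (sym (replace-other v′ λ { refl → v∉F m })) (sym (replace-other v′ λ { refl → v∉F m′ })) (mk⇔ id id)

      σ : Induced D P ≅ᵈ Induced D Q
      σ = record
        { bijection = mk↔ₛ′ (replaceIn v v′ v∉F) (replaceIn v′ v v′∉F)
            (λ q → Elements-≡ Q (replace-back v′ v v′∉F v∉F (double-negation (proj₂ q))))
            (λ p → Elements-≡ P (replace-back v v′ v∉F v′∉F (double-negation (proj₂ p))))
        ; preserves = λ {p} {q} → arrows (double-negation (proj₂ p)) (double-negation (proj₂ q))
        }

      connected : ∀ {a} → Built (underlying D) (a ∷ F) → Connected (underlying (Induced D (listSubset (a ∷ F))))
      connected {a} built = (a , λ k → k (here refl)) , λ p q →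
        to-head p ◅◅ Star.reverse swap (to-head q)
        where
        to-head : (p : Subset.Elements (listSubset (a ∷ F))) →
          Star (λ (p q : Subset.Elements (listSubset (a ∷ F))) → proj₁ p ~ proj₁ q) p (a , λ k → k (here refl))
        to-head (u , m) = Built-connected (underlying D) (listSubset (a ∷ F)) built (λ m k → k m) (double-negation m)

      built′ : Built (underlying D) (v′ ∷ F)
      built′ = Built-replace (underlying D)
        (λ m → λ { (inj₁ e) → inj₁ (Equivalence.to (proj₁ (same m)) e) ; (inj₂ e) → inj₂ (Equivalence.to (proj₂ (same m)) e) }) built

      ext : Σ (D ≅ᵈ D) λ α → ∀ p → RelIso.to α (proj₁ p) ≡ proj₁ (RelIso.to σ p)
      ext = ch P Q (listSubset-finite (v ∷ F)) (listSubset-finite (v′ ∷ F)) (connected built) (connected built′) σ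

  module _ (Δ : BipartiteGraph) (T : Digraph)
    (φ : ∀ t → Digraph.In T t ↔ BipartiteGraph.X Δ)
    (ψ : ∀ t → Digraph.Out T t ↔ BipartiteGraph.Y Δ)
    (t₀ : Digraph.V T) (Δ-connected : Connected (graph Δ)) where

    open ArcLabels Δ T φ ψ

    -- As Δ is connected, one vertex that stays in the copy on its own side keeps the whole copy
    -- there; the same holds for the inverse.
    restrict : (α : DL Δ T φ ψ ≅ᵈ DL Δ T φ ψ) → ∀ {v v′} → side v ≡ side v′ → RelIso.to α (arcAt t₀ v) ≡ arcAt t₀ v′ →
      Σ (graph Δ ≅ graph Δ) λ g → ∀ u → arcAt t₀ (RelIso.to g u) ≡ RelIso.to α (arcAt t₀ u)
    restrict α {v} {v′} sv≡sv′ αv≡v′ = record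
      { bijection = mk↔ₛ′ to from
          (λ u → arcAt-injective t₀ (trans (to-arc _) (trans (cong (RelIso.to α) (from-arc u)) (to∘from α _))))
          (λ u → arcAt-injective t₀ (trans (from-arc _) (trans (cong (RelIso.from α) (to-arc u)) (from∘to α _))))
      ; preserves = λ {u} {w} → mk⇔
          (λ e → [ arrow u w , (λ h → ~ᐞ-sym {to w} {to u} (arrow w u h)) ]′ (~⇒⇀ {u} {w} e))
          (λ e → [ arrow⁻¹ u w , (λ h → ~ᐞ-sym {w} {u} (arrow⁻¹ w u h)) ]′ (~⇒⇀ {to u} {to w} e))
      } , to-arc
      where
      everything : Subset Vertex
      everything = record { member = λ _ → ⊤ ; member-irrelevant = λ _ _ → refl }

      module _ (α : DL Δ T φ ψ ≅ᵈ DL Δ T φ ψ) {v v′} (sv≡sv′ : side v ≡ side v′) (αv≡v′ : RelIso.to α (arcAt t₀ v) ≡ arcAt t₀ v′) where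
        open Propagation everything (RelIso.to α ∘ proj₁) (λ {p} {q} → preserve α {proj₁ p} {proj₁ q})

        lands : ∀ u → ∃[ u′ ] (side u′ ≡ side u × RelIso.to α (arcAt t₀ u) ≡ arcAt t₀ u′)
        lands u = propagate {l = v , tt} (gmap (_, tt) id (proj₂ Δ-connected v u)) (v′ , sym sv≡sv′ , αv≡v′)

      forth = lands α sv≡sv′ αv≡v′
      back  = lands (RelIso-sym α) (sym sv≡sv′) (trans (cong (RelIso.from α) (sym αv≡v′)) (from∘to α _))

      to from : Label → Label
      to   = proj₁ ∘ forth
      from = proj₁ ∘ back

      to-arc : ∀ u → arcAt t₀ (to u) ≡ RelIso.to α (arcAt t₀ u)
      to-arc u = sym (proj₂ (proj₂ (forth u)))

      from-arc : ∀ u → arcAt t₀ (from u) ≡ RelIso.from α (arcAt t₀ u)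
      from-arc u = sym (proj₂ (proj₂ (back u)))

      arrow : ∀ u w → u ⇀ w → to u ~ᐞ to w
      arrow u w h = proj₁ (⟶⇒⇀ t₀ (subst₂ _⟶ᴰ_ (sym (to-arc u)) (sym (to-arc w)) (preserve α (⇀⇒⟶ t₀ h))))

      arrow⁻¹ : ∀ u w → to u ⇀ to w → u ~ᐞ w
      arrow⁻¹ u w h = proj₁ (⟶⇒⇀ t₀ (reflect α (subst₂ _⟶ᴰ_ (to-arc u) (to-arc w) (⇀⇒⟶ t₀ h))))

    -- Equality of the sides turns equal adjacency to `F` in Δ into equal incoming and outgoing arcs
    -- in DL(Δ).
    local-move : ConnectedHomogeneous (DL Δ T φ ψ) → ∀ {F v v′} → side v ≡ side v′ → v ∉ F → v′ ∉ F → Built (graph Δ) (v ∷ F) →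
      (∀ {u} → u ∈ F → v ~ᐞ u ⇔ v′ ~ᐞ u) →
      Σ (graph Δ ≅ graph Δ) λ g → RelIso.to g v ≡ v′ × (∀ {u} → u ∈ F → RelIso.to g u ≡ u)
    local-move ch {F} {v} {v′} sv≡sv′ v∉F v′∉F built same = proj₁ g ,
      arcAt-injective t₀ (trans (proj₂ g v) (proj₁ (proj₂ α))) ,
      λ m → arcAt-injective t₀ (trans (proj₂ g _) (proj₂ (proj₂ α) (∈-map⁺ (arcAt t₀) m)))
      where
      ∉-map : ∀ {u} → u ∉ F → arcAt t₀ u ∉ map (arcAt t₀) F
      ∉-map u∉F m with ∈-map⁻ (arcAt t₀) m
      ... | w , w∈F , eq = u∉F (subst (_∈ F) (sym (arcAt-injective t₀ eq)) w∈F)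

      Built-map : ∀ l → Built (graph Δ) l → Built (underlying (DL Δ T φ ψ)) (map (arcAt t₀) l)
      Built-map []      _                      = tt
      Built-map (u ∷ l) (inj₁ refl , built)    = inj₁ refl , tt
      Built-map (u ∷ l) (inj₂ nb , built) with find nb
      ... | z , z∈l , u~z = inj₂ (lose (∈-map⁺ (arcAt t₀) z∈l)
        ([ inj₁ ∘ ⇀⇒⟶ t₀ , inj₂ ∘ ⇀⇒⟶ t₀ ]′ (~⇒⇀ {u} {z} u~z))) , Built-map l built

      arrows : ∀ {e} → e ∈ map (arcAt t₀) F → (arcAt t₀ v ⟶ᴰ e ⇔ arcAt t₀ v′ ⟶ᴰ e) × (e ⟶ᴰ arcAt t₀ v ⇔ e ⟶ᴰ arcAt t₀ v′)
      arrows m with ∈-map⁻ (arcAt t₀) m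
      ... | u , u∈F , refl =
        mk⇔ (λ d → let e , s = ⟶⇒⇀ t₀ {v} {u} d in ⇀⇒⟶ t₀ {v′} {u} (Equivalence.to (same u∈F) e , trans (sym sv≡sv′) s))
            (λ d → let e , s = ⟶⇒⇀ t₀ {v′} {u} d in ⇀⇒⟶ t₀ {v} {u} (Equivalence.from (same u∈F) e , trans sv≡sv′ s)) ,
        mk⇔ (λ d → let e , s = ⟶⇒⇀ t₀ {u} {v} d in
                   ⇀⇒⟶ t₀ {u} {v′} (~ᐞ-sym {v′} {u} (Equivalence.to (same u∈F) (~ᐞ-sym {u} {v} e)) , s))
            (λ d → let e , s = ⟶⇒⇀ t₀ {u} {v′} d in
                   ⇀⇒⟶ t₀ {u} {v} (~ᐞ-sym {v} {u} (Equivalence.from (same u∈F) (~ᐞ-sym {u} {v′} e)) , s))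

      α = digraph-move (DL Δ T φ ψ) ch (∉-map v∉F) (∉-map v′∉F) (Built-map (v ∷ F) built) arrows
      g = restrict (proj₁ α) sv≡sv′ (proj₁ (proj₂ α))

-- Consequences of the moves

neither : ∀ {A B : Set} → ¬ A → ¬ B → A ⇔ B
neither ¬a ¬b = mk⇔ (λ a → contradiction a ¬a) (λ b → contradiction b ¬b)

both : ∀ {A B : Set} → A → B → A ⇔ B
both a b = mk⇔ (λ _ → b) (λ _ → a)

module _ (Γ : Graph) where
  open Graph Γ

  Movable : (V → Bool) → Set
  Movable side = ∀ {F v v′} → side v ≡ side v′ → v ∉ F → v′ ∉ F → Built Γ (v ∷ F) →
    (∀ {u} → u ∈ F → v ~ u ⇔ v′ ~ u) →
    Σ (Γ ≅ Γ) λ g → RelIso.to g v ≡ v′ × (∀ {u} → u ∈ F → RelIso.to g u ≡ u)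

  record MovableGraph : Set where
    field
      side          : V → Bool
      proper        : Proper Γ side
      connect       : ∀ u v → Star _~_ u v
      locallyFinite : LocallyFinite Γ
      neighbour     : ∀ v → ∃[ u ] v ~ u
      move          : Movable side

module Moves (em : ExcludedMiddle 0ℓ) (Γ : Graph) (M : MovableGraph Γ) where
  open Graph Γ public
  open MovableGraph M public

  co-neighbours : ∀ {u v w} → w ~ u → w ~ v → side u ≡ side v
  co-neighbours e e′ = ≢-≢⇒≡ (proper (~-sym e)) (proper e′)

  same-side-nonadjacent : ∀ {u v} → side u ≡ side v → ¬ u ~ v
  same-side-nonadjacent eq e = proper e eq

  ~-≢ : ∀ {u v w} → u ~ w → ¬ v ~ w → u ≢ v
  ~-≢ e ¬e refl = ¬e e

  module _ (g : Γ ≅ Γ) where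
    private
      module g = RelIso g

    image-adjacent : ∀ {u v u′ v′} → g.to u ≡ u′ → g.to v ≡ v′ → u ~ v → u′ ~ v′
    image-adjacent refl refl = preserve g

    preimage-adjacent : ∀ {u v u′ v′} → g.to u ≡ u′ → g.to v ≡ v′ → u′ ~ v′ → u ~ v
    preimage-adjacent refl refl = reflect g

    image-≢ : ∀ {u v u′ v′} → g.to u ≡ u′ → g.to v ≡ v′ → u ≢ v → u′ ≢ v′
    image-≢ refl refl u≢v eq = u≢v (to-injective g eq)

    preimage-≡ : ∀ {u v v′} → g.to u ≡ v′ → g.to v ≡ v′ → u ≡ v
    preimage-≡ eq eq′ = to-injective g (trans eq (sym eq′))

  abstract
    transitive : ∀ {u v} → side u ≡ side v → Σ (Γ ≅ Γ) λ g → RelIso.to g u ≡ v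
    transitive eq = let g , gu≡v , _ = move {[]} eq (λ ()) (λ ()) (inj₁ refl , tt) (λ ()) in g , gu≡v

    -- Here `F` and `x` span a star. Its leaves share the side of `a` and `b`, so each of these sees
    -- only the centre.
    star-move : ∀ {x a b} (F : List V) → (∀ {u} → u ∈ F → x ~ u) → x ~ a → x ~ b → a ∉ F → b ∉ F →
      Σ (Γ ≅ Γ) λ g → RelIso.to g x ≡ x × RelIso.to g a ≡ b × (∀ {u} → u ∈ F → RelIso.to g u ≡ u)
    star-move {x} {a} {b} F x~F x~a x~b a∉F b∉F =
      let g , ga≡b , fix = move {F ++ x ∷ []} (co-neighbours x~a x~b) (∉-star x~a a∉F) (∉-star x~b b∉F)
                             (inj₂ (lose (∈-++⁺ʳ F (here refl)) (~-sym x~a)) , built F x~F) same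
      in g , fix (∈-++⁺ʳ F (here refl)) , ga≡b , fix ∘ ∈-++⁺ˡ
      where
      ∉-star : ∀ {c} → x ~ c → c ∉ F → c ∉ F ++ x ∷ []
      ∉-star x~c c∉F m with ∈-++⁻ F m
      ... | inj₁ c∈F         = c∉F c∈F
      ... | inj₂ (here refl) = ~-irrefl refl x~c

      built : ∀ F → (∀ {u} → u ∈ F → x ~ u) → Built Γ (F ++ x ∷ [])
      built []      _    = inj₁ refl , tt
      built (u ∷ F) x~F = inj₂ (lose (∈-++⁺ʳ F (here refl)) (~-sym (x~F (here refl)))) , built F (x~F ∘ there)

      same : ∀ {u} → u ∈ F ++ x ∷ [] → a ~ u ⇔ b ~ u
      same m with ∈-++⁻ F m
      ... | inj₁ u∈F         = neither (same-side-nonadjacent (co-neighbours x~a (x~F u∈F)))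
                                       (same-side-nonadjacent (co-neighbours x~b (x~F u∈F)))
      ... | inj₂ (here refl) = both (~-sym x~a) (~-sym x~b)

    -- Three moves in succession place the first, second and third vertex, each fixing those already
    -- placed.
    two-arc-transitive : ∀ {x y x′ u v u′} → side x ≡ side u → x ≢ x′ → x ~ y → x′ ~ y → u ≢ u′ → u ~ v → u′ ~ v →
      Σ (Γ ≅ Γ) λ g → RelIso.to g x ≡ u × RelIso.to g y ≡ v × RelIso.to g x′ ≡ u′
    two-arc-transitive {x} {y} {x′} {u} {v} {u′} sx≡su x≢x′ x~y x′~y u≢u′ u~v u′~v =
      let f , fx≡u = transitive sx≡su
          g , gu≡u , gfy≡v , _ = star-move {u} {RelIso.to f y} {v} [] (λ ()) (image-adjacent f fx≡u refl x~y) u~v (λ ()) (λ ())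
          gfx≡u = trans (cong (RelIso.to g) fx≡u) gu≡u
          h , hv≡v , hgfx′≡u′ , fix = star-move {v} {RelIso.to g (RelIso.to f x′)} {u′} (u ∷ [])
            (λ { (here refl) → ~-sym u~v })
            (image-adjacent g gfy≡v refl (image-adjacent f refl refl (~-sym x′~y))) (~-sym u′~v)
            (λ { (here eq) → image-≢ (RelIso-trans f g) gfx≡u refl x≢x′ (sym eq) })
            (λ { (here eq) → u≢u′ (sym eq) })
      in RelIso-trans f (RelIso-trans g h) , trans (cong (RelIso.to h) gfx≡u) (fix (here refl))
         , trans (cong (RelIso.to h) gfy≡v) hv≡v , hgfx′≡u′

  record ThreeNeighbours (x : V) : Set where
    constructor three
    field
      {a b c} : V
      x~a : x ~ a
      x~b : x ~ b
      x~c : x ~ c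
      a≢b : a ≢ b
      a≢c : a ≢ c
      b≢c : b ≢ c

  abstract
    three-neighbours-transport : ∀ {x x′} → side x ≡ side x′ → ThreeNeighbours x → ThreeNeighbours x′
    three-neighbours-transport eq (three x~a x~b x~c a≢b a≢c b≢c) =
      let g , gx≡x′ = transitive eq in
      three (image-adjacent g gx≡x′ refl x~a) (image-adjacent g gx≡x′ refl x~b) (image-adjacent g gx≡x′ refl x~c)
        (image-≢ g refl refl a≢b) (image-≢ g refl refl a≢c) (image-≢ g refl refl b≢c)

    pick : ∀ {x} → ThreeNeighbours x → ∀ u v → ∃[ w ] (x ~ w × w ≢ u × w ≢ v)
    pick (three {a} {b} {c} x~a x~b x~c a≢b a≢c b≢c) u v with em {a ≡ u} | em {a ≡ v}
    ... | no a≢u  | no a≢v = a , x~a , a≢u , a≢v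
    ... | yes refl | _ with em {b ≡ v}
    ...   | no b≢v  = b , x~b , a≢b ∘ sym , b≢v
    ...   | yes refl = c , x~c , a≢c ∘ sym , b≢c ∘ sym
    pick (three {a} {b} {c} x~a x~b x~c a≢b a≢c b≢c) u v | no _ | yes refl with em {b ≡ u}
    ...   | no b≢u  = b , x~b , b≢u , a≢b ∘ sym
    ...   | yes refl = c , x~c , b≢c ∘ sym , a≢c ∘ sym

  abstract
    -- A move fixes a finite list, so local finiteness is what allows it to fix all common
    -- neighbours of two vertices but one.
    neighbours : ∀ x → Σ (List V) λ l → ∀ {u} → (x ~ u → u ∈ l) × (u ∈ l → x ~ u)
    neighbours x with locallyFinite x
    ... | n , f = map proj₁ (tabulate (Inverse.from f)) , to , from
      where
      to : ∀ {u} → x ~ u → u ∈ map proj₁ (tabulate (Inverse.from f))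
      to e = ∈-map⁺ proj₁ (subst (_∈ tabulate (Inverse.from f)) (Inverse.strictlyInverseʳ f (_ , e)) (∈-tabulate⁺ (Inverse.to f (_ , e))))

      from : ∀ {u} → u ∈ map proj₁ (tabulate (Inverse.from f)) → x ~ u
      from m with ∈-map⁻ proj₁ m
      ... | (_ , e) , _ , refl = e

  Complete : Set
  Complete = ∀ u v → side u ≢ side v → u ~ v

  CoMatching : Set
  CoMatching = ∀ v → ∃[ z ] (side v ≢ side z × ¬ v ~ z × (∀ w → side v ≢ side w → ¬ v ~ w → w ≡ z))

  SquareFree : Set
  SquareFree = ∀ {u v a b} → u ≢ v → u ~ a → v ~ a → u ~ b → v ~ b → a ≡ b

  star-induction : ∀ (Q : V → Set) → (∀ {v w} → Q v → v ~ w → Q w) → ∀ {u v} → Star _~_ u v → Q u → Q v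
  star-induction Q step ε       q = q
  star-induction Q step (e ◅ w) q = star-induction Q step w (step q e)

-- Graphs with a 4-cycle

module FourCycle (em : ExcludedMiddle 0ℓ) (Γ : Graph) (M : MovableGraph Γ) where
  open Moves em Γ M

  module _ {x₀ x₁ y₀ y₁ : V} (x₀≢x₁ : x₀ ≢ x₁) (y₀≢y₁ : y₀ ≢ y₁)
    (x₀~y₀ : x₀ ~ y₀) (x₁~y₀ : x₁ ~ y₀) (x₀~y₁ : x₀ ~ y₁) (x₁~y₁ : x₁ ~ y₁) where

    private
      s : Bool
      s = side x₀

    -- By two-arc-transitivity one inclusion of neighbourhoods at distance two gives it for all such
    -- pairs on this side, and connectedness spreads it.
    same-neighbourhoods⇒complete : ∀ {x x′ y} → side x ≡ s → x ≢ x′ → x ~ y → x′ ~ y →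
      (∀ {u} → x ~ u → x′ ~ u) → Complete
    same-neighbourhoods⇒complete {x} {x′} {y} sx x≢x′ x~y x′~y N⊆ u v su≢sv = case em {side u ≡ s} of
      λ { (yes su)  → complete su su≢sv
        ; (no su≢s) → ~-sym (complete (≢-≢⇒≡ (su≢sv ∘ sym) su≢s) (su≢sv ∘ sym)) }
      where
      all-same : ∀ {u u′ v} → side u ≡ s → u ≢ u′ → u ~ v → u′ ~ v → ∀ {w} → u ~ w → u′ ~ w
      all-same su u≢u′ u~v u′~v u~w with two-arc-transitive (trans sx (sym su)) x≢x′ x~y x′~y u≢u′ u~v u′~v
      ... | g , gx≡u , _ , gx′≡u′ = image-adjacent g gx′≡u′ (to∘from g _)
        (N⊆ (preimage-adjacent g gx≡u (to∘from g _) u~w))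

      complete : ∀ {u v} → side u ≡ s → side u ≢ side v → u ~ v
      complete {u} {v} su su≢sv with star-induction Q step (connect u v) (inj₁ (refl , id))
        where
        -- The invariant along a walk from `u`: a vertex on the side of `u` has all of N(u) as
        -- neighbours, and any other is adjacent to `u`.
        Q : V → Set
        Q v = (side v ≡ side u × (∀ {w} → u ~ w → v ~ w)) ⊎ u ~ v

        step : ∀ {v w} → Q v → v ~ w → Q w
        step {v} (inj₁ (sv≡su , N⊆)) v~w with em {v ≡ u}
        ... | yes refl = inj₂ v~w
        ... | no v≢u   = inj₂ (all-same (trans sv≡su su) v≢u (N⊆ (proj₂ (neighbour u))) (proj₂ (neighbour u)) v~w)
        step {v} {w} (inj₂ u~v) v~w with em {w ≡ u}
        ... | yes refl = inj₁ (refl , id)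
        ... | no w≢u   = inj₁ (co-neighbours v~w (~-sym u~v) , all-same su (w≢u ∘ sym) u~v (~-sym v~w))
      ... | inj₁ (sv≡su , _) = contradiction (sym sv≡su) su≢sv
      ... | inj₂ u~v         = u~v

    abstract
      another-common : ∀ {x x′ y} → side x ≡ s → x ≢ x′ → x ~ y → x′ ~ y → ∃[ y′ ] (y ≢ y′ × x ~ y′ × x′ ~ y′)
      another-common sx x≢x′ x~y x′~y with two-arc-transitive (sym sx) x₀≢x₁ x₀~y₀ x₁~y₀ x≢x′ x~y x′~y
      ... | g , gx₀ , gy₀ , gx₁ = _ , image-≢ g gy₀ refl y₀≢y₁ , image-adjacent g gx₀ refl x₀~y₁ , image-adjacent g gx₁ refl x₁~y₁

    module _ (not-contained : ∀ {x x′ y} → side x ≡ s → x ≢ x′ → x ~ y → x′ ~ y → ∃[ b ] (x ~ b × ¬ x′ ~ b)) where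

      -- Otherwise fixing x, x′ and y allows x″ to be moved to any other neighbour of y. One of
      -- these, `k x′`, is adjacent to a neighbour b of x outside N(x′), and the inclusion carried
      -- over to it puts b into N(x′).
      no-twins : ∀ {x x′ x″ y} → side x ≡ s → x ≢ x′ → x ≢ x″ → x ~ y → x′ ~ y → x″ ~ y →
        (∀ {u} → x ~ u → x″ ~ u → x′ ~ u) → x′ ≡ x″
      no-twins {x} {x′} {x″} {y} sx x≢x′ x≢x″ x~y x′~y x″~y ⊆ with em {x′ ≡ x″}
      ... | yes eq = eq
      ... | no x′≢x″ with not-contained sx x≢x′ x~y x′~y | another-common sx x≢x′ x~y x′~y
      ...   | b , x~b , x′≁b | y′ , y≢y′ , x~y′ , x′~y′
        with star-move {x} {y′} {b} (y ∷ []) (λ { (here refl) → x~y }) x~y′ x~b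
               (λ { (here eq) → y≢y′ (sym eq) }) (λ { (here refl) → x′≁b x′~y })
      ...     | k , kx , ky′ , fix
        with star-move {y} {x″} {RelIso.to k x′} (x ∷ x′ ∷ []) (λ { (here refl) → ~-sym x~y ; (there (here refl)) → ~-sym x′~y })
               (~-sym x″~y) (image-adjacent k (fix (here refl)) refl (~-sym x′~y))
               (λ { (here eq) → x≢x″ (sym eq) ; (there (here eq)) → x′≢x″ (sym eq) })
               (λ { (here eq) → image-≢ k kx refl x≢x′ (sym eq)
                  ; (there (here eq)) → x′≁b (subst (_~ b) eq (image-adjacent k refl ky′ x′~y′)) })
      ...       | h , _ , hx″ , fix′ = contradiction
        (image-adjacent h (fix′ (there (here refl))) (to∘from h b)
          (⊆ (preimage-adjacent h (fix′ (here refl)) (to∘from h b) x~b)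
             (preimage-adjacent h hx″ (to∘from h b) (image-adjacent k refl ky′ x′~y′))))
        x′≁b

      -- The move `k` fixes x and the common neighbours of x and x′ other than a, and takes a to b;
      -- x″ is the image of x′.
      exchange : ∀ {x x′ a b} → x ≢ x′ → x ~ a → x′ ~ a → x ~ b → ¬ x′ ~ b →
        ∃[ x″ ] (x ≢ x″ × (∀ {u} → x ~ u → x″ ~ u ⇔ ((x′ ~ u × u ≢ a) ⊎ u ≡ b)))
      exchange {x} {x′} {a} {b} x≢x′ x~a x′~a x~b x′≁b =
        RelIso.to k x′ , image-≢ k kx refl x≢x′ , λ x~u → mk⇔ (forth x~u) (back x~u)
        where
        Kept : V → Set
        Kept u = x′ ~ u × u ≢ a

        kept : List V
        kept = filter (λ u → em {Kept u}) (proj₁ (neighbours x))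

        kept⁺ : ∀ {u} → x ~ u → Kept u → u ∈ kept
        kept⁺ x~u q = ∈-filter⁺ (λ u → em {Kept u}) (proj₁ (proj₂ (neighbours x)) x~u) q

        kept⁻ : ∀ {u} → u ∈ kept → x ~ u × Kept u
        kept⁻ m = let m′ , q = ∈-filter⁻ (λ u → em {Kept u}) {xs = proj₁ (neighbours x)} m in proj₂ (proj₂ (neighbours x)) m′ , q

        moved = star-move {x} {a} {b} kept (proj₁ ∘ kept⁻) x~a x~b
          (λ m → proj₂ (proj₂ (kept⁻ m)) refl) (λ m → x′≁b (proj₁ (proj₂ (kept⁻ m))))
        k   = proj₁ moved
        kx  = proj₁ (proj₂ moved)
        ka  = proj₁ (proj₂ (proj₂ moved))
        fix = proj₂ (proj₂ (proj₂ moved))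

        back : ∀ {u} → x ~ u → Kept u ⊎ u ≡ b → RelIso.to k x′ ~ u
        back x~u (inj₁ q)    = image-adjacent k refl (fix (kept⁺ x~u q)) (proj₁ q)
        back x~u (inj₂ refl) = image-adjacent k refl ka x′~a

        forth : ∀ {u} → x ~ u → RelIso.to k x′ ~ u → Kept u ⊎ u ≡ b
        forth {u} x~u e with em {RelIso.from k u ≡ a}
        ... | yes eq = inj₂ (trans (sym (to∘from k u)) (trans (cong (RelIso.to k) eq) ka))
        ... | no neq = inj₁ (subst Kept (trans (sym (fix (kept⁺ x~u₀ q))) (to∘from k u)) q)
          where
          x~u₀ = preimage-adjacent k kx (to∘from k u) x~u
          q = preimage-adjacent k refl (to∘from k u) e , neq

      -- Exchanging a for b gives x₁; exchanging a′ for b′ as well gives x₂. All are adjacent to y,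
      -- so a move fixing x, x′ and y takes x₁ to x₂. But of the common neighbours of x and x′,
      -- N(x₁) misses only a, while N(x₂) misses both a and a′.
      not-three-two : ∀ {x x′ y a a′ b b′} → x ≢ x′ → x ~ y → x′ ~ y → x ~ a → x′ ~ a → x ~ a′ → x′ ~ a′ →
        y ≢ a → y ≢ a′ → a ≢ a′ → x ~ b → ¬ x′ ~ b → x ~ b′ → ¬ x′ ~ b′ → b ≢ b′ → ⊥
      not-three-two {x} {x′} {y} {a} {a′} {b} {b′} x≢x′ x~y x′~y x~a x′~a x~a′ x′~a′ y≢a y≢a′ a≢a′ x~b x′≁b x~b′ x′≁b′ b≢b′
        with exchange x≢x′ x~a x′~a x~b x′≁b
      ... | x₁ , x≢x₁ , N₁
        with exchange x≢x₁ x~a′ (Equivalence.from (N₁ x~a′) (inj₁ (x′~a′ , a≢a′ ∘ sym)))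
               x~b′ ((λ { (inj₁ (e , _)) → x′≁b′ e ; (inj₂ eq) → b≢b′ (sym eq) }) ∘ Equivalence.to (N₁ x~b′))
      ... | x₂ , x≢x₂ , N₂
        with star-move {y} {x₁} {x₂} (x ∷ x′ ∷ [])
               (λ { (here refl) → ~-sym x~y ; (there (here refl)) → ~-sym x′~y })
               (~-sym x₁~y) (~-sym (Equivalence.from (N₂ x~y) (inj₁ (x₁~y , y≢a′))))
               (λ { (here eq) → x≢x₁ (sym eq)
                  ; (there (here eq)) → x′≁b (subst (_~ b) eq (Equivalence.from (N₁ x~b) (inj₂ refl))) })
               (λ { (here eq) → x≢x₂ (sym eq)
                  ; (there (here eq)) → x′≁b′ (subst (_~ b′) eq (Equivalence.from (N₂ x~b′) (inj₂ refl))) })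
        where
        x₁~y = Equivalence.from (N₁ x~y) (inj₁ (x′~y , y≢a))
      ... | h , _ , hx₁ , fix = a≢a′ (trans (sym (to∘from h a)) (trans (cong (RelIso.to h) (trans (pulled x~a x′~a x₂≁a) (sym (pulled x~a′ x′~a′ x₂≁a′)))) (to∘from h a′)))
        where
        x₂≁a : ¬ x₂ ~ a
        x₂≁a e with Equivalence.to (N₂ x~a) e
        ... | inj₂ refl = x′≁b′ x′~a
        ... | inj₁ (e₁ , _) with Equivalence.to (N₁ x~a) e₁
        ...   | inj₁ (_ , a≢a) = a≢a refl
        ...   | inj₂ refl      = x′≁b x′~a

        x₂≁a′ : ¬ x₂ ~ a′
        x₂≁a′ e with Equivalence.to (N₂ x~a′) e
        ... | inj₁ (_ , a′≢a′) = a′≢a′ refl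
        ... | inj₂ refl        = x′≁b′ x′~a′

        -- h⁻¹ takes (N(x) ∩ N(x′)) ∖ N(x₂) to (N(x) ∩ N(x′)) ∖ N(x₁) = {a}.
        pulled : ∀ {u} → x ~ u → x′ ~ u → ¬ x₂ ~ u → RelIso.from h u ≡ a
        pulled {u} x~u x′~u x₂≁u with em {RelIso.from h u ≡ a}
        ... | yes eq = eq
        ... | no neq = contradiction (image-adjacent h hx₁ (to∘from h u) (Equivalence.from (N₁ x~u₀)
            (inj₁ (preimage-adjacent h (fix (there (here refl))) (to∘from h u) x′~u , neq)))) x₂≁u
          where
          x~u₀ = preimage-adjacent h (fix (here refl)) (to∘from h u) x~u

      -- Two exchanges would leave no common neighbour here. Instead x, x′, x″ are chosen so that
      -- any two of them share a₁ and just one further vertex: a₂ for x and x′, b for x and x″, b′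
      -- for x′ and x″.
      not-two-two : ∀ {x x′ a₁ a₂ b b₃} → side x ≡ s → x ≢ x′ → x ~ a₁ → x′ ~ a₁ → x ~ a₂ → x′ ~ a₂ → a₁ ≢ a₂ →
        (∀ {u} → x ~ u → x′ ~ u → u ≡ a₁ ⊎ u ≡ a₂) → x ~ b → ¬ x′ ~ b → x ~ b₃ → ¬ x′ ~ b₃ → b ≢ b₃ → ⊥
      not-two-two {x} {x′} {a₁} {a₂} {b} {b₃} sx x≢x′ x~a₁ x′~a₁ x~a₂ x′~a₂ a₁≢a₂ only x~b x′≁b x~b₃ x′≁b₃ b≢b₃
        with exchange x≢x′ x~a₂ x′~a₂ x~b x′≁b
      ... | x″ , x≢x″ , N″ = finish
        where
        x″~a₁ : x″ ~ a₁
        x″~a₁ = Equivalence.from (N″ x~a₁) (inj₁ (x′~a₁ , a₁≢a₂))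

        x″~b : x″ ~ b
        x″~b = Equivalence.from (N″ x~b) (inj₂ refl)

        x″-only : ∀ {u} → x ~ u → x″ ~ u → u ≡ a₁ ⊎ u ≡ b
        x″-only x~u e with Equivalence.to (N″ x~u) e
        ... | inj₂ eq = inj₂ eq
        ... | inj₁ (x′~u , u≢a₂) with only x~u x′~u
        ...   | inj₁ eq = inj₁ eq
        ...   | inj₂ eq = contradiction eq u≢a₂

        x″≢x′ : x″ ≢ x′
        x″≢x′ = ~-≢ x″~b x′≁b

        -- Taking x to x″ while fixing x′ and a₁ carries the common neighbours of x and x′ to those
        -- of x″ and x′.
        rotated = star-move {a₁} {x} {x″} (x′ ∷ []) (λ { (here refl) → ~-sym x′~a₁ }) (~-sym x~a₁) (~-sym x″~a₁)
          (λ { (here eq) → x≢x′ eq }) (λ { (here eq) → x″≢x′ eq })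
        h   = proj₁ rotated
        ha₁ = proj₁ (proj₂ rotated)
        hx  = proj₁ (proj₂ (proj₂ rotated))
        hx′ = proj₂ (proj₂ (proj₂ rotated)) (here refl)

        b′ : V
        b′ = RelIso.to h a₂

        x′~b′ : x′ ~ b′
        x′~b′ = image-adjacent h hx′ refl x′~a₂

        x″~b′ : x″ ~ b′
        x″~b′ = image-adjacent h hx refl x~a₂

        x′x″-only : ∀ {u} → x′ ~ u → x″ ~ u → u ≡ a₁ ⊎ u ≡ b′
        x′x″-only {u} x′~u x″~u with only (preimage-adjacent h hx (to∘from h u) x″~u) (preimage-adjacent h hx′ (to∘from h u) x′~u)
        ... | inj₁ eq = inj₁ (trans (sym (to∘from h u)) (trans (cong (RelIso.to h) eq) ha₁))
        ... | inj₂ eq = inj₂ (trans (sym (to∘from h u)) (cong (RelIso.to h) eq))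

        x≁b′ : ¬ x ~ b′
        x≁b′ e with only e x′~b′
        ... | inj₁ eq = image-≢ h ha₁ refl a₁≢a₂ (sym eq)
        ... | inj₂ eq with x″-only x~a₂ (subst (x″ ~_) eq x″~b′)
        ...   | inj₁ eq′ = a₁≢a₂ (sym eq′)
        ...   | inj₂ refl = x′≁b x′~a₂

        -- Interchanging x and x′ gives x′ two neighbours outside N(x), the images of b and b₃; at
        -- most one of them is b′.
        swapped = two-arc-transitive (co-neighbours (~-sym x~a₁) (~-sym x′~a₁)) x≢x′ x~a₁ x′~a₁ (x≢x′ ∘ sym) x′~a₁ x~a₁
        τ   = proj₁ swapped
        τx  = proj₁ (proj₂ swapped)
        τx′ = proj₂ (proj₂ (proj₂ swapped))

        private-neighbour : ∃[ b″ ] (x′ ~ b″ × ¬ x ~ b″ × b″ ≢ b′)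
        private-neighbour with em {RelIso.to τ b ≡ b′}
        ... | no neq = _ , image-adjacent τ τx refl x~b , x′≁b ∘ preimage-adjacent τ τx′ refl , neq
        ... | yes eq = _ , image-adjacent τ τx refl x~b₃ , x′≁b₃ ∘ preimage-adjacent τ τx′ refl ,
          λ eq′ → b≢b₃ (preimage-≡ τ eq eq′)

        -- Fixing b, x, a₂ and x′ fixes a₁ and hence x″, but moves the vertex b′
        -- of N(x′) ∩ N(x″) = {a₁ , b′}.
        finish : ⊥
        finish with private-neighbour
        ... | b″ , x′~b″ , x≁b″ , b″≢b′
          with move {x′ ∷ a₂ ∷ x ∷ b ∷ []} {b′} {b″} (co-neighbours x′~b′ x′~b″) (avoid x′~b′ x≁b′) (avoid x′~b″ x≁b″)
                 (inj₂ (here (~-sym x′~b′)) , inj₂ (here x′~a₂) , inj₂ (here (~-sym x~a₂)) , inj₂ (here x~b) , inj₁ refl , tt)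
                 (λ { (here refl) → both (~-sym x′~b′) (~-sym x′~b″)
                    ; (there (here refl)) → level x′~a₂
                    ; (there (there (here refl))) → neither (x≁b′ ∘ ~-sym) (x≁b″ ∘ ~-sym)
                    ; (there (there (there (here refl)))) → neither
                        (same-side-nonadjacent (trans (co-neighbours x′~b′ x′~a₂) (co-neighbours x~a₂ x~b)))
                        (same-side-nonadjacent (trans (co-neighbours x′~b″ x′~a₂) (co-neighbours x~a₂ x~b))) })
          where
          avoid : ∀ {c} → x′ ~ c → ¬ x ~ c → c ∉ x′ ∷ a₂ ∷ x ∷ b ∷ []
          avoid e _ (here refl)                         = ~-irrefl refl e
          avoid _ n (there (here refl))                 = n x~a₂
          avoid e _ (there (there (here refl)))         =
            proper e (co-neighbours (~-sym x′~a₁) (~-sym x~a₁))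
          avoid _ n (there (there (there (here refl)))) = n x~b

          level : ∀ {u} → x′ ~ u → b′ ~ u ⇔ b″ ~ u
          level e = neither (same-side-nonadjacent (co-neighbours x′~b′ e)) (same-side-nonadjacent (co-neighbours x′~b″ e))
        ...   | k , kb′ , fix = conclude (x′x″-only x′~b″ (subst (_~ b″) kx″ (image-adjacent k refl kb′ x″~b′)))
          where
          kx′ = fix (here refl)
          kx  = fix (there (there (here refl)))
          kb  = fix (there (there (there (here refl))))

          ka₁ : RelIso.to k a₁ ≡ a₁
          ka₁ with only (image-adjacent k kx refl x~a₁) (image-adjacent k kx′ refl x′~a₁)
          ... | inj₁ eq = eq
          ... | inj₂ eq = contradiction eq (image-≢ k refl (fix (there (here refl))) a₁≢a₂)

          kx″ : RelIso.to k x″ ≡ x″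
          -- Both x″ and its image are adjacent to a₁ and b, which are all the common neighbours of
          -- x and x″.
          kx″ = no-twins sx (image-≢ k kx refl x≢x″) x≢x″ x~a₁ (image-adjacent k refl ka₁ x″~a₁) x″~a₁
            λ x~u x″~u → [ (λ { refl → image-adjacent k refl ka₁ x″~a₁ })
                          , (λ { refl → image-adjacent k refl kb x″~b }) ]′ (x″-only x~u x″~u)

          conclude : b″ ≡ a₁ ⊎ b″ ≡ b′ → ⊥
          conclude (inj₁ refl) = x≁b″ x~a₁
          conclude (inj₂ eq)   = b″≢b′ eq

      abstract
        -- Two omitted vertices contradict `not-three-two` or `not-two-two`, according to whether x
        -- and x′ have a third common neighbour.
        omitted : ∀ {x x′ y} → side x ≡ s → x ≢ x′ → x ~ y → x′ ~ y →
          ∃[ b ] (x ~ b × ¬ x′ ~ b × (∀ {u} → x ~ u → ¬ x′ ~ u → u ≡ b))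
        omitted {x} {x′} {y} sx x≢x′ x~y x′~y with not-contained sx x≢x′ x~y x′~y | another-common sx x≢x′ x~y x′~y
        ... | b , x~b , x′≁b | y′ , y≢y′ , x~y′ , x′~y′ = b , x~b , x′≁b , unique
          where
          unique : ∀ {u} → x ~ u → ¬ x′ ~ u → u ≡ b
          unique {u} x~u x′≁u with em {u ≡ b}
          ... | yes eq = eq
          ... | no u≢b with em {∃[ a ] (x ~ a × x′ ~ a × y ≢ a × y′ ≢ a)}
          ...   | yes (a , x~a , x′~a , y≢a , y′≢a) = ⊥-elim
            (not-three-two x≢x′ x~y x′~y x~y′ x′~y′ x~a x′~a y≢y′ y≢a y′≢a x~u x′≁u x~b x′≁b u≢b)
          ...   | no none = ⊥-elim
            (not-two-two sx x≢x′ x~y x′~y x~y′ x′~y′ y≢y′ only x~u x′≁u x~b x′≁b u≢b)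
            where
            only : ∀ {a} → x ~ a → x′ ~ a → a ≡ y ⊎ a ≡ y′
            only {a} x~a x′~a with em {y ≡ a} | em {y′ ≡ a}
            ... | yes eq | _      = inj₁ (sym eq)
            ... | no _   | yes eq = inj₂ (sym eq)
            ... | no y≢a | no y′≢a = contradiction (a , x~a , x′~a , y≢a , y′≢a) none

      private
        Near : V → V → Set
        Near x x′ = x ≢ x′ × ∃[ y ] (x ~ y × x′ ~ y)

        omit : ∀ {x x′} → side x ≡ s → Near x x′ → ∃[ b ] (x ~ b × ¬ x′ ~ b × (∀ {u} → x ~ u → ¬ x′ ~ u → u ≡ b))
        omit sx (x≢x′ , y , x~y , x′~y) = omitted sx x≢x′ x~y x′~y

        Near-side : ∀ {x x′} → side x ≡ s → Near x x′ → side x′ ≡ s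
        Near-side sx (_ , _ , x~y , x′~y) = trans (co-neighbours (~-sym x′~y) (~-sym x~y)) sx

        Near-sym : ∀ {x x′} → Near x x′ → Near x′ x
        Near-sym (x≢x′ , y , x~y , x′~y) = x≢x′ ∘ sym , y , x′~y , x~y

        unless-omitted : ∀ {x x′ b u} → side x ≡ s → Near x x′ → x ~ b → ¬ x′ ~ b → x ~ u → u ≢ b → x′ ~ u
        unless-omitted {x′ = x′} {u = u} sx near x~b x′≁b x~u u≢b with em {x′ ~ u}
        ... | yes e = e
        ... | no x′≁u with omit sx near
        ...   | _ , _ , _ , unique = contradiction (trans (unique x~u x′≁u) (sym (unique x~b x′≁b))) u≢b

        three₀ : ThreeNeighbours x₀
        three₀ with not-contained refl x₀≢x₁ x₀~y₀ x₁~y₀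
        ... | b , x₀~b , x₁≁b = three x₀~y₀ x₀~y₁ x₀~b y₀≢y₁ (λ { refl → x₁≁b x₁~y₀ }) (λ { refl → x₁≁b x₁~y₁ })

        pick′ : ∀ {x} → side x ≡ s → ∀ u v → ∃[ w ] (x ~ w × w ≢ u × w ≢ v)
        pick′ sx = pick (three-neighbours-transport (sym sx) three₀)

        abstract
          -- If some vertex near x is adjacent to b, exchanging b for the neighbour of x that it
          -- omits gives one that omits b.
          missing : ∀ {x b} → side x ≡ s → x ~ b → ∃[ x′ ] (Near x x′ × ¬ x′ ~ b)
          missing {x} {b} sx x~b with transitive (sym sx)
          ... | g , gx₀ = from-near (image-≢ g gx₀ refl x₀≢x₁ , _ , image-adjacent g gx₀ refl x₀~y₀ , image-adjacent g refl refl x₁~y₀)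
            where
            from-near : ∀ {x′} → Near x x′ → ∃[ x′ ] (Near x x′ × ¬ x′ ~ b)
            from-near {x′} near with em {x′ ~ b} | omit sx near
            ... | no x′≁b  | _ = x′ , near , x′≁b
            ... | yes x′~b | b₁ , x~b₁ , x′≁b₁ , _ with exchange (proj₁ near) x~b x′~b x~b₁ x′≁b₁
            ...   | x″ , x≢x″ , N″ = x″ , (x≢x″ , b₁ , x~b₁ , Equivalence.from (N″ x~b₁) (inj₂ refl)) ,
              (λ { (inj₁ (_ , b≢b)) → b≢b refl ; (inj₂ refl) → x′≁b₁ x′~b }) ∘ Equivalence.to (N″ x~b)

        missing-unique : ∀ {x b x′ x″} → side x ≡ s → x ~ b → Near x x′ → ¬ x′ ~ b → Near x x″ → ¬ x″ ~ b → x′ ≡ x″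
        missing-unique {b = b} sx x~b near′ x′≁b near″ x″≁b with pick′ sx b b
        ... | y , x~y , y≢b , _ = no-twins sx (proj₁ near′) (proj₁ near″) x~y
          (unless-omitted sx near′ x~b x′≁b x~y y≢b) (unless-omitted sx near″ x~b x″≁b x~y y≢b)
          λ x~u x″~u → unless-omitted sx near′ x~b x′≁b x~u λ { refl → x″≁b x″~u }

      abstract
        -- The vertex z is the one neighbour outside N(x) of some x₁ near x. All vertices near x
        -- turn out to share it, so x, the vertices near x, N(x) and z are closed under adjacency.
        antipode : ∀ {x} → side x ≡ s → ∃[ z ] (side x ≢ side z × ¬ x ~ z × (∀ v → v ≡ x ⊎ Near x v ⊎ x ~ v ⊎ v ≡ z))
        antipode {x} sx with neighbour x
        ... | b₀ , x~b₀ with missing sx x~b₀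
        ...   | x₁ , near₁ , x₁≁b₀ with omit (Near-side sx near₁) (Near-sym near₁)
        ...     | z , x₁~z , x≁z , z-unique =
          z , (λ eq → proper x₁~z (trans (trans (Near-side sx near₁) (sym sx)) eq)) , x≁z ,
          λ v → star-induction Q step (connect x v) (inj₁ refl)
          where
          Q : V → Set
          Q v = v ≡ x ⊎ Near x v ⊎ x ~ v ⊎ v ≡ z

          sx₁ : side x₁ ≡ s
          sx₁ = Near-side sx near₁

          -- Otherwise x₁ has two neighbours outside N(x′), namely z and the neighbour of x that x′
          -- omits, contrary to `omitted`.
          common~z : ∀ {x′} → Near x x′ → x′ ~ z
          common~z {x′} near′ with em {x′ ≡ x₁} | em {x′ ~ z}
          ... | _        | yes e   = e
          ... | yes refl | no _    = x₁~z
          ... | no x′≢x₁ | no x′≁z with omit sx near′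
          ...   | b′ , x~b′ , x′≁b′ , _ with em {b′ ≡ b₀}
          ...     | yes refl = contradiction (missing-unique sx x~b₀ near′ x′≁b′ near₁ x₁≁b₀) x′≢x₁
          ...     | no b′≢b₀ with pick′ sx b₀ b′
          ...       | u , x~u , u≢b₀ , u≢b′ with omit sx₁ (x′≢x₁ ∘ sym , u , unless-omitted sx near₁ x~b₀ x₁≁b₀ x~u u≢b₀
                                                                           , unless-omitted sx near′ x~b′ x′≁b′ x~u u≢b′)
          ...         | c , _ , _ , c-unique = contradiction
            (subst (x ~_) (trans (c-unique (unless-omitted sx near₁ x~b₀ x₁≁b₀ x~b′ b′≢b₀) x′≁b′) (sym (c-unique x₁~z x′≁z))) x~b′) x≁z

          step : ∀ {v w} → Q v → v ~ w → Q w
          step (inj₁ refl) x~w = inj₂ (inj₂ (inj₁ x~w))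
          step {v} {w} (inj₂ (inj₁ near)) v~w with em {x ~ w} | omit (Near-side sx near) (Near-sym near)
          ... | yes x~w | _ = inj₂ (inj₂ (inj₁ x~w))
          ... | no x≁w  | _ , _ , _ , unique =
            inj₂ (inj₂ (inj₂ (trans (unique v~w x≁w) (sym (unique (common~z near) x≁z)))))
          step {v} {w} (inj₂ (inj₂ (inj₁ x~v))) v~w with em {w ≡ x}
          ... | yes w≡x = inj₁ w≡x
          ... | no w≢x  = inj₂ (inj₁ (w≢x ∘ sym , v , x~v , ~-sym v~w))
          -- A neighbour w of z omits at most one neighbour of x₁, and x and x₁ share enough
          -- neighbours for w to be adjacent to one of them.
          step {v} {w} (inj₂ (inj₂ (inj₂ refl))) z~w with em {w ≡ x₁}
          ... | yes refl = inj₂ (inj₁ near₁)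
          ... | no w≢x₁ with omit sx₁ (w≢x₁ ∘ sym , z , x₁~z , ~-sym z~w)
          ...   | c , _ , _ , c-unique with pick′ sx b₀ c
          ...     | u , x~u , u≢b₀ , u≢c with em {w ~ u}
          ...       | yes w~u = inj₂ (inj₁ ((λ { refl → x≁z (~-sym z~w) }) , u , x~u , w~u))
          ...       | no w≁u  = contradiction (c-unique (unless-omitted sx near₁ x~b₀ x₁≁b₀ x~u u≢b₀) w≁u) u≢c

      -- On the side of x₀ the mate is the antipode. For v on the other side it is the vertex near a
      -- neighbour x of v that omits v, unique by `missing-unique`.
      coMatching : CoMatching
      coMatching v with em {side v ≡ s}
      ... | yes sv with antipode sv
      ...   | z , sv≢sz , v≁z , cover = z , sv≢sz , v≁z , λ w sv≢sw v≁w → which w sv≢sw v≁w (cover w)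
        where
        which : ∀ w → side v ≢ side w → ¬ v ~ w → w ≡ v ⊎ Near v w ⊎ v ~ w ⊎ w ≡ z → w ≡ z
        which w sv≢sw v≁w (inj₁ refl)                 = contradiction refl sv≢sw
        which w sv≢sw v≁w (inj₂ (inj₁ near))          = contradiction (trans sv (sym (Near-side sv near))) sv≢sw
        which w sv≢sw v≁w (inj₂ (inj₂ (inj₁ v~w)))    = contradiction v~w v≁w
        which w sv≢sw v≁w (inj₂ (inj₂ (inj₂ w≡z)))    = w≡z
      coMatching v | no sv≢s with neighbour v
      ... | x , v~x with trans (¬-not (proper (~-sym v~x))) (sym (¬-not (sv≢s ∘ sym)))
      ...   | sx with missing sx (~-sym v~x) | antipode sx
      ...     | x′ , near′ , x′≁v | z , sx≢sz , _ , cover =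
        x′ , (λ eq → sv≢s (trans eq (Near-side sx near′))) , x′≁v ∘ ~-sym , λ w sv≢sw v≁w → which w sv≢sw v≁w (cover w)
        where
        side-w : ∀ {w} → side v ≢ side w → side w ≡ side x
        side-w sv≢sw = ≢-≢⇒≡ (sv≢sw ∘ sym) (proper v~x)

        which : ∀ w → side v ≢ side w → ¬ v ~ w → w ≡ x ⊎ Near x w ⊎ x ~ w ⊎ w ≡ z → w ≡ x′
        which w sv≢sw v≁w (inj₁ refl)              = contradiction v~x v≁w
        which w sv≢sw v≁w (inj₂ (inj₁ near))       = missing-unique sx (~-sym v~x) near (v≁w ∘ ~-sym) near′ x′≁v
        which w sv≢sw v≁w (inj₂ (inj₂ (inj₁ x~w))) = contradiction (sym (side-w sv≢sw)) (proper x~w)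
        which w sv≢sw v≁w (inj₂ (inj₂ (inj₂ refl))) = contradiction (sym (side-w sv≢sw)) sx≢sz

    four-cycle : Complete ⊎ CoMatching
    four-cycle with em {Σ V λ x → Σ V λ x′ → Σ V λ y → side x ≡ s × x ≢ x′ × x ~ y × x′ ~ y × (∀ {u} → x ~ u → x′ ~ u)}
    ... | yes (_ , _ , _ , sx , x≢x′ , x~y , x′~y , N⊆) = inj₁ (same-neighbourhoods⇒complete sx x≢x′ x~y x′~y N⊆)
    ... | no none = inj₂ (coMatching λ {x} {x′} {y} sx x≢x′ x~y x′~y → witness x x′ y sx x≢x′ x~y x′~y)
      where
      witness : ∀ x x′ y → side x ≡ s → x ≢ x′ → x ~ y → x′ ~ y → ∃[ b ] (x ~ b × ¬ x′ ~ b)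
      witness x x′ y sx x≢x′ x~y x′~y with em {∃[ b ] (x ~ b × ¬ x′ ~ b)}
      ... | yes w = w
      ... | no ¬w = contradiction (x , x′ , y , sx , x≢x′ , x~y , x′~y , λ {u} → contained {u}) none
        where
        contained : ∀ {u} → x ~ u → x′ ~ u
        contained {u} x~u with em {x′ ~ u}
        ... | yes e = e
        ... | no ¬e = contradiction (u , x~u , ¬e) ¬w

-- Graphs without a 4-cycle

alternating⇒even : ∀ m (b : ℕ → Bool) → (∀ i → b (suc i) ≢ b i) → b m ≡ b 0 → 2 ∣ m
alternating⇒even zero          b alt eq = 2 ∣0
alternating⇒even (suc zero)    b alt eq = contradiction eq (alt 0)
alternating⇒even (suc (suc m)) b alt eq = ∣m∣n⇒∣m+n ∣-refl
  (alternating⇒even m b alt (trans (≢-≢⇒≡ {b = b (suc m)} (alt m ∘ sym) (alt (suc m) ∘ sym)) eq))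

module _ {m : ℕ} where

  -- The cycle is unrolled over all natural numbers, so that a path along it may start anywhere
  -- without reduction modulo its length.
  position : ℕ → Fin (suc m)
  position zero    = zero
  position (suc i) = proj₁ (next (position i))

  toℕ-position : ∀ i → i ≤ m → toℕ (position i) ≡ i
  toℕ-position zero    _   = refl
  toℕ-position (suc i) i<m with proj₂ (next (position i)) | toℕ-position i (<⇒≤ i<m)
  ... | inj₁ eq       | ih = trans eq (cong suc ih)
  ... | inj₂ (_ , eq) | ih = contradiction (trans (sym ih) (suc-injective eq)) (ℕ.<⇒≢ i<m)

  position-period : position (suc m) ≡ zero
  position-period with proj₂ (next (position m))
  ... | inj₁ eq       = contradiction (trans eq (cong suc (toℕ-position m ≤-refl))) (ℕ.<⇒≢ (toℕ<n _))
  ... | inj₂ (eq , _) = toℕ-injective eq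

module _ {A : Set} where

  graft : (ℕ → A) → ℕ → A → ℕ → A
  graft f k       u zero    = f zero
  graft f zero    u (suc i) = u
  graft f (suc k) u (suc i) = graft (f ∘ suc) k u i

  graft-≤ : ∀ f {k} u {i} → i ≤ k → graft f k u i ≡ f i
  graft-≤ f         u z≤n       = refl
  graft-≤ f {suc k} u (s≤s i≤k) = graft-≤ (f ∘ suc) u i≤k

  graft-end : ∀ f k u → graft f k u (suc k) ≡ u
  graft-end f zero    u = refl
  graft-end f (suc k) u = graft-end (f ∘ suc) k u

  segment : (ℕ → A) → ℕ → List A
  segment f zero    = f zero ∷ []
  segment f (suc n) = f (suc n) ∷ segment f n

  ∈-segment⁻ : ∀ f n {u} → u ∈ segment f n → ∃[ i ] (i ≤ n × u ≡ f i)
  ∈-segment⁻ f zero    (here eq) = zero , z≤n , eq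
  ∈-segment⁻ f (suc n) (here eq) = suc n , ≤-refl , eq
  ∈-segment⁻ f (suc n) (there m) = let i , i≤n , eq = ∈-segment⁻ f n m in i , m≤n⇒m≤1+n i≤n , eq

  first∈segment : ∀ f n → f 0 ∈ segment f n
  first∈segment f zero    = here refl
  first∈segment f (suc n) = there (first∈segment f n)

  last∈segment : ∀ f n → f n ∈ segment f n
  last∈segment f zero    = here refl
  last∈segment f (suc n) = here refl

module _ (Γ : Graph) where
  open Graph Γ

  segment-built : ∀ {f} n → Walk Γ f n → Built Γ (segment f n)
  segment-built zero    _    = inj₁ refl , tt
  segment-built {f} (suc n) walk = inj₂ (lose (last∈segment f n) (~-sym (walk n ≤-refl))) ,
    segment-built n (λ i i<n → walk i (m≤n⇒m≤1+n i<n))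

  no-chord-from : ∀ i n {p} → 2 ≤ n → NoCycleUpTo Γ (suc n) → Walk Γ p (i + n) → NonBacktracking Γ p (i + n) → ¬ p (i + n) ~ p i
  no-chord-from zero    n 2≤n noCycle walk nb = no-chord Γ n 2≤n noCycle walk nb
  no-chord-from (suc i) n 2≤n noCycle walk nb =
    no-chord-from i n 2≤n noCycle (λ j j<n → walk (suc j) (s≤s j<n)) (λ j j<n → nb (suc j) (s≤s j<n))

  NoCycleUpTo-≤ : ∀ {n n′} → n ≤ n′ → NoCycleUpTo Γ n′ → NoCycleUpTo Γ n
  NoCycleUpTo-≤ n≤n′ noCycle m 3≤m m≤n = noCycle m 3≤m (≤-trans m≤n n≤n′)

  -- Such an edge would close the part of the path from `p i` onwards to a cycle of length at most 2
  -- + k.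
  end-nonadjacent : ∀ {k p i} → NoCycleUpTo Γ (2 + k) → Walk Γ p (suc k) → NonBacktracking Γ p (suc k) → i < k → ¬ p (suc k) ~ p i
  end-nonadjacent {k} {p} {i} noCycle walk nb i<k e with ℕ.m≤n⇒∃[o]m+o≡n (s≤s i<k)
  ... | o , eq = no-chord-from i (2 + o) {p} (s≤s (s≤s z≤n)) (NoCycleUpTo-≤ (s≤s 2+o≤1+k) noCycle)
      (subst (Walk Γ p) (sym eq′) walk) (subst (NonBacktracking Γ p) (sym eq′) nb) (subst (λ n → p n ~ p i) (sym eq′) e)
    where
    eq′ : i + (2 + o) ≡ suc k
    eq′ = trans (ℕ.+-suc i (suc o)) (trans (cong suc (ℕ.+-suc i o)) eq)

    2+o≤1+k : 2 + o ≤ suc k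
    2+o≤1+k = subst (2 + o ≤_) eq′ (ℕ.m≤n+m (2 + o) i)

  shortest-cycle : ExcludedMiddle 0ℓ → ∀ {m} → 3 ≤ m → HasCycle Γ m →
    ∃[ k ] (HasCycle Γ (3 + k) × NoCycleUpTo Γ (2 + k))
  shortest-cycle em {m} = <-rec (λ m → 3 ≤ m → HasCycle Γ m → ∃[ k ] (HasCycle Γ (3 + k) × NoCycleUpTo Γ (2 + k))) shorten m
    where
    shorten : ∀ m → (∀ {l} → l < m → 3 ≤ l → HasCycle Γ l → ∃[ k ] (HasCycle Γ (3 + k) × NoCycleUpTo Γ (2 + k))) →
      3 ≤ m → HasCycle Γ m → ∃[ k ] (HasCycle Γ (3 + k) × NoCycleUpTo Γ (2 + k))
    shorten (suc (suc (suc k))) rec _ c with em {∃[ l ] (l < 3 + k × 3 ≤ l × HasCycle Γ l)}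
    ... | yes (l , l<m , 3≤l , c′) = rec l<m 3≤l c′
    ... | no none = k , c , λ l 3≤l l≤2+k c′ → none (l , s≤s l≤2+k , 3≤l , c′)
    shorten (suc (suc zero)) rec (s≤s (s≤s ()))
    shorten (suc zero) rec (s≤s ())

  module _ {m : ℕ} (cyc : HasCycle Γ (suc m)) where

    around : ℕ → V
    around i = proj₁ cyc (position i)

    around-walk : ∀ i → around i ~ around (suc i)
    around-walk i = proj₂ (proj₂ cyc) (inj₁ (proj₂ (next (position i))))

    around-nonBacktracking : 3 ≤ suc m → ∀ i → around i ≢ around (2 + i)
    around-nonBacktracking 3≤m i eq = Next-asym 3≤m (proj₂ (next (position i)))
      (subst (Next (position (suc i))) (sym (proj₁ (proj₂ cyc) eq)) (proj₂ (next (position (suc i)))))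

    around-period : ∀ i → around (i + suc m) ≡ around i
    around-period i = cong (proj₁ cyc) (go i)
      where
      go : ∀ i → position (i + suc m) ≡ position i
      go zero    = position-period
      go (suc i) = cong (proj₁ ∘ next) (go i)

-- Leaves, trees and girth

module Girth (em : ExcludedMiddle 0ℓ) (Γ : Graph) (M : MovableGraph Γ) where
  open Moves em Γ M

  -- By transitivity on each side all neighbours of u are leaves like v, so the graph is a star with
  -- centre u.
  leaf⇒complete : ∀ {u v} → v ~ u → (∀ {w} → v ~ w → w ≡ u) → Complete
  leaf⇒complete {u} {v} v~u leaf a b sa≢sb with spread a | spread b
    where
    leaf′ : ∀ {v′ w} → u ~ v′ → v′ ~ w → w ≡ u
    leaf′ {v′} {w} u~v′ v′~w with transitive (co-neighbours (~-sym v~u) u~v′)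
    ... | g , gv≡v′ = trans (sym (to∘from g w)) (trans (cong (RelIso.to g)
      (trans (leaf (preimage-adjacent g gv≡v′ (to∘from g w) v′~w)) (sym (leaf (preimage-adjacent g gv≡v′ (to∘from g u) (~-sym u~v′)))))) (to∘from g u))

    spread : ∀ w → w ≡ u ⊎ u ~ w
    spread w = star-induction (λ w → w ≡ u ⊎ u ~ w)
      (λ { (inj₁ refl) e → inj₂ e ; (inj₂ u~w) e → inj₁ (leaf′ u~w e) }) (connect u w) (inj₁ refl)
  ... | inj₁ refl | inj₁ refl = contradiction refl sa≢sb
  ... | inj₁ refl | inj₂ u~b  = u~b
  ... | inj₂ u~a  | inj₁ refl = ~-sym u~a
  ... | inj₂ u~a  | inj₂ u~b  = contradiction (co-neighbours u~a u~b) sa≢sb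

  Leafless : Set
  Leafless = ∀ {u v} → v ~ u → ∃[ w ] (v ~ w × w ≢ u)

  -- Without leaves a walk can go on for ever without turning back, and in an acyclic graph it never
  -- repeats a vertex.
  leafless-acyclic⇒infinite : Leafless → Acyclic Γ → V → Infinite V
  leafless-acyclic⇒infinite leafless acyclic v₀ (n , f) = contradiction (injective⇒≤ (λ {i} {j} → inj {i} {j})) 1+n≰n
    where
    Edge : Set
    Edge = Σ V λ u → Σ V λ v → u ~ v

    advance : Edge → Edge
    advance (u , v , e) = v , proj₁ (leafless (~-sym e)) , proj₁ (proj₂ (leafless (~-sym e)))

    edge : ℕ → Edge
    edge zero    = v₀ , neighbour v₀
    edge (suc i) = advance (edge i)

    inj : Injective _≡_ _≡_ (λ (i : Fin (suc n)) → Inverse.to f (proj₁ (edge (toℕ i))))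
    inj {i} {j} eq = toℕ-injective (reduced-walk-injective Γ n (acyclic⇒noCycle Γ acyclic n)
      (λ i _ → proj₂ (proj₂ (edge i)))
      (λ i _ eq → proj₂ (proj₂ (leafless (~-sym (proj₂ (proj₂ (edge i)))))) (sym eq))
      (≤-pred (toℕ<n i)) (≤-pred (toℕ<n j)) (↔-to-injective f eq))

  neighbours-transport : ∀ {u v n} → side u ≡ side v → HasDegree Γ u n → HasDegree Γ v n
  neighbours-transport eq f with transitive eq
  ... | g , refl = mk↔ₛ′
    (λ { (w , e) → Inverse.to f (RelIso.from g w , preimage-adjacent g refl (to∘from g w) e) })
    (λ i → RelIso.to g (proj₁ (Inverse.from f i)) , preserve g (proj₂ (Inverse.from f i)))
    (λ i → trans (cong (Inverse.to f) (Neighbours-≡ (from∘to g _))) (Inverse.strictlyInverseˡ f i))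
    (λ { (w , e) → Neighbours-≡ (trans (cong (RelIso.to g ∘ proj₁) (Inverse.strictlyInverseʳ f _)) (to∘from g w)) })
    where
    Neighbours-≡ : ∀ {u} {n n′ : Neighbours Γ u} → proj₁ n ≡ proj₁ n′ → n ≡ n′
    Neighbours-≡ refl = cong (_ ,_) (~-irrelevant _ _)

  leafless-acyclic⇒tree : Leafless → Acyclic Γ → V → ∃[ a ] ∃[ b ] IsSemiregularTree a b Γ
  leafless-acyclic⇒tree leafless acyclic v₀ = degreeOn true , degreeOn false , record
    { isTree   = (v₀ , connect) , acyclic
    ; infinite = leafless-acyclic⇒infinite leafless acyclic v₀
    ; side     = side
    ; proper   = proper
    ; degree   = degree
    }
    where
    representative : ∀ s → ∃[ v ] side v ≡ s
    representative s with em {side v₀ ≡ s}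
    ... | yes eq = v₀ , eq
    ... | no neq = proj₁ (neighbour v₀) , ≢-≢⇒≡ (proper (~-sym (proj₂ (neighbour v₀)))) neq

    degreeOn : Bool → ℕ
    degreeOn s = proj₁ (locallyFinite (proj₁ (representative s)))

    degree : ∀ v → HasDegree Γ v (if side v then degreeOn true else degreeOn false)
    degree v = go (side v) refl
      where
      go : ∀ s → side v ≡ s → HasDegree Γ v (if s then degreeOn true else degreeOn false)
      go true  eq = neighbours-transport (trans (proj₂ (representative true)) (sym eq)) (proj₂ (locallyFinite _))
      go false eq = neighbours-transport (trans (proj₂ (representative false)) (sym eq)) (proj₂ (locallyFinite _))

  cycle-even : ∀ {m} → HasCycle Γ (suc m) → 2 ∣ suc m
  cycle-even {m} cyc = alternating⇒even (suc m) (side ∘ around Γ cyc)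
    (λ i → proper (~-sym (around-walk Γ cyc i))) (cong side (around-period Γ cyc 0))

  -- An edge that leaves the cycle, or a chord of it, would give a third neighbour; connectedness
  -- does the rest.
  degree≤2⇒cycle : ∀ {m} → (3≤m : 3 ≤ suc m) → HasCycle Γ (suc m) → (∀ v → ¬ ThreeNeighbours v) → Γ ≅ cycle (suc m) 3≤m
  degree≤2⇒cycle {m} 3≤m (c , c-inj , c-adj) ≤2 = RelIso-sym record
    { bijection = mk↔ₛ′ c (proj₁ ∘ covered) (proj₂ ∘ covered) (λ i → c-inj (proj₂ (covered (c i))))
    ; preserves = mk⇔ c-adj (reflected _ _)
    }
    where
    neighbour-on-cycle : ∀ i {u} → c i ~ u → ∃[ j ] (CycleAdj i j × c j ≡ u)
    neighbour-on-cycle i {u} e with prev i | next i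
    ... | p , p→i | q , i→q with em {c p ≡ u} | em {c q ≡ u}
    ...   | yes eq | _      = p , inj₂ p→i , eq
    ...   | no _   | yes eq = q , inj₁ i→q , eq
    ...   | no p≢u | no q≢u = contradiction
      (three (c-adj (inj₂ p→i)) (c-adj (inj₁ i→q)) e
        (λ eq → Next-asym 3≤m p→i (subst (Next i) (sym (c-inj eq)) i→q)) p≢u q≢u) (≤2 (c i))

    covered : ∀ v → ∃[ i ] c i ≡ v
    covered v = star-induction (λ v → ∃[ i ] c i ≡ v)
      (λ { (i , refl) e → let j , _ , eq = neighbour-on-cycle i e in j , eq }) (connect (c zero) v) (zero , refl)

    reflected : ∀ i j → c i ~ c j → CycleAdj i j
    reflected i j e with neighbour-on-cycle i e
    ... | j′ , adj , eq = subst (CycleAdj i) (c-inj eq) adj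

  module _ (square-free : SquareFree) where

    -- A shortest cycle f₀ … f_{k+2} and a third neighbour u of f_k.  Moving
    -- f_{k+1} to u while fixing f₀ … f_k completes f₀ … f_k u to a cycle too.
    module _ {k j : ℕ} (k≡1+j : k ≡ suc j) {f : ℕ → V} (noCycle : NoCycleUpTo Γ (2 + k))
      (walk : ∀ i → f i ~ f (suc i)) (nb : ∀ i → f i ≢ f (2 + i)) (closed : f (3 + k) ≡ f 0)
      {u : V} (fk~u : f k ~ u) (u≢fj : u ≢ f j) (u≢f1+k : u ≢ f (suc k)) where

      private
        noCycle′ : NoCycleUpTo Γ (suc k)
        noCycle′ = NoCycleUpTo-≤ Γ (n≤1+n _) noCycle

      cycle-injective : InjectiveUpTo Γ f (2 + k)
      cycle-injective = reduced-walk-injective Γ (2 + k) noCycle (λ i _ → walk i) (λ i _ → nb i)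

      private
        grafted : ℕ → V
        grafted = graft f k u

        grafted-walk : Walk Γ grafted (suc k)
        grafted-walk i (s≤s i≤k) with i ℕ.≟ k
        ... | yes refl = subst₂ _~_ (sym (graft-≤ f u i≤k)) (sym (graft-end f i u)) fk~u
        ... | no i≢k   = subst₂ _~_ (sym (graft-≤ f u i≤k)) (sym (graft-≤ f u (≤∧≢⇒< i≤k i≢k))) (walk i)

        grafted-nonBacktracking : NonBacktracking Γ grafted (suc k)
        grafted-nonBacktracking i (s≤s i<k) eq with suc i ℕ.≟ k
        ... | yes refl = u≢fj (trans (sym (graft-end f (suc i) u)) (trans (sym eq)
                           (trans (graft-≤ f u (n≤1+n i)) (cong f (suc-injective k≡1+j)))))
        ... | no 1+i≢k = nb i (trans (sym (graft-≤ f u (<⇒≤ i<k))) (trans eq (graft-≤ f u (≤∧≢⇒< i<k 1+i≢k))))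

        -- Used for the path along the cycle and for the grafted one: in both the last vertex is new
        -- and adjacent only to `f k`, as the move requires.
        extends-path : ∀ p → (∀ {i} → i ≤ k → p i ≡ f i) → Walk Γ p (suc k) → NonBacktracking Γ p (suc k) →
          p (suc k) ∉ segment f k × (∀ {i} → i < k → ¬ p (suc k) ~ f i)
        extends-path p p≡f walk nb = fresh , λ i<k e → end-nonadjacent Γ noCycle walk nb i<k (subst (p (suc k) ~_) (sym (p≡f (<⇒≤ i<k))) e)
          where
          fresh : p (suc k) ∉ segment f k
          fresh m with ∈-segment⁻ f k m
          ... | i , i≤k , eq = contradiction
            (sym (reduced-walk-injective Γ (suc k) noCycle′ walk nb ≤-refl (m≤n⇒m≤1+n i≤k) (trans eq (sym (p≡f i≤k)))))
            (ℕ.<⇒≢ (s≤s i≤k))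

        old = extends-path f (λ _ → refl) (λ i _ → walk i) (λ i _ → nb i)
        new = subst (λ v → v ∉ segment f k × (∀ {i} → i < k → ¬ v ~ f i)) (graft-end f k u)
                (extends-path grafted (graft-≤ f u) grafted-walk grafted-nonBacktracking)

        same : ∀ {w} → w ∈ segment f k → f (suc k) ~ w ⇔ u ~ w
        same m with ∈-segment⁻ f k m
        ... | i , i≤k , refl with i ℕ.≟ k
        ...   | yes refl = both (~-sym (walk k)) (~-sym fk~u)
        ...   | no i≢k   = neither (proj₂ old (≤∧≢⇒< i≤k i≢k)) (proj₂ new (≤∧≢⇒< i≤k i≢k))

      u≢f0 : u ≢ f 0
      u≢f0 refl = proj₁ new (first∈segment f k)

      fk≁f0 : 2 ≤ k → ¬ f k ~ f 0
      fk≁f0 2≤k = no-chord Γ k 2≤k noCycle′ (λ i _ → walk i) (λ i _ → nb i)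

      other-route : ∃[ w ] (u ~ w × w ~ f 0 × w ≢ f (2 + k))
      other-route with move (co-neighbours (walk k) fk~u) (proj₁ old) (proj₁ new)
                         (inj₂ (lose (last∈segment f k) (~-sym (walk k))) , segment-built Γ k (λ i _ → walk i)) same
      ... | g , gf≡u , fix = _ , image-adjacent g gf≡u refl (walk (suc k)) ,
        image-adjacent g refl (fix (first∈segment f k)) (subst (f (2 + k) ~_) closed (walk (2 + k))) ,
        -- If `w` were `f (2 + k)`, then `f (suc k)` and `u` would have `f k` and `f (2 + k)` in
        -- common, a 4-cycle.
        λ eq → nb k (square-free (u≢f1+k ∘ sym) (~-sym (walk k)) (~-sym fk~u) (walk (suc k))
          (subst (u ~_) eq (image-adjacent g gf≡u refl (walk (suc k)))))

      -- The two routes from `f k` to `f 0`, one along the cycle and one through `u` and `w`, close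
      -- to a reduced walk of length 6, although no cycle is that short.
      hexagon : 6 ≤ 2 + k → ⊥
      hexagon 6≤ = close other-route
        where
        close : ∃[ w ] (u ~ w × w ~ f 0 × w ≢ f (2 + k)) → ⊥
        close (w , u~w , w~f0 , w≢f2+k) =
          ℕ.0≢1+n (reduced-walk-injective Γ 6 {h} (NoCycleUpTo-≤ Γ 6≤ noCycle) h-walk h-nb {0} {6} z≤n ≤-refl refl)
          where
          h : ℕ → V
          h 0 = f 0
          h 1 = f (2 + k)
          h 2 = f (suc k)
          h 3 = f k
          h 4 = u
          h 5 = w
          h _ = f 0

          h-walk : Walk Γ h 6
          h-walk 0 _ = ~-sym (subst (f (2 + k) ~_) closed (walk (2 + k)))
          h-walk 1 _ = ~-sym (walk (suc k))
          h-walk 2 _ = ~-sym (walk k)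
          h-walk 3 _ = fk~u
          h-walk 4 _ = u~w
          h-walk 5 _ = w~f0
          h-walk (suc (suc (suc (suc (suc (suc _)))))) (s≤s (s≤s (s≤s (s≤s (s≤s (s≤s ()))))))

          h-nb : NonBacktracking Γ h 6
          h-nb 0 _ eq with () ← cycle-injective z≤n (n≤1+n _) eq
          h-nb 1 _ eq = nb k (sym eq)
          h-nb 2 _ eq = u≢f1+k (sym eq)
          h-nb 3 _ eq = fk≁f0 (≤-trans (s≤s (s≤s z≤n)) (≤-pred (≤-pred 6≤))) (subst (_~ f 0) (sym eq) w~f0)
          h-nb 4 _ eq = u≢f0 eq
          h-nb (suc (suc (suc (suc (suc _))))) (s≤s (s≤s (s≤s (s≤s (s≤s (s≤s ()))))))

    -- The spider has centre f₃ and legs ending in f₁, f₅ and w, all adjacent to f₀. Moving w to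
    -- another neighbour z of u fixes f₁ and f₅, hence their only common neighbour f₀; then w and z
    -- share u and f₀.
    no-girth-6 : ∀ {f : ℕ → V} → NoCycleUpTo Γ 5 → (∀ i → f i ~ f (suc i)) → (∀ i → f i ≢ f (2 + i)) → f 6 ≡ f 0 →
      ¬ ThreeNeighbours (f 3)
    no-girth-6 {f} noCycle walk nb closed thr with pick thr (f 2) (f 4)
    ... | u , f3~u , u≢f2 , u≢f4 = spider other
      where
      u≢f0′ = u≢f0 refl noCycle walk nb closed f3~u u≢f2 u≢f4
      f3≁f0 = fk≁f0 refl noCycle walk nb closed f3~u u≢f2 u≢f4 (s≤s (s≤s z≤n))
      other = other-route refl noCycle walk nb closed f3~u u≢f2 u≢f4

      f1≢f5 : f 1 ≢ f 5
      f1≢f5 eq with () ← cycle-injective refl noCycle walk nb closed f3~u u≢f2 u≢f4 (s≤s z≤n) ≤-refl eq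

      f5~f0 : f 5 ~ f 0
      f5~f0 = subst (f 5 ~_) closed (walk 5)

      F : List V
      F = f 1 ∷ f 5 ∷ f 2 ∷ f 4 ∷ u ∷ f 3 ∷ []

      module _ {c : V} (c~u : c ~ u) (c≢f3 : c ≢ f 3) where

        c-f3 : side c ≡ side (f 3)
        c-f3 = co-neighbours (~-sym c~u) (~-sym f3~u)

        c≁f2 : ¬ c ~ f 2
        c≁f2 e = u≢f2 (square-free c≢f3 c~u f3~u e (~-sym (walk 2)))

        c≁f4 : ¬ c ~ f 4
        c≁f4 e = u≢f4 (square-free c≢f3 c~u f3~u e (walk 3))

        c∉F : c ∉ F
        c∉F (here refl)                                 = c≁f2 (walk 1)
        c∉F (there (here refl))                         = c≁f4 (~-sym (walk 4))
        c∉F (there (there (here refl)))                 = proper (walk 2) c-f3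
        c∉F (there (there (there (here refl))))         = proper (walk 3) (sym c-f3)
        c∉F (there (there (there (there (here refl))))) = ~-irrefl refl c~u
        c∉F (there (there (there (there (there (here refl)))))) = c≢f3 refl

      spider : ∃[ w ] (u ~ w × w ~ f 0 × w ≢ f 5) → ⊥
      spider (w , u~w , w~f0 , w≢f5) with pick thr-u (f 3) w
        where
        -- The assumption concerns the side of f₃; the side of u also contains f₀, whose neighbours
        -- f₁, f₅ and w are distinct.
        thr-u : ThreeNeighbours u
        thr-u = three-neighbours-transport
          (trans (≢-≢⇒≡ (proper (walk 0)) (proper (walk 1))) (co-neighbours (~-sym (walk 2)) f3~u))
          (three (walk 0) (~-sym f5~f0) (~-sym w~f0) f1≢f5
            (λ { refl → c≁f2 (~-sym u~w) (λ eq → f3≁f0 (subst (_~ f 0) eq w~f0)) (walk 1) })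
            (w≢f5 ∘ sym))
      ... | z , u~z , z≢f3 , z≢w with move {F} {w} {z} (co-neighbours u~w u~z) (c∉F (~-sym u~w) w≢f3) (c∉F (~-sym u~z) z≢f3)
              ( inj₂ (there (there (there (there (here (~-sym u~w))))))
              , inj₂ (there (here (walk 1)))
              , inj₂ (there (here (~-sym (walk 4))))
              , inj₂ (there (there (here (walk 2))))
              , inj₂ (there (here (~-sym (walk 3))))
              , inj₂ (here (~-sym f3~u))
              , inj₁ refl , tt)
              same
        where
        w≢f3 : w ≢ f 3
        w≢f3 eq = f3≁f0 (subst (_~ f 0) eq w~f0)

        level : ∀ {v} → side v ≡ side (f 3) → w ~ v ⇔ z ~ v
        level eq = neither (same-side-nonadjacent (trans (c-f3 (~-sym u~w) w≢f3) (sym eq)))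
                           (same-side-nonadjacent (trans (c-f3 (~-sym u~z) z≢f3) (sym eq)))

        same : ∀ {v} → v ∈ F → w ~ v ⇔ z ~ v
        same (here refl)                                 = level (co-neighbours (~-sym (walk 1)) (walk 2))
        same (there (here refl))                         = level (co-neighbours (walk 4) (~-sym (walk 3)))
        same (there (there (here refl)))                 = neither (c≁f2 (~-sym u~w) w≢f3) (c≁f2 (~-sym u~z) z≢f3)
        same (there (there (there (here refl))))         = neither (c≁f4 (~-sym u~w) w≢f3) (c≁f4 (~-sym u~z) z≢f3)
        same (there (there (there (there (here refl))))) = both (~-sym u~w) (~-sym u~z)
        same (there (there (there (there (there (here refl)))))) = level refl
      ...   | g , gw≡z , fix = u≢f0′ (square-free z≢w (~-sym u~z) (~-sym u~w)
                (image-adjacent g gw≡z gf0≡f0 w~f0) w~f0)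
        where
        gf0≡f0 : RelIso.to g (f 0) ≡ f 0
        gf0≡f0 = square-free f1≢f5
          (image-adjacent g (fix (here refl)) refl (~-sym (walk 0)))
          (image-adjacent g (fix (there (here refl))) refl f5~f0) (~-sym (walk 0)) f5~f0

    private
      -- The girth is 3 + k. Lengths 3 and 5 contradict the sides, length 4 the absence of squares,
      -- and from length 7 on a 6-cycle is too short.
      girth : ∀ k {f : ℕ → V} → NoCycleUpTo Γ (2 + k) → (∀ i → f i ~ f (suc i)) → (∀ i → f i ≢ f (2 + i)) → f (3 + k) ≡ f 0 →
        ¬ ThreeNeighbours (f k)
      girth 0 {f} _ walk nb closed _ =
        proper (walk 2) (trans (≢-≢⇒≡ (proper (~-sym (walk 1))) (proper (~-sym (walk 0)))) (cong side (sym closed)))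
      girth 1 {f} _ walk nb closed _ =
        nb 1 (square-free (nb 0) (walk 0) (~-sym (walk 1)) (~-sym (subst (f 3 ~_) closed (walk 3))) (walk 2))
      girth 2 {f} _ walk nb closed _ =
        proper (walk 4) (trans (≢-≢⇒≡ (proper (~-sym (walk 3))) (proper (~-sym (walk 2))))
          (trans (≢-≢⇒≡ (proper (~-sym (walk 1))) (proper (~-sym (walk 0)))) (cong side (sym closed))))
      girth 3 noCycle walk nb closed thr = no-girth-6 noCycle walk nb closed thr
      girth (suc (suc (suc (suc k)))) noCycle walk nb closed thr with pick thr _ _
      ... | u , fk~u , u≢fj , u≢f1+k =
        hexagon refl noCycle walk nb closed fk~u u≢fj u≢f1+k (s≤s (s≤s (s≤s (s≤s (s≤s (s≤s z≤n))))))

    three-neighbours⇒no-cycle : ∀ {v} → ThreeNeighbours v → ∀ {m} → 3 ≤ m → ¬ HasCycle Γ m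
    three-neighbours⇒no-cycle {v} thr 3≤m c with shortest-cycle Γ em 3≤m c
    ... | k , cyc , noCycle with em {side v ≡ side (around Γ cyc k)}
    ...   | yes eq = girth k noCycle (around-walk Γ cyc) (around-nonBacktracking Γ cyc (s≤s (s≤s (s≤s z≤n))))
                       (around-period Γ cyc 0) (three-neighbours-transport eq thr)
    -- Starting the cycle one vertex later puts a vertex of the other side in place k.
    ...   | no neq = girth k noCycle (around-walk Γ cyc ∘ suc) (around-nonBacktracking Γ cyc (s≤s (s≤s (s≤s z≤n))) ∘ suc)
                       (around-period Γ cyc 1) (three-neighbours-transport (≢-≢⇒≡ neq (proper (around-walk Γ cyc k))) thr)

-- Recognition of the listed graphs and the equivalence

module _ (em : ExcludedMiddle 0ℓ) (Δ : BipartiteGraph) (locallyFinite : LocallyFinite (graph Δ)) where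
  open BipartiteGraph Δ
  open Graph (graph Δ) using (_~_)

  private
    -- The extra point stands for the one vertex on the other side that `v` is not adjacent to in
    -- the complement of a matching.
    part-finite : ∀ {A : Set} (v : X ⊎ Y) (f : A → Neighbours (graph Δ) v ⊎ ⊤) →
      (∀ {a a′} → f a ≡ f a′ → a ≡ a′) → Finite A
    part-finite {A} v f f-inj = finite-injection em (suc (proj₁ (locallyFinite v))) (code ∘ f)
      (λ {a} {a′} eq → f-inj (code-injective (f a) (f a′) eq))
      where
      code : Neighbours (graph Δ) v ⊎ ⊤ → Fin (suc (proj₁ (locallyFinite v)))
      code (inj₁ n)  = suc (Inverse.to (proj₂ (locallyFinite v)) n)
      code (inj₂ tt) = zero

      code-injective : ∀ p q → code p ≡ code q → p ≡ q
      code-injective (inj₁ _)  (inj₁ _)  eq = cong inj₁ (↔-to-injective (proj₂ (locallyFinite v)) (Fin.suc-injective eq))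
      code-injective (inj₂ tt) (inj₂ tt) _  = refl

  complete⇒completeBipartite : X → Y → (∀ x y → E x y) → ∃[ m ] ∃[ n ] graph Δ ≅ graph (completeBipartite m n)
  complete⇒completeBipartite x₀ y₀ complete = proj₁ finX , proj₁ finY , record
    { bijection = mk↔ₛ′ to from
        (λ { (inj₁ i) → cong inj₁ (FX.strictlyInverseˡ i) ; (inj₂ j) → cong inj₂ (FY.strictlyInverseˡ j) })
        (λ { (inj₁ x) → cong inj₁ (FX.strictlyInverseʳ x) ; (inj₂ y) → cong inj₂ (FY.strictlyInverseʳ y) })
    ; preserves = λ {u} {v} → adjacent u v
    }
    where
    finX : Finite X
    finX = part-finite (inj₂ y₀) (λ x → inj₁ (inj₁ x , complete x y₀)) (inj₁-injective ∘ cong proj₁ ∘ inj₁-injective)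

    finY : Finite Y
    finY = part-finite (inj₁ x₀) (λ y → inj₁ (inj₂ y , complete x₀ y)) (inj₂-injective ∘ cong proj₁ ∘ inj₁-injective)

    module FX = Inverse (proj₂ finX)
    module FY = Inverse (proj₂ finY)

    to : X ⊎ Y → Fin (proj₁ finX) ⊎ Fin (proj₁ finY)
    to (inj₁ x) = inj₁ (FX.to x)
    to (inj₂ y) = inj₂ (FY.to y)

    from : Fin (proj₁ finX) ⊎ Fin (proj₁ finY) → X ⊎ Y
    from (inj₁ i) = inj₁ (FX.from i)
    from (inj₂ j) = inj₂ (FY.from j)

    adjacent : ∀ u v → u ~ v ⇔ Graph._~_ (graph (completeBipartite (proj₁ finX) (proj₁ finY))) (to u) (to v)
    adjacent (inj₁ x) (inj₂ y) = mk⇔ (λ _ → tt) (λ _ → complete x y)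
    adjacent (inj₂ y) (inj₁ x) = mk⇔ (λ _ → tt) (λ _ → complete x y)
    adjacent (inj₁ _) (inj₁ _) = mk⇔ (λ ()) (λ ())
    adjacent (inj₂ _) (inj₂ _) = mk⇔ (λ ()) (λ ())

  -- X is numbered through the mates in Y, which makes the matching the identity.
  coMatching⇒matchingComplement : X →
    (∀ x → ∃[ y ] (¬ E x y × (∀ y′ → ¬ E x y′ → y′ ≡ y))) →
    (∀ y → ∃[ x ] (¬ E x y × (∀ x′ → ¬ E x′ y → x′ ≡ x))) →
    ∃[ n ] Σ (Fin n ↔ Fin n) λ η → graph Δ ≅ graph (matchingComplement η)
  coMatching⇒matchingComplement x₀ mateX mateY = n , η , record
    { bijection = mk↔ₛ′ to from
        (λ { (inj₁ i) → cong inj₁ (trans (cong FY.to (mate-mateY _)) (FY.strictlyInverseˡ i)) ; (inj₂ j) → cong inj₂ (FY.strictlyInverseˡ j) })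
        (λ { (inj₁ x) → cong inj₁ (trans (cong (proj₁ ∘ mateY) (FY.strictlyInverseʳ _)) (mate-mateX x)) ; (inj₂ y) → cong inj₂ (FY.strictlyInverseʳ y) })
    ; preserves = λ {u} {v} → adjacent u v
    }
    where
    mate-mateX : ∀ x → proj₁ (mateY (proj₁ (mateX x))) ≡ x
    mate-mateX x = sym (proj₂ (proj₂ (mateY _)) x (proj₁ (proj₂ (mateX x))))

    mate-mateY : ∀ y → proj₁ (mateX (proj₁ (mateY y))) ≡ y
    mate-mateY y = sym (proj₂ (proj₂ (mateX _)) y (proj₁ (proj₂ (mateY y))))

    finY : Finite Y
    finY = part-finite (inj₁ x₀) code code-injective
      where
      code : Y → Neighbours (graph Δ) (inj₁ x₀) ⊎ ⊤
      code y with em {E x₀ y}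
      ... | yes e = inj₁ (inj₂ y , e)
      ... | no _  = inj₂ tt

      code-injective : ∀ {y y′} → code y ≡ code y′ → y ≡ y′
      code-injective {y} {y′} eq with em {E x₀ y} | em {E x₀ y′}
      ... | yes _ | yes _  = inj₂-injective (cong proj₁ (inj₁-injective eq))
      ... | no ¬e | no ¬e′ = trans (proj₂ (proj₂ (mateX x₀)) y ¬e) (sym (proj₂ (proj₂ (mateX x₀)) y′ ¬e′))
      code-injective () | yes _ | no _
      code-injective () | no _  | yes _

    n : ℕ
    n = proj₁ finY

    module FY = Inverse (proj₂ finY)

    η : Fin n ↔ Fin n
    η = mk↔ₛ′ id id (λ _ → refl) (λ _ → refl)

    to : X ⊎ Y → Fin n ⊎ Fin n
    to (inj₁ x) = inj₁ (FY.to (proj₁ (mateX x)))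
    to (inj₂ y) = inj₂ (FY.to y)

    from : Fin n ⊎ Fin n → X ⊎ Y
    from (inj₁ i) = inj₁ (proj₁ (mateY (FY.from i)))
    from (inj₂ j) = inj₂ (FY.from j)

    edge : ∀ x y → E x y ⇔ FY.to y ≢ FY.to (proj₁ (mateX x))
    edge x y = mk⇔
      (λ e eq → proj₁ (proj₂ (mateX x)) (subst (E x) (↔-to-injective (proj₂ finY) eq) e))
      (λ neq → double-negation em λ ¬e → neq (cong FY.to (proj₂ (proj₂ (mateX x)) y ¬e)))

    adjacent : ∀ u v → u ~ v ⇔ Graph._~_ (graph (matchingComplement η)) (to u) (to v)
    adjacent (inj₁ x) (inj₂ y) = edge x y
    adjacent (inj₂ y) (inj₁ x) = edge x y
    adjacent (inj₁ _) (inj₁ _) = mk⇔ (λ ()) (λ ())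
    adjacent (inj₂ _) (inj₂ _) = mk⇔ (λ ()) (λ ())

module _ (em : ExcludedMiddle 0ℓ) (Γ : Graph) (M : MovableGraph Γ) where
  open Moves em Γ M
  open FourCycle em Γ M
  open Girth em Γ M

  -- Leaves are separated before acyclicity is considered, because a finite star is acyclic without
  -- being an infinite semiregular tree.
  classification : V → Complete ⊎ CoMatching ⊎ (∃[ m ] Σ (3 ≤ m) λ 3≤m → 2 ∣ m × Γ ≅ cycle m 3≤m)
    ⊎ (∃[ a ] ∃[ b ] IsSemiregularTree a b Γ)
  classification v₀ with em {Σ V λ u → Σ V λ v → v ~ u × (∀ {w} → v ~ w → w ≡ u)}
  ... | yes (u , v , v~u , leaf) = inj₁ (leaf⇒complete v~u leaf)
  ... | no ¬leaf with em {∃[ m ] (3 ≤ m × HasCycle Γ m)}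
  ...   | no ¬cycle = inj₂ (inj₂ (inj₂ (leafless-acyclic⇒tree leafless
    (λ 3≤m c c-inj c-adj → ¬cycle (_ , 3≤m , c , c-inj , λ {i} {j} → c-adj {i} {j})) v₀)))
    where
    leafless : Leafless
    leafless {u} {v} v~u with em {∃[ w ] (v ~ w × w ≢ u)}
    ... | yes w = w
    ... | no ¬w = contradiction (u , v , v~u , λ {w} v~w → double-negation em λ w≢u → ¬w (w , v~w , w≢u)) ¬leaf
  ...   | yes (suc m , 3≤m , c) with em {Σ V λ u → Σ V λ v → Σ V λ a → Σ V λ b → u ≢ v × a ≢ b × u ~ a × v ~ a × u ~ b × v ~ b}
  ...     | yes (_ , _ , _ , _ , u≢v , a≢b , ua , va , ub , vb) with four-cycle u≢v a≢b ua va ub vb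
  ...       | inj₁ complete   = inj₁ complete
  ...       | inj₂ coMatching = inj₂ (inj₁ coMatching)
  classification v₀ | no _ | yes (suc m , 3≤m , c) | no ¬square with em {Σ V ThreeNeighbours}
  ... | yes (v , thr) = contradiction c (three-neighbours⇒no-cycle square-free thr 3≤m)
    where
    square-free : SquareFree
    square-free {u} {v} {a} {b} u≢v ua va ub vb =
      double-negation em λ a≢b → ¬square (u , v , a , b , u≢v , a≢b , ua , va , ub , vb)
  ... | no ≤2 = inj₂ (inj₂ (inj₁ (suc m , 3≤m , cycle-even c , degree≤2⇒cycle 3≤m c λ v thr → ≤2 (v , thr))))

Listed : BipartiteGraph → Set
Listed Δ =
  (∃[ m ] Σ (3 ≤ m) λ 3≤m → 2 ∣ m × graph Δ ≅ cycle m 3≤m)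
  ⊎ (∃[ a ] ∃[ b ] IsSemiregularTree a b (graph Δ))
  ⊎ (∃[ m ] ∃[ n ] graph Δ ≅ graph (completeBipartite m n))
  ⊎ (∃[ n ] Σ (Fin n ↔ Fin n) λ η → graph Δ ≅ graph (matchingComplement η))

listed⇒homogeneous : ExcludedMiddle 0ℓ → ∀ Δ → Listed Δ → Homogeneous (graph Δ)
listed⇒homogeneous em Δ (inj₁ (m , 3≤m , _ , iso))          = Homogeneous-resp-≅ iso (cycle-homogeneous em m 3≤m)
listed⇒homogeneous em Δ (inj₂ (inj₁ (_ , _ , semiregular))) = tree-homogeneous em semiregular
listed⇒homogeneous em Δ (inj₂ (inj₂ (inj₁ (m , n , iso))))  = Homogeneous-resp-≅ iso (completeBipartite-homogeneous em m n)
listed⇒homogeneous em Δ (inj₂ (inj₂ (inj₂ (_ , η , iso))))  = Homogeneous-resp-≅ iso (matchingComplement-homogeneous em η)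

movable⇒listed : ExcludedMiddle 0ℓ → ∀ Δ → BipartiteGraph.X Δ → BipartiteGraph.Y Δ → LocallyFinite (graph Δ) →
  (∀ u v → Star (Graph._~_ (graph Δ)) u v) → Movable (graph Δ) (sideOf Δ) → Listed Δ
movable⇒listed em Δ x₀ y₀ locallyFinite connect move = listed (classification em (graph Δ) M (inj₁ x₀))
  where
  open BipartiteGraph Δ
  open Graph (graph Δ) using (_~_)

  neighbour : ∀ v → ∃[ u ] v ~ u
  neighbour (inj₁ x) with connect (inj₁ x) (inj₂ y₀)
  ... | _◅_ {j = u} e _ = u , e
  neighbour (inj₂ y) with connect (inj₂ y) (inj₁ x₀)
  ... | _◅_ {j = u} e _ = u , e

  M : MovableGraph (graph Δ)
  M = record
    { side          = sideOf Δ
    ; proper        = λ {u} {v} → sideOf-proper Δ {u} {v}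
    ; connect       = connect
    ; locallyFinite = locallyFinite
    ; neighbour     = neighbour
    ; move          = move
    }

  open Moves em (graph Δ) M using (Complete; CoMatching)

  listed : Complete ⊎ CoMatching ⊎ (∃[ m ] Σ (3 ≤ m) λ 3≤m → 2 ∣ m × graph Δ ≅ cycle m 3≤m)
    ⊎ (∃[ a ] ∃[ b ] IsSemiregularTree a b (graph Δ)) → Listed Δ
  listed (inj₁ complete) = inj₂ (inj₂ (inj₁ (complete⇒completeBipartite em Δ locallyFinite x₀ y₀
    λ x y → complete (inj₁ x) (inj₂ y) λ ())))
  listed (inj₂ (inj₁ coMatching)) = inj₂ (inj₂ (inj₂ (coMatching⇒matchingComplement em Δ locallyFinite x₀ mateX mateY)))
    where
    mateX : ∀ x → ∃[ y ] (¬ E x y × (∀ y′ → ¬ E x y′ → y′ ≡ y))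
    mateX x with coMatching (inj₁ x)
    ... | inj₁ _ , opposite , _ = contradiction refl opposite
    ... | inj₂ y , _ , ¬e , unique = y , ¬e , λ y′ ¬e′ → inj₂-injective (unique (inj₂ y′) (λ ()) ¬e′)

    mateY : ∀ y → ∃[ x ] (¬ E x y × (∀ x′ → ¬ E x′ y → x′ ≡ x))
    mateY y with coMatching (inj₂ y)
    ... | inj₂ _ , opposite , _ = contradiction refl opposite
    ... | inj₁ x , _ , ¬e , unique = x , ¬e , λ x′ ¬e′ → inj₁-injective (unique (inj₁ x′) (λ ()) ¬e′)
  listed (inj₂ (inj₂ (inj₁ cyc)))  = inj₁ cyc
  listed (inj₂ (inj₂ (inj₂ tree))) = inj₂ (inj₁ tree)

theorem4p7 : ExcludedMiddle 0ℓ →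
    (Δ : BipartiteGraph) →
    Connected (graph Δ) → EdgeTransitive (graph Δ) → LocallyFinite (graph Δ) →
    (T : Digraph) → IsTree (underlying T) →
    (φ : ∀ t → Digraph.In T t ↔ BipartiteGraph.X Δ) →
    (ψ : ∀ t → Digraph.Out T t ↔ BipartiteGraph.Y Δ) →
    ConnectedHomogeneous (DL Δ T φ ψ) ⇔
    ( (∃[ m ] Σ (3 ≤ m) λ 3≤m → 2 ∣ m × graph Δ ≅ cycle m 3≤m)
    ⊎ (∃[ a ] ∃[ b ] IsSemiregularTree a b (graph Δ))
    ⊎ (∃[ m ] ∃[ n ] graph Δ ≅ graph (completeBipartite m n))
    ⊎ (∃[ n ] Σ (Fin n ↔ Fin n) λ η → graph Δ ≅ graph (matchingComplement η)) )
theorem4p7 em Δ connected _ locallyFinite T tree φ ψ = mk⇔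
  (λ ch → movable⇒listed em Δ (proj₁ inhabited) (proj₂ inhabited) locallyFinite (proj₂ connected)
            (local-move em Δ T φ ψ t₀ connected ch))
  (homogeneous⇒DL-connectedHomogeneous em Δ T φ ψ tree connected ∘ listed⇒homogeneous em Δ)
  where
  open BipartiteGraph Δ

  t₀ : Digraph.V T
  t₀ = proj₁ (proj₁ tree)

  -- A vertex in X gives `t₀` an in-neighbour, which has `t₀` as an out-neighbour, so Y is inhabited
  -- as well; dually for a vertex in Y.
  inhabited : X × Y
  inhabited with proj₁ connected
  ... | inj₁ x = x , Inverse.to (ψ _) (t₀ , proj₂ (Inverse.from (φ t₀) x))
  ... | inj₂ y = Inverse.to (φ _) (t₀ , proj₂ (Inverse.from (ψ t₀) y)) , y
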